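{- Let $(G,\sigma)$ be a $\frac{10}{3}$-critical signed graph which is isomorphic neither to the digon $\widetilde{K}_2$ nor to $(K_4,-)$. Then $|E(G)|\ge \frac{3|V(G)|+1}{2}$; equivalently $3|V(G)|-2|E(G)|\le -1$.
   Context: A signed graph $(G,\sigma)$ is a (multi)graph $G$ with a sign assignment $\sigma:E(G)\to\{+,-\}$. The digon $\widetilde{K}_2$ is the signed multigraph on two vertices joined by two parallel edges, one positive and one negative; $(K_4,-)$ is $K_4$ with all edges negative. Switching a vertex reverses the signs of all edges incident to it; isomorphism of signed graphs is understood up to switching. For integers $p\ge 2q>0$ with $p$ even, $K^s_{p;q}$ has vertex set $\{0,\dots,p-1\}$, with $ij$ a negative edge iff $q\le|i-j|\le p-q$ and a positive edge iff $|i-j|\le\frac p2-q$ or $|i-j|\ge\frac p2+q$ (loops included when $i=j$). A signed graph admits a circular $\frac{10}{3}$-coloring if there is a map $f:V(G)\to V(K^s_{10;3})$ sending each edge $uv$ to an edge $f(u)f(v)$ of the same sign. A signed graph is $\frac{10}{3}$-critical if it admits no circular $\frac{10}{3}$-coloring but every proper subgraph does.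
   Formalization: The signed graph G is taken to be loopless: a single vertex with one negative loop would be 10/3-critical and violate the bound, and no other 10/3-critical signed graph has a loop. -}

module Defs where

open import Data.Nat using (ℕ; _≤_; _+_; _*_; ∣_-_∣)
open import Data.Fin using (Fin; toℕ; zero; suc)
open import Data.Bool using (Bool; true; false; _xor_)
open import Data.Product using (Σ; ∃; _×_; _,_)
open import Data.Sum using (_⊎_)
open import Relation.Nullary using (¬_)
open import Relation.Binary.PropositionalEquality using (_≡_; _≢_)
open import Function.Bundles using (_↔_; Inverse)

data Sign : Set where
  plus minus : Sign

flipIf : Bool → Sign → Sign
flipIf false s = s
flipIf true plus = minus
flipIf true minus = plus

record SignedGraph : Set where
  field
    nV    : ℕ
    nE    : ℕ
    src   : Fin nE → Fin nV
    tgt   : Fin nE → Fin nV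
    sign  : Fin nE → Sign
    loopless : (e : Fin nE) → src e ≢ tgt e
open SignedGraph public

K10-3-Edge : Sign → Fin 10 → Fin 10 → Set
K10-3-Edge minus i j = (3 ≤ ∣ toℕ i - toℕ j ∣) × (∣ toℕ i - toℕ j ∣ ≤ 7)
K10-3-Edge plus  i j = (∣ toℕ i - toℕ j ∣ ≤ 2) ⊎ (8 ≤ ∣ toℕ i - toℕ j ∣)

record Subgraph (G : SignedGraph) : Set where
  field
    inV : Fin (nV G) → Bool
    inE : Fin (nE G) → Bool
    closed : (e : Fin (nE G)) → inE e ≡ true →
             (inV (src G e) ≡ true) × (inV (tgt G e) ≡ true)
open Subgraph public

Proper : {G : SignedGraph} → Subgraph G → Set
Proper {G} H = (∃ λ (v : Fin (nV G)) → inV H v ≡ false)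
             ⊎ (∃ λ (e : Fin (nE G)) → inE H e ≡ false)

-- The subgraph H admits a circular 10/3-coloring: a map on its vertices
-- (extended arbitrarily to the other vertices of G, which is harmless)
-- sending each edge of H to an edge of K^s_{10;3} of the same sign.
SubColorable : {G : SignedGraph} → Subgraph G → Set
SubColorable {G} H =
  Σ (Fin (nV G) → Fin 10) λ f →
    (e : Fin (nE G)) → inE H e ≡ true →
      K10-3-Edge (sign G e) (f (src G e)) (f (tgt G e))

Colorable : SignedGraph → Set
Colorable G =
  Σ (Fin (nV G) → Fin 10) λ f →
    (e : Fin (nE G)) → K10-3-Edge (sign G e) (f (src G e)) (f (tgt G e))

Critical : SignedGraph → Set
Critical G = (¬ Colorable G) × ((H : Subgraph G) → Proper H → SubColorable H)

SwitchIso : SignedGraph → SignedGraph → Set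
SwitchIso G H =
  Σ (Fin (nV G) ↔ Fin (nV H)) λ φ →
  Σ (Fin (nE G) ↔ Fin (nE H)) λ ψ →
  Σ (Fin (nV G) → Bool) λ δ →
    (e : Fin (nE G)) →
      (  ((src H (Inverse.to ψ e) ≡ Inverse.to φ (src G e))
          × (tgt H (Inverse.to ψ e) ≡ Inverse.to φ (tgt G e)))
       ⊎ ((src H (Inverse.to ψ e) ≡ Inverse.to φ (tgt G e))
          × (tgt H (Inverse.to ψ e) ≡ Inverse.to φ (src G e))))
      × (sign H (Inverse.to ψ e)
           ≡ flipIf (δ (src G e) xor δ (tgt G e)) (sign G e))

digon : SignedGraph
digon = record
  { nV = 2 ; nE = 2
  ; src = λ _ → zero
  ; tgt = λ _ → suc zero
  ; sign = λ { zero → plus ; (suc _) → minus }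
  ; loopless = λ _ ()
  }

K4src : Fin 6 → Fin 4
K4src zero = zero
K4src (suc zero) = zero
K4src (suc (suc zero)) = zero
K4src (suc (suc (suc zero))) = suc zero
K4src (suc (suc (suc (suc zero)))) = suc zero
K4src (suc (suc (suc (suc (suc zero))))) = suc (suc zero)

K4tgt : Fin 6 → Fin 4
K4tgt zero = suc zero
K4tgt (suc zero) = suc (suc zero)
K4tgt (suc (suc zero)) = suc (suc (suc zero))
K4tgt (suc (suc (suc zero))) = suc (suc zero)
K4tgt (suc (suc (suc (suc zero)))) = suc (suc (suc zero))
K4tgt (suc (suc (suc (suc (suc zero))))) = suc (suc (suc zero))

K4loopless : (e : Fin 6) → K4src e ≢ K4tgt e
K4loopless zero ()
K4loopless (suc zero) ()
K4loopless (suc (suc zero)) ()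
K4loopless (suc (suc (suc zero))) ()
K4loopless (suc (suc (suc (suc zero)))) ()
K4loopless (suc (suc (suc (suc (suc zero))))) ()

K4minus : SignedGraph
K4minus = record
  { nV = 4 ; nE = 6
  ; src = K4src ; tgt = K4tgt
  ; sign = λ _ → minus
  ; loopless = K4loopless
  }

{-# OPTIONS --safe #-}

-- The colouring problem is generalised: besides signed edges ("strong" constraints, of cost 2) it has the weak
-- constraints that paths of two edges impose (of cost 1), and some vertices are precoloured.  The potential of a set
-- is 3 for every vertex minus the cost of the constraints it meets inside the set and the precoloured vertices.  If
-- all potentials are nonnegative and there is no negative K₄, then the precolouring extends.  A critical graph with
-- 2|E| ≤ 3|V| would therefore be colourable: colour a set of least potential by criticality, and extend.
--
-- In a minimal counterexample to the extension statement every proper nonempty set has positive potential, because a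
-- tight set could be coloured first.  This slack pays for the constraints added when a vertex of degree two or three,
-- or a small configuration, is deleted.  Such reductions and a discharging argument (the average degree is at most 3)
-- leave a cubic graph without negative triangles.  Switch it so that the fewest edges are negative: they form a
-- matching, and the colours 0, ±1, ±2 suffice.
module Submission where

open import Defs
open import Data.Nat using (ℕ; zero; suc; _+_; _*_; _∸_; _≤_; _<_; z≤n; s≤s; _≤ᵇ_; _<ᵇ_; _<?_; ∣_-_∣)
import Data.Nat
open import Data.Nat.Properties using (≤-trans; ≤-refl; ≤-reflexive; ≤-antisym; m≤m+n; m≤n+m; +-mono-≤; +-monoˡ-≤; +-monoʳ-≤; +-comm; +-assoc; +-identityʳ; +-cancelʳ-≤; +-cancelˡ-≤; *-zeroʳ; *-suc; *-monoʳ-≤; *-distribˡ-+; *-cancelˡ-<; ≤ᵇ⇒≤; ≤⇒≤ᵇ; <⇒≱; ≰⇒>; ≮⇒≥; n≤1+n; _≤?_; ∣-∣-comm)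
import Data.Nat.Properties
open import Data.Nat.Tactic.RingSolver using (solve-∀)
open import Data.Fin using (Fin; toℕ; zero; suc; _≟_; #_)
open import Data.Fin.Properties using (any?; toℕ-injective)
open import Data.Bool using (Bool; true; false; _∧_; _∨_; not; _xor_; T; if_then_else_)
open import Data.Bool.Properties using (∧-comm; ∨-comm; xor-comm)
import Data.Bool.Properties
open import Data.List using (List; []; _∷_; _++_; length; map; filterᵇ; allFin)
open import Data.List.Properties using (length-++; length-map; length-tabulate; ++-assoc; ++-identityʳ)
open import Data.List.Membership.Propositional using (_∈_; _∉_; find)
open import Data.List.Membership.Propositional.Properties using (∈-∃++; ∈-++⁺ˡ; ∈-++⁺ʳ; ∈-++⁻; ∈-map⁺; ∈-allFin)
open import Data.List.Relation.Unary.Any using (here; there)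
open import Data.List.Relation.Unary.All using (All; []; _∷_)
import Data.List.Relation.Unary.All as All
import Data.List.Relation.Unary.All.Properties as AllP
open import Data.List.Relation.Unary.AllPairs using ([]; _∷_)
open import Data.List.Relation.Unary.Unique.Propositional using (Unique)
import Data.List.Relation.Unary.Unique.Propositional.Properties as UP
open import Data.List.Relation.Binary.Subset.Propositional using (_⊆_)
open import Data.Product using (∃; _×_; _,_; proj₁; proj₂)
open import Data.Sum using (_⊎_; inj₁; inj₂; [_,_]′)
open import Data.Empty using (⊥; ⊥-elim)
open import Data.Unit using (⊤; tt)
open import Data.Maybe using (Maybe; just; nothing)
open import Function using (_∘_; id; case_of_)
open import Function.Bundles using (mk↔ₛ′)
open import Relation.Nullary using (¬_; Dec; yes; no; does)
open import Relation.Nullary.Decidable using (map′; _×-dec_; _⊎-dec_; _→-dec_; toWitness)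
open import Relation.Binary.PropositionalEquality using (_≡_; _≢_; refl; sym; trans; cong; cong₂; subst; subst₂; module ≡-Reasoning)

-- Switching a vertex acts on its colour as the antipodal map of the ten-cycle. Every edge therefore
-- confines an end to five consecutive colours, and a path of two edges forbids a single colour.
-- This fixes the costs: a vertex with two edges contributes 3 - 4 to a potential, and the weak
-- constraint left by its deletion has exactly that weight.
--
-- A negative K₄ has potential 12 - 12 and no colouring, so it has to be excluded apart from the
-- potentials. This is the main obstacle. A vertex with two edges that also carries weak constraints
-- is best replaced by a new edge, since the colours of its ends then leave it three choices instead
-- of one; but the new edge may close a negative K₄. What is left in that case is a kite, K₄ with
-- one edge subdivided.
--
-- Kites and negative triangles are rigid, but they have colourings in which no two colours are
-- equal or antipodal. Such a pattern meets all weak constraints inside, and can be rotated: each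
-- weak constraint to the outside spoils one of the ten rotations.

pattern 1st = here refl
pattern 2nd = there 1st
pattern 3rd = there 2nd
pattern 4th = there 3rd
pattern 5th = there 4th

-- Booleans and finite quantifiers

∧-elim : ∀ {a b} → a ∧ b ≡ true → (a ≡ true) × (b ≡ true)
∧-elim {true} {true} _ = refl , refl

∧-intro : ∀ {a b} → a ≡ true → b ≡ true → a ∧ b ≡ true
∧-intro refl refl = refl

infixr 3 _⇒_
_⇒_ : Bool → Bool → Bool
a ⇒ b = not a ∨ b

true≢false : ∀ {b} → b ≡ true → b ≡ false → ⊥
true≢false refl ()

Bool-cases : (b : Bool) → (b ≡ true) ⊎ (b ≡ false)
Bool-cases true  = inj₁ refl
Bool-cases false = inj₂ refl

allF : ∀ {n} → (Fin n → Bool) → Bool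
allF {zero}  p = true
allF {suc n} p = p zero ∧ allF (p ∘ suc)

allF-elim : ∀ {n} (p : Fin n → Bool) → allF p ≡ true → ∀ i → p i ≡ true
allF-elim p h zero    = proj₁ (∧-elim h)
allF-elim p h (suc i) = allF-elim (p ∘ suc) (proj₂ (∧-elim {p zero} h)) i

anyF : ∀ {n} → (Fin n → Bool) → Bool
anyF {zero}  p = false
anyF {suc n} p = p zero ∨ anyF (p ∘ suc)

anyF-elim : ∀ {n} (p : Fin n → Bool) → anyF p ≡ true → ∃ λ i → p i ≡ true
anyF-elim {suc n} p h with p zero in eq
... | true  = zero , eq
... | false with anyF-elim (p ∘ suc) h
...   | i , q = suc i , q

-- Lists without repetition

private variable
  𝔸 𝔹 : Set

∑ : List 𝔸 → (𝔸 → ℕ) → ℕ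
∑ []       g = 0
∑ (x ∷ xs) g = g x + ∑ xs g

∑-++ : (xs ys : List 𝔸) (g : 𝔸 → ℕ) → ∑ (xs ++ ys) g ≡ ∑ xs g + ∑ ys g
∑-++ []       ys g = refl
∑-++ (x ∷ xs) ys g = trans (cong (g x +_) (∑-++ xs ys g)) (sym (+-assoc (g x) _ _))

∑-mono : (xs : List 𝔸) {g h : 𝔸 → ℕ} → (∀ {x} → x ∈ xs → g x ≤ h x) → ∑ xs g ≤ ∑ xs h
∑-mono []       _ = z≤n
∑-mono (x ∷ xs) p = +-mono-≤ (p 1st) (∑-mono xs (p ∘ there))

∑-cong : (xs : List 𝔸) {g h : 𝔸 → ℕ} → (∀ {x} → x ∈ xs → g x ≡ h x) → ∑ xs g ≡ ∑ xs h
∑-cong []       _ = refl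
∑-cong (x ∷ xs) p = cong₂ _+_ (p 1st) (∑-cong xs (p ∘ there))

∑-const : (xs : List 𝔸) (k : ℕ) → ∑ xs (λ _ → k) ≡ k * length xs
∑-const []       k = sym (*-zeroʳ k)
∑-const (x ∷ xs) k = trans (cong (k +_) (∑-const xs k)) (sym (*-suc k (length xs)))

interchange : ∀ a b c d → (a + b) + (c + d) ≡ (a + c) + (b + d)
interchange = solve-∀

∑-+ : (xs : List 𝔸) (g h : 𝔸 → ℕ) → ∑ xs (λ x → g x + h x) ≡ ∑ xs g + ∑ xs h
∑-+ []       g h = refl
∑-+ (x ∷ xs) g h = trans (cong (g x + h x +_) (∑-+ xs g h)) (interchange (g x) (h x) _ _)

∑-swap : (xs : List 𝔸) (ys : List 𝔹) (g : 𝔸 → 𝔹 → ℕ) →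
  ∑ xs (λ x → ∑ ys (g x)) ≡ ∑ ys (λ y → ∑ xs (λ x → g x y))
∑-swap []       ys g = sym (∑-const ys 0)
∑-swap (x ∷ xs) ys g = trans (cong (∑ ys (g x) +_) (∑-swap xs ys g)) (sym (∑-+ ys (g x) _))

∑-0 : (xs : List 𝔸) {g : 𝔸 → ℕ} → (∀ {x} → x ∈ xs → g x ≡ 0) → ∑ xs g ≡ 0
∑-0 xs p = trans (∑-cong xs p) (∑-const xs 0)

term≤∑ : {xs : List 𝔸} {x : 𝔸} (g : 𝔸 → ℕ) → x ∈ xs → g x ≤ ∑ xs g
term≤∑ g 1st = m≤m+n _ _
term≤∑ {xs = y ∷ xs} g (there m) = ≤-trans (term≤∑ g m) (m≤n+m _ (g y))

-- Adding the hypothesis to both sides reduces a linear goal to a semiring identity.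
lin : ∀ {a b A B} k → a ≤ b → A + b + k ≡ B + a → A ≤ B
lin {a} {b} {A} {B} k h e =
  +-cancelʳ-≤ b A B (≤-trans (m≤m+n (A + b) k) (≤-trans (≤-reflexive e) (+-monoʳ-≤ B h)))

-- The differences of `h` and `g` are nonnegative and sum to at most zero. The discharging ends with
-- this.
∑-tight : (xs : List 𝔸) {g h : 𝔸 → ℕ} → (∀ {x} → x ∈ xs → g x ≤ h x) → ∑ xs h ≤ ∑ xs g →
  ∀ {x} → x ∈ xs → h x ≤ g x
∑-tight (y ∷ xs) {g} {h} p q 1st =
  +-cancelʳ-≤ (∑ xs g) (h y) (g y) (≤-trans (+-monoʳ-≤ (h y) (∑-mono xs (p ∘ there))) q)
∑-tight (y ∷ xs) {g} {h} p q (there m) =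
  ∑-tight xs (p ∘ there) (+-cancelˡ-≤ (h y) _ _ (≤-trans q (+-monoˡ-≤ _ (p 1st)))) m

∉⇒All≢ : {x : 𝔸} {xs : List 𝔸} → x ∉ xs → All (λ y → x ≢ y) xs
∉⇒All≢ {xs = []}     p = []
∉⇒All≢ {xs = y ∷ xs} p = (λ { refl → p 1st }) ∷ ∉⇒All≢ (p ∘ there)

All≢⇒∉ : {x : 𝔸} {xs : List 𝔸} → All (λ y → x ≢ y) xs → x ∉ xs
All≢⇒∉ p m = All.lookup p m refl

infixr 5 _∷ᵘ_
_∷ᵘ_ : {x : 𝔸} {xs : List 𝔸} → x ∉ xs → Unique xs → Unique (x ∷ xs)
p ∷ᵘ u = ∉⇒All≢ p ∷ u

Unique-head : {x : 𝔸} {xs : List 𝔸} → Unique (x ∷ xs) → x ∉ xs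
Unique-head (p ∷ _) = All≢⇒∉ p

Unique-tail : {x : 𝔸} {xs : List 𝔸} → Unique (x ∷ xs) → Unique xs
Unique-tail (_ ∷ u) = u

Unique-++ : {xs ys : List 𝔸} → Unique xs → Unique ys → (∀ {x} → x ∈ xs → x ∉ ys) → Unique (xs ++ ys)
Unique-++ u v d = UP.++⁺ u v (λ { (a , b) → d a b })

Unique-++ˡ : (xs : List 𝔸) {ys : List 𝔸} → Unique (xs ++ ys) → Unique xs
Unique-++ˡ []       u       = []
Unique-++ˡ (x ∷ xs) (p ∷ u) = AllP.++⁻ˡ xs p ∷ Unique-++ˡ xs u

Unique-++ʳ : (xs : List 𝔸) {ys : List 𝔸} → Unique (xs ++ ys) → Unique ys
Unique-++ʳ []       u       = u
Unique-++ʳ (x ∷ xs) (p ∷ u) = Unique-++ʳ xs u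

Unique-++-disjoint : (xs : List 𝔸) {ys : List 𝔸} → Unique (xs ++ ys) → ∀ {x} → x ∈ xs → x ∉ ys
Unique-++-disjoint (x ∷ xs) u 1st m = Unique-head u (∈-++⁺ʳ xs m)
Unique-++-disjoint (x ∷ xs) u (there k)   m = Unique-++-disjoint xs (Unique-tail u) k m

∑-⊆ : (g : 𝔸 → ℕ) {xs ys : List 𝔸} → Unique xs → xs ⊆ ys → ∑ xs g ≤ ∑ ys g
∑-⊆ g {[]}     u s = z≤n
∑-⊆ g {x ∷ xs} u s with ∈-∃++ (s 1st)
... | as , bs , refl = ≤-trans (+-monoʳ-≤ (g x) (∑-⊆ g (Unique-tail u) sub)) (≤-reflexive eq)
  where
    sub : xs ⊆ (as ++ bs)
    sub {y} m with ∈-++⁻ as (s (there m))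
    ... | inj₁ q           = ∈-++⁺ˡ q
    ... | inj₂ 1st = ⊥-elim (Unique-head u m)
    ... | inj₂ (there q)   = ∈-++⁺ʳ as q
    shuffle : ∀ a b c → a + (b + c) ≡ b + (a + c)
    shuffle = solve-∀
    eq : g x + ∑ (as ++ bs) g ≡ ∑ (as ++ x ∷ bs) g
    eq = trans (cong (g x +_) (∑-++ as bs g))
         (trans (shuffle (g x) (∑ as g) (∑ bs g)) (sym (∑-++ as (x ∷ bs) g)))

length≡∑ : (xs : List 𝔸) → length xs ≡ ∑ xs (λ _ → 1)
length≡∑ []       = refl
length≡∑ (x ∷ xs) = cong suc (length≡∑ xs)

length-⊆ : {xs ys : List 𝔸} → Unique xs → xs ⊆ ys → length xs ≤ length ys
length-⊆ {xs = xs} {ys} u s = subst₂ _≤_ (sym (length≡∑ xs)) (sym (length≡∑ ys)) (∑-⊆ (λ _ → 1) u s)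

module _ {n : ℕ} where
  open import Data.List.Membership.DecPropositional (_≟_ {n}) public using (_∈?_)

  infixl 6 _∖_
  opaque
    _∖_ : List (Fin n) → List (Fin n) → List (Fin n)
    []       ∖ R = []
    (x ∷ xs) ∖ R with x ∈? R
    ... | yes _ = xs ∖ R
    ... | no  _ = x ∷ (xs ∖ R)

    ∈-∖⁺ : ∀ {x xs R} → x ∈ xs → x ∉ R → x ∈ xs ∖ R
    ∈-∖⁺ {xs = y ∷ xs} {R} 1st q with y ∈? R
    ... | yes r = ⊥-elim (q r)
    ... | no  _ = 1st
    ∈-∖⁺ {xs = y ∷ xs} {R} (there p) q with y ∈? R
    ... | yes _ = ∈-∖⁺ p q
    ... | no  _ = there (∈-∖⁺ p q)

    ∈-∖⁻ : ∀ {x} xs {R} → x ∈ xs ∖ R → (x ∈ xs) × (x ∉ R)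
    ∈-∖⁻ (y ∷ xs) {R} m with y ∈? R
    ... | yes _ = let a , b = ∈-∖⁻ xs m in there a , b
    ... | no  q with m
    ...   | 1st = 1st , q
    ...   | there m′  = let a , b = ∈-∖⁻ xs m′ in there a , b

    Unique-∖ : ∀ {xs R} → Unique xs → Unique (xs ∖ R)
    Unique-∖ {[]} u = []
    Unique-∖ {x ∷ xs} {R} u with x ∈? R
    ... | yes _ = Unique-∖ (Unique-tail u)
    ... | no  _ = (λ m → Unique-head u (proj₁ (∈-∖⁻ xs m))) ∷ᵘ Unique-∖ (Unique-tail u)

  ∖-⊆ : ∀ {xs R} → (xs ∖ R) ⊆ xs
  ∖-⊆ {xs} m = proj₁ (∈-∖⁻ xs m)

  length-missing : ∀ {xs ys : List (Fin n)} {z} → Unique xs → xs ⊆ ys → z ∈ ys → z ∉ xs → length xs < length ys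
  length-missing {xs} {ys} {z} u s z∈ z∉ =
    length-⊆ {xs = z ∷ xs} (z∉ ∷ᵘ u) (λ { 1st → z∈ ; (there m) → s m })

  covers : ∀ {xs ys : List (Fin n)} → Unique xs → xs ⊆ ys → length ys ≤ length xs → ys ⊆ xs
  covers {xs} u s l {z} z∈ with z ∈? xs
  ... | yes q = q
  ... | no  q = ⊥-elim (<⇒≱ (length-missing u s z∈ q) l)

  length-≤n : ∀ {xs : List (Fin n)} → Unique xs → length xs ≤ n
  length-≤n u = ≤-trans (length-⊆ u (λ {x} _ → ∈-allFin x))
    (≤-reflexive (length-tabulate {n = n} id))

  pigeonhole : ∀ (xs ys : List (Fin n)) → Unique xs → length ys < length xs → ∃ λ x → (x ∈ xs) × (x ∉ ys)
  pigeonhole xs ys u l with All.all? (λ x → x ∈? ys) xs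
  ... | yes a = ⊥-elim (<⇒≱ l (length-⊆ u (All.lookup a)))
  ... | no ¬a = find (AllP.¬All⇒Any¬ (λ x → x ∈? ys) xs ¬a)

∈filterᵇ : (p : 𝔸 → Bool) (xs : List 𝔸) {x : 𝔸} → x ∈ filterᵇ p xs → (x ∈ xs) × (p x ≡ true)
∈filterᵇ p (y ∷ xs) m with p y in eq
∈filterᵇ p (y ∷ xs) 1st | true  = 1st , eq
∈filterᵇ p (y ∷ xs) (there m)   | true  = let a , b = ∈filterᵇ p xs m in there a , b
... | false = let a , b = ∈filterᵇ p xs m in there a , b

filterᵇ∈ : (p : 𝔸 → Bool) {xs : List 𝔸} {x : 𝔸} → x ∈ xs → p x ≡ true → x ∈ filterᵇ p xs
filterᵇ∈ p {y ∷ xs} 1st h with p y | h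
... | true | _ = 1st
filterᵇ∈ p {y ∷ xs} (there m) h with p y
... | true  = there (filterᵇ∈ p m h)
... | false = filterᵇ∈ p m h

Unique-filterᵇ : (p : 𝔸 → Bool) {xs : List 𝔸} → Unique xs → Unique (filterᵇ p xs)
Unique-filterᵇ p {[]} u = []
Unique-filterᵇ p {x ∷ xs} u with p x
... | true  = (λ m → Unique-head u (proj₁ (∈filterᵇ p xs m))) ∷ᵘ Unique-filterᵇ p (Unique-tail u)
... | false = Unique-filterᵇ p (Unique-tail u)

𝟙 : Bool → ℕ
𝟙 true  = 1
𝟙 false = 0

length-filterᵇ : (p : 𝔸 → Bool) (xs : List 𝔸) → length (filterᵇ p xs) ≡ ∑ xs (𝟙 ∘ p)
length-filterᵇ p [] = refl
length-filterᵇ p (x ∷ xs) with p x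
... | true  = cong suc (length-filterᵇ p xs)
... | false = length-filterᵇ p xs

-- The target K^s_{10;3}

Color : Set
Color = Fin 10

near : ℕ → Bool
near 0 = true
near 1 = true
near 2 = true
near 3 = false
near 4 = false
near 5 = false
near 6 = false
near 7 = false
near _ = true

opaque
  okS : Sign → Color → Color → Bool
  okS plus  i j = near ∣ toℕ i - toℕ j ∣
  okS minus i j = not (near ∣ toℕ i - toℕ j ∣)

near-sound : ∀ k → near k ≡ true → (k ≤ 2) ⊎ (8 ≤ k)
near-sound 0 _ = inj₁ z≤n
near-sound 1 _ = inj₁ (s≤s z≤n)
near-sound 2 _ = inj₁ (s≤s (s≤s z≤n))
near-sound (suc (suc (suc (suc (suc (suc (suc (suc k)))))))) _ = inj₂ (≤ᵇ⇒≤ 8 (8 + k) tt)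

far-sound : ∀ k → not (near k) ≡ true → (3 ≤ k) × (k ≤ 7)
far-sound 3 _ = ≤ᵇ⇒≤ 3 3 tt , ≤ᵇ⇒≤ 3 7 tt
far-sound 4 _ = ≤ᵇ⇒≤ 3 4 tt , ≤ᵇ⇒≤ 4 7 tt
far-sound 5 _ = ≤ᵇ⇒≤ 3 5 tt , ≤ᵇ⇒≤ 5 7 tt
far-sound 6 _ = ≤ᵇ⇒≤ 3 6 tt , ≤ᵇ⇒≤ 6 7 tt
far-sound 7 _ = ≤ᵇ⇒≤ 3 7 tt , ≤ᵇ⇒≤ 7 7 tt

opaque
  unfolding okS

  okS-sound : ∀ s i j → okS s i j ≡ true → K10-3-Edge s i j
  okS-sound plus  i j h = near-sound _ h
  okS-sound minus i j h = far-sound _ h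

  okS-complete : ∀ s i j → K10-3-Edge s i j → okS s i j ≡ true
  okS-complete plus i j h with near ∣ toℕ i - toℕ j ∣ in eq
  ... | true = refl
  ... | false with far-sound ∣ toℕ i - toℕ j ∣ (cong not eq) | h
  ...   | a , b | inj₁ c = ⊥-elim (<⇒≱ a c)
  ...   | a , b | inj₂ c = ⊥-elim (<⇒≱ c b)
  okS-complete minus i j (a , b) with near ∣ toℕ i - toℕ j ∣ in eq
  ... | false = refl
  ... | true with near-sound ∣ toℕ i - toℕ j ∣ eq
  ...   | inj₁ c = ⊥-elim (<⇒≱ a c)
  ...   | inj₂ c = ⊥-elim (<⇒≱ c b)

  okS-sym : ∀ s i j → okS s i j ≡ true → okS s j i ≡ true
  okS-sym plus  i j h = trans (cong near (∣-∣-comm (toℕ j) (toℕ i))) h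
  okS-sym minus i j h = trans (cong (not ∘ near) (∣-∣-comm (toℕ j) (toℕ i))) h

infixl 7 _·_
_·_ : Sign → Sign → Sign
plus  · s     = s
minus · plus  = minus
minus · minus = plus

isMinus : Sign → Bool
isMinus plus  = false
isMinus minus = true

next : Color → Color
next zero = suc zero
next (suc zero) = suc (suc zero)
next (suc (suc zero)) = suc (suc (suc zero))
next (suc (suc (suc zero))) = suc (suc (suc (suc zero)))
next (suc (suc (suc (suc zero)))) = suc (suc (suc (suc (suc zero))))
next (suc (suc (suc (suc (suc zero))))) = suc (suc (suc (suc (suc (suc zero)))))
next (suc (suc (suc (suc (suc (suc zero)))))) = suc (suc (suc (suc (suc (suc (suc zero))))))
next (suc (suc (suc (suc (suc (suc (suc zero))))))) = suc (suc (suc (suc (suc (suc (suc (suc zero)))))))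
next (suc (suc (suc (suc (suc (suc (suc (suc zero)))))))) = suc (suc (suc (suc (suc (suc (suc (suc (suc zero))))))))
next (suc (suc (suc (suc (suc (suc (suc (suc (suc zero))))))))) = zero

opaque
  shift : ℕ → Color → Color
  shift zero    i = i
  shift (suc k) i = shift k (next i)

  anti : Color → Color
  anti = shift 5

eqC : Color → Color → Bool
eqC i j = ∣ toℕ i - toℕ j ∣ Data.Nat.≡ᵇ 0

-- A weak constraint of sign σ between two vertices is what a path of two edges with sign product σ
-- imposes: it excludes the antipode if σ = plus, and equality if σ = minus.
excl : Sign → Color → Color
excl plus  j = anti j
excl minus j = j

opaque
  weakOK : Sign → Color → Color → Bool
  weakOK σ i j = not (eqC i (excl σ j))

eqC-refl : ∀ i → eqC i i ≡ true
eqC-refl = allF-elim (λ i → eqC i i) refl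

opaque
  unfolding shift

  anti-anti : ∀ i → anti (anti i) ≡ i
  anti-anti zero = refl
  anti-anti (suc zero) = refl
  anti-anti (suc (suc zero)) = refl
  anti-anti (suc (suc (suc zero))) = refl
  anti-anti (suc (suc (suc (suc zero)))) = refl
  anti-anti (suc (suc (suc (suc (suc zero))))) = refl
  anti-anti (suc (suc (suc (suc (suc (suc zero)))))) = refl
  anti-anti (suc (suc (suc (suc (suc (suc (suc zero))))))) = refl
  anti-anti (suc (suc (suc (suc (suc (suc (suc (suc zero)))))))) = refl
  anti-anti (suc (suc (suc (suc (suc (suc (suc (suc (suc zero))))))))) = refl

eqC-sound : ∀ i j → eqC i j ≡ true → i ≡ j
eqC-sound i j h = toℕ-injective
  (Data.Nat.Properties.∣m-n∣≡0⇒m≡n (Data.Nat.Properties.≡ᵇ⇒≡ _ 0 (subst T (sym h) tt)))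

opaque
  unfolding weakOK

  weakOK-intro : ∀ σ i j → i ≢ excl σ j → weakOK σ i j ≡ true
  weakOK-intro σ i j h with eqC i (excl σ j) in eq
  ... | false = refl
  ... | true  = ⊥-elim (h (eqC-sound i (excl σ j) eq))

  weakOK-sym : ∀ σ i j → weakOK σ i j ≡ true → weakOK σ j i ≡ true
  weakOK-sym σ i j h = weakOK-intro σ j i λ e →
    true≢false h (cong not (trans (cong (λ z → eqC z (excl σ j)) (inv σ e)) (eqC-refl (excl σ j))))
    where
      inv : ∀ σ → j ≡ excl σ i → i ≡ excl σ j
      inv plus  refl = sym (anti-anti i)
      inv minus refl = refl

-- Counting colours and deciding finite statements

colors : List Color
colors = allFin 10

cand : (Color → Bool) → List Color
cand p = filterᵇ p colors

opaque
  cnt : (Color → Bool) → ℕ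
  cnt p = length (cand p)

  pick : (p : Color → Bool) (E : List Color) → length E < cnt p → ∃ λ k → (p k ≡ true) × (k ∉ E)
  pick p E l with pigeonhole (cand p) E (Unique-filterᵇ p (UP.allFin⁺ 10)) l
  ... | k , m , q = k , proj₂ (∈filterᵇ p colors m) , q

≤ᵇ-elim : ∀ {m n} → (m ≤ᵇ n) ≡ true → m ≤ n
≤ᵇ-elim {m} {n} h = ≤ᵇ⇒≤ m n (subst T (sym h) tt)

allF? : ∀ {n} {Q : Fin n → Set} → (∀ i → Dec (Q i)) → Dec (∀ i → Q i)
allF? {zero}  q = yes λ ()
allF? {suc n} q = map′ (λ { (a , b) zero → a ; (a , b) (suc i) → b i }) (λ h → h zero , h ∘ suc)
  (q zero ×-dec allF? (q ∘ suc))

allS? : {Q : Sign → Set} → (∀ s → Dec (Q s)) → Dec (∀ s → Q s)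
allS? q = map′ (λ { (a , b) plus → a ; (a , b) minus → b }) (λ h → h plus , h minus) (q plus ×-dec q minus)

allB? : {Q : Bool → Set} → (∀ b → Dec (Q b)) → Dec (∀ b → Q b)
allB? q = map′ (λ { (a , b) true → a ; (a , b) false → b }) (λ h → h true , h false) (q true ×-dec q false)

chk : ∀ {b} → Dec (b ≡ true)
chk {true}  = yes refl
chk {false} = no λ ()

-- A false premise settles the case without a look at `Q`. The larger checks below therefore state a
-- premise as soon as its colours or signs are bound, which prunes the enumeration.
imp? : ∀ {b} {Q : Set} → Dec Q → Dec (b ≡ true → Q)
imp? {true}  q = map′ (λ x _ → x) (λ h → h refl) q
imp? {false} q = yes λ ()

ex? : ∀ {m} {Q : Fin m → Set} → (∀ i → Dec (Q i)) → Dec (∃ Q)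
ex? {zero}  q = no λ ()
ex? {suc m} q = map′ [ (zero ,_) , (λ { (i , x) → suc i , x }) ]′
  (λ { (zero , x) → inj₁ x ; (suc i , x) → inj₂ (i , x) }) (q zero ⊎-dec ex? (q ∘ suc))

-- Colourings of negative triangles, diamonds and kites

infix 4 _✓
_✓ : Bool → Set
b ✓ = b ≡ true

negTri : Sign → Sign → Sign → Bool
negTri p q r = isMinus (p · q · r)

-- Neither equal nor antipodal, so that weak constraints of both signs hold.
trivial : Color → Color → Bool
trivial i j = weakOK plus i j ∧ weakOK minus i j

-- An edge of sign `q` to a vertex of colour `j` acts like a positive edge to colour `eff q j`.
-- Signs of edges that leave a configuration are absorbed in this way, and the exhaustive checks
-- take them to be `plus`.
eff : Sign → Color → Color
eff plus  = id
eff minus = anti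

-- For a negative triangle with the colour of b fixed, the pairs of colours of a and u
-- (a, u) = b + (3,6), (4,7), (6,3), (7,4), up to switching, are pairwise disjoint.
flip36 : Color → Color
flip36 (suc (suc (suc zero))) = suc (suc (suc (suc (suc (suc zero)))))
flip36 (suc (suc (suc (suc zero)))) = suc (suc (suc (suc (suc (suc (suc zero))))))
flip36 (suc (suc (suc (suc (suc (suc zero)))))) = suc (suc (suc zero))
flip36 (suc (suc (suc (suc (suc (suc (suc zero))))))) = suc (suc (suc (suc zero)))
flip36 i = i

partner : Sign → Sign → Color → Color → Color
partner ab ub b k = shift (toℕ b) (eff (minus · ub) (flip36 (eff (minus · ab) (shift (10 ∸ toℕ b) k))))

-- A vertex of a rotating pattern gets the base colour `r`, moved by its place `m` in the pattern
-- and switched by `q`. The inverse `ρ⁻` pulls a forbidden colour of the vertex back to a forbidden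
-- base colour.
ρ ρ⁻ : ℕ → Sign → Color → Color
ρ  m q r = shift m (eff q r)
ρ⁻ m q k = eff q (shift (10 ∸ m) k)

opaque
  unfolding okS shift weakOK cnt

  -- Arguments named after an edge are its sign, those named after a vertex its colour.

  okS-5 : ∀ q i → 5 ≤ cnt (λ k → okS q k i)
  okS-5 = toWitness {a? = allS? λ _ → allF? λ _ → 5 ≤? _} tt

  cnt-true : 10 ≤ cnt (λ _ → true)
  cnt-true = ≤ᵇ⇒≤ 10 10 tt

  -- Two intervals of five among ten cyclic colours are disjoint only if they are complementary,
  -- that is, if their centres are antipodal.
  path-extends : ∀ p q i j → weakOK (p · q) i j ✓ → ∃ λ k → okS p k i ✓ × okS q k j ✓
  path-extends = toWitness {a? = allS? λ _ → allS? λ _ → allF? λ _ → allF? λ _ → imp? (ex? λ _ → chk ×-dec chk)} tt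

  -- The centres of the two intervals of five are at distance at most 2, so the intervals share at
  -- least three colours.
  edge-extends : ∀ p q i j → okS (p · q) i j ✓ → 3 ≤ cnt (λ k → okS p k i ∧ okS q k j)
  edge-extends = toWitness {a? = allS? λ _ → allS? λ _ → allF? λ _ → allF? λ _ → imp? (3 ≤? _)} tt

  -- With all three edges switched to negative, the colours are pairwise at distance at least 3, so
  -- the gaps around the circle are 3, 3 and 4. Weak constraints inside a coloured negative triangle
  -- hold automatically.
  negTri-trivial : ∀ p q r i j k → negTri p q r ✓ → okS p i j ✓ → okS q i k ✓ → okS r j k ✓ → trivial i j ✓
  negTri-trivial = toWitness {a? = allS? λ _ → allS? λ _ → allS? λ _ → allF? λ _ → allF? λ _ → allF? λ _ →
    imp? (imp? (imp? (imp? chk)))} tt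

  -- The triangle on u, a, b is negative, and a has one more neighbour α.
  tri-pendant : ∀ ua ub ab aα b α → negTri ua ub ab ✓ → weakOK (ab · aα) b α ✓ →
    ∃ λ a → okS ab a b ✓ × okS aα a α ✓ × 2 ≤ cnt (λ u → okS ua u a ∧ okS ub u b)
  tri-pendant = toWitness {a? = allS? λ _ → allS? λ _ → allS? λ _ → allS? λ _ → allF? λ _ → allF? λ _ →
    imp? (imp? (ex? λ _ → chk ×-dec chk ×-dec (2 ≤? _)))} tt

  -- Up to switching, `vw` is negative. A colour of `v` at distance exactly 3 from that of `w`
  -- leaves two colours for the apex of either triangle, and there are two such colours of `v`.
  diamond : ∀ vw v₁ w₁ v₂ w₂ w → negTri v₁ w₁ vw ✓ → negTri v₂ w₂ vw ✓ →
    2 ≤ cnt (λ v → okS vw v w ∧ (2 ≤ᵇ cnt λ u → okS v₁ u v ∧ okS w₁ u w) ∧ (2 ≤ᵇ cnt λ u → okS v₂ u v ∧ okS w₂ u w))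
  diamond = toWitness {a? = allS? λ _ → allS? λ _ → allS? λ _ → allS? λ _ → allS? λ _ → allF? λ _ → imp? (imp? (2 ≤? _))} tt

  -- The last conjunct says that the pairing with `a` and `u` exchanged is its inverse, so a colour
  -- forbidden at `u` spoils only one pair.
  partner-pairs : ∀ ua ub ab b → negTri ua ub ab ✓ → 4 ≤ cnt (λ k →
    okS ab k b ∧ okS ua (partner ab ub b k) k ∧ okS ub (partner ab ub b k) b ∧ eqC (partner ub ab b (partner ab ub b k)) k)
  partner-pairs = toWitness {a? = allS? λ _ → allS? λ _ → allS? λ _ → allF? λ _ → imp? (4 ≤? _)} tt

  -- Three colours of `u` exceed by one the weak constraints that `u` may carry in `tri-two-three`.
  tri-spread⁺ : ∀ ua ub ab α β → negTri ua ub ab ✓ → 3 ≤ cnt (λ u → anyF λ a →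
    okS ua u a ∧ okS plus a α ∧ anyF λ b → okS ub u b ∧ okS ab a b ∧ okS plus b β)
  tri-spread⁺ = toWitness {a? = allS? λ _ → allS? λ _ → allS? λ _ → allF? λ _ → allF? λ _ → imp? (3 ≤? _)} tt

  -- Three more neighbours α, β, γ, pairwise constrained as by the paths through the triangle.
  tri-three⁺ : ∀ ab ac bc → negTri ab ac bc ✓ → ∀ α β → weakOK ab α β ✓ → ∀ γ → weakOK ac α γ ✓ → weakOK bc β γ ✓ →
    ∃ λ a → okS plus a α ✓ × ∃ λ b → okS plus b β ✓ × okS ab a b ✓ × ∃ λ d → okS plus d γ ✓ × okS ac a d ✓ × okS bc b d ✓
  tri-three⁺ = toWitness {a? = allS? λ _ → allS? λ _ → allS? λ _ → imp? (allF? λ _ → allF? λ _ → imp? (allF? λ _ →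
    imp? (imp? (ex? λ _ → chk ×-dec ex? λ _ → chk ×-dec chk ×-dec ex? λ _ → chk ×-dec chk ×-dec chk))))} tt

  -- The vertices `a` and `b` share the outer neighbour `α` in a positive triangle. The colours `α`
  -- and `γ` are arbitrary, so the triangle can be deleted without adding a constraint between them.
  tri-positive⁺ : ∀ ab ac bc p α γ → negTri ab ac bc ✓ →
    ∃ λ a → okS p a α ✓ × ∃ λ b → okS (ab · p) b α ✓ × okS ab a b ✓ × ∃ λ d → okS plus d γ ✓ × okS ac a d ✓ × okS bc b d ✓
  tri-positive⁺ = toWitness {a? = allS? λ _ → allS? λ _ → allS? λ _ → allS? λ _ → allF? λ _ → allF? λ _ →
    imp? (ex? λ _ → chk ×-dec ex? λ _ → chk ×-dec chk ×-dec ex? λ _ → chk ×-dec chk ×-dec chk)} tt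

  -- The apexes `k` and `l` of two negative triangles on `ab` keep one outer neighbour each, and the
  -- colours of these are again arbitrary.
  kite-extends⁺ : ∀ ab ac bc → negTri ab ac bc ✓ → ∀ ad bd → negTri ab ad bd ✓ → ∀ γ δ →
    ∃ λ k → okS plus k γ ✓ × ∃ λ l → okS plus l δ ✓ ×
    ∃ λ a → okS ac a k ✓ × okS ad a l ✓ × ∃ λ b → okS ab a b ✓ × okS bc b k ✓ × okS bd b l ✓
  kite-extends⁺ = toWitness {a? = allS? λ _ → allS? λ _ → allS? λ _ → imp? (allS? λ _ → allS? λ _ → imp? (allF? λ _ → allF? λ _ →
    ex? λ _ → chk ×-dec ex? λ _ → chk ×-dec ex? λ _ → chk ×-dec chk ×-dec ex? λ _ → chk ×-dec chk ×-dec chk))} tt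

  eff-okS : ∀ q k j → okS plus k (eff q j) ✓ → okS q k j ✓
  eff-okS = toWitness {a? = allS? λ _ → allF? λ _ → allF? λ _ → imp? chk} tt

  eff-weakOK : ∀ p q r i j → weakOK (p · q · r) i j ✓ → weakOK q (eff p i) (eff r j) ✓
  eff-weakOK = toWitness {a? = allS? λ _ → allS? λ _ → allS? λ _ → allF? λ _ → allF? λ _ → imp? chk} tt

  ρ-inverse : ∀ (m : Color) q r → eqC (ρ⁻ (toℕ m) q (ρ (toℕ m) q r)) r ✓
  ρ-inverse = toWitness {a? = allF? λ _ → allS? λ _ → allF? λ _ → chk} tt

  -- The rotations of the colouring (b, u, a) = (0, 3, 6) of a negative triangle.
  rot-tri : ∀ ua ub ab r → negTri ua ub ab ✓ →
    okS ua (ρ 3 (minus · ub) r) (ρ 6 (minus · ab) r) ✓ × okS ub (ρ 3 (minus · ub) r) r ✓ × okS ab (ρ 6 (minus · ab) r) r ✓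
  rot-tri = toWitness {a? = allS? λ _ → allS? λ _ → allS? λ _ → allF? λ _ → imp? (chk ×-dec chk ×-dec chk)} tt

  -- The rotations of the colouring (x, y, a, b, u) = (0, 3, 6, 7, 4) of K₄ with the edge ab subdivided by u.
  rot-K : ∀ ua ub ax ay bx by xy r → negTri ax ay xy ✓ → negTri bx by xy ✓ → negTri (ua · ub) ax bx ✓ →
    (okS ua (ρ 4 (ua · minus · ax) r) (ρ 6 (minus · ax) r) ✓ × okS ub (ρ 4 (ua · minus · ax) r) (ρ 7 (minus · bx) r) ✓ ×
     okS ax (ρ 6 (minus · ax) r) r ✓ × okS ay (ρ 6 (minus · ax) r) (ρ 3 (minus · xy) r) ✓ ×
     okS bx (ρ 7 (minus · bx) r) r ✓ × okS by (ρ 7 (minus · bx) r) (ρ 3 (minus · xy) r) ✓ × okS xy r (ρ 3 (minus · xy) r) ✓) ×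
    (trivial (ρ 4 (ua · minus · ax) r) (ρ 6 (minus · ax) r) ✓ × trivial (ρ 4 (ua · minus · ax) r) (ρ 7 (minus · bx) r) ✓ ×
     trivial (ρ 4 (ua · minus · ax) r) r ✓ × trivial (ρ 4 (ua · minus · ax) r) (ρ 3 (minus · xy) r) ✓ ×
     trivial (ρ 6 (minus · ax) r) (ρ 7 (minus · bx) r) ✓ × trivial (ρ 6 (minus · ax) r) r ✓ ×
     trivial (ρ 6 (minus · ax) r) (ρ 3 (minus · xy) r) ✓ × trivial (ρ 7 (minus · bx) r) r ✓ ×
     trivial (ρ 7 (minus · bx) r) (ρ 3 (minus · xy) r) ✓ × trivial r (ρ 3 (minus · xy) r) ✓)
  rot-K = toWitness {a? = allS? λ _ → allS? λ _ → allS? λ _ → allS? λ _ → allS? λ _ → allS? λ _ → allS? λ _ → allF? λ _ →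
    imp? (imp? (imp? ((chk ×-dec chk ×-dec chk ×-dec chk ×-dec chk ×-dec chk ×-dec chk) ×-dec
      (chk ×-dec chk ×-dec chk ×-dec chk ×-dec chk ×-dec chk ×-dec chk ×-dec chk ×-dec chk ×-dec chk))))} tt

∉-++ˡ : ∀ {k : Color} {E F} → k ∉ E ++ F → k ∉ E
∉-++ˡ q m = q (∈-++⁺ˡ m)

∉-++ʳ : ∀ {k : Color} E {F} → k ∉ E ++ F → k ∉ F
∉-++ʳ E q m = q (∈-++⁺ʳ E m)

ρ-avoid : ∀ (m : Color) q {r} E → r ∉ map (ρ⁻ (toℕ m) q) E → ρ (toℕ m) q r ∉ E
ρ-avoid m q {r} E h e = h (subst (_∈ map (ρ⁻ (toℕ m) q) E) (eqC-sound _ r (ρ-inverse m q r)) (∈-map⁺ (ρ⁻ (toℕ m) q) e))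

length-++-map : ∀ (E F : List Color) (g : Color → Color) → length (E ++ map g F) ≡ length E + length F
length-++-map E F g = trans (length-++ E) (cong (length E +_) (length-map g F))

-- Three forbidden colours meet at most three of the four disjoint pairs. Those forbidden at `u` are
-- transported to `a`, so that a single count of colours of `a` decides.
tri-choose : ∀ ua ub ab b Ea Eu → negTri ua ub ab ✓ → length Ea + length Eu ≤ 3 →
  ∃ λ k → ∃ λ l → okS ab k b ✓ × okS ua l k ✓ × okS ub l b ✓ × k ∉ Ea × l ∉ Eu
tri-choose ua ub ab b Ea Eu ng l with pick
    (λ k → okS ab k b ∧ okS ua (partner ab ub b k) k ∧ okS ub (partner ab ub b k) b ∧ eqC (partner ub ab b (partner ab ub b k)) k)
    (Ea ++ map (partner ub ab b) Eu)
    (≤-trans (s≤s (≤-trans (≤-reflexive (length-++-map Ea Eu _)) l)) (partner-pairs ua ub ab b ng))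
... | k , h , q =
  let o₁ , h₁ = ∧-elim {okS ab k b} h
      o₂ , h₂ = ∧-elim {okS ua (partner ab ub b k) k} h₁
      o₃ , h₃ = ∧-elim {okS ub (partner ab ub b k) b} h₂
  in k , partner ab ub b k , o₁ , o₂ , o₃ , ∉-++ˡ q ,
     λ m → ∉-++ʳ Ea q (subst (_∈ map (partner ub ab b) Eu) (eqC-sound _ k h₃) (∈-map⁺ (partner ub ab b) m))

tri-spread : ∀ ua ub ab p q α β E → negTri ua ub ab ✓ → length E ≤ 2 →
  ∃ λ u → ∃ λ a → ∃ λ b → okS ua u a ✓ × okS ub u b ✓ × okS ab a b ✓ × okS p a α ✓ × okS q b β ✓ × u ∉ E
tri-spread ua ub ab p q α β E ng l with pick (λ u → anyF λ a →
    okS ua u a ∧ okS plus a (eff p α) ∧ anyF λ b → okS ub u b ∧ okS ab a b ∧ okS plus b (eff q β)) E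
    (≤-trans (s≤s l) (tri-spread⁺ ua ub ab (eff p α) (eff q β) ng))
... | u , h , u∉ with anyF-elim (λ a → okS ua u a ∧ okS plus a (eff p α) ∧ anyF λ b → okS ub u b ∧ okS ab a b ∧ okS plus b (eff q β)) h
...   | a , h₁ with ∧-elim {okS ua u a} h₁
...     | o₁ , h₂ with ∧-elim {okS plus a (eff p α)} h₂
...       | o₂ , h₃ with anyF-elim (λ b → okS ub u b ∧ okS ab a b ∧ okS plus b (eff q β)) h₃
...         | b , h₄ with ∧-elim {okS ub u b} h₄
...           | o₃ , h₅ with ∧-elim {okS ab a b} h₅
...             | o₄ , o₅ = u , a , b , o₁ , o₃ , o₄ , eff-okS p a α o₂ , eff-okS q b β o₅ , u∉

tri-three : ∀ ab ac bc p q r α β γ → negTri ab ac bc ✓ →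
  weakOK (p · ab · q) α β ✓ → weakOK (p · ac · r) α γ ✓ → weakOK (q · bc · r) β γ ✓ →
  ∃ λ a → ∃ λ b → ∃ λ d → okS p a α ✓ × okS q b β ✓ × okS r d γ ✓ × okS ab a b ✓ × okS ac a d ✓ × okS bc b d ✓
tri-three ab ac bc p q r α β γ ng w₁ w₂ w₃ =
  let a , o₁ , b , o₂ , o₃ , d , o₄ , o₅ , o₆ = tri-three⁺ ab ac bc ng (eff p α) (eff q β)
        (eff-weakOK p ab q α β w₁) (eff r γ) (eff-weakOK p ac r α γ w₂) (eff-weakOK q bc r β γ w₃)
  in a , b , d , eff-okS p a α o₁ , eff-okS q b β o₂ , eff-okS r d γ o₄ , o₃ , o₅ , o₆

tri-positive : ∀ ab ac bc p r α γ → negTri ab ac bc ✓ →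
  ∃ λ a → ∃ λ b → ∃ λ d → okS p a α ✓ × okS (ab · p) b α ✓ × okS r d γ ✓ × okS ab a b ✓ × okS ac a d ✓ × okS bc b d ✓
tri-positive ab ac bc p r α γ ng =
  let a , o₁ , b , o₂ , o₃ , d , o₄ , o₅ , o₆ = tri-positive⁺ ab ac bc p α (eff r γ) ng
  in a , b , d , o₁ , o₂ , eff-okS r d γ o₄ , o₃ , o₅ , o₆

kite-extends : ∀ ab ac bc ad bd p q γ δ → negTri ab ac bc ✓ → negTri ab ad bd ✓ →
  ∃ λ a → ∃ λ b → ∃ λ k → ∃ λ l → okS p k γ ✓ × okS q l δ ✓ × okS ac a k ✓ × okS ad a l ✓ × okS ab a b ✓ × okS bc b k ✓ × okS bd b l ✓
kite-extends ab ac bc ad bd p q γ δ n₁ n₂ =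
  let k , o₁ , l , o₂ , a , o₃ , o₄ , b , o₅ , o₆ , o₇ = kite-extends⁺ ab ac bc n₁ ad bd n₂ (eff p γ) (eff q δ)
  in a , b , k , l , eff-okS p k γ o₁ , eff-okS q l δ o₂ , o₃ , o₄ , o₅ , o₆ , o₇

-- Instances

anyL : {X : Set} → (X → Bool) → List X → Bool
anyL p []       = false
anyL p (x ∷ xs) = p x ∨ anyL p xs

anyL-elim : {X : Set} (p : X → Bool) (xs : List X) → anyL p xs ≡ true → ∃ λ x → (x ∈ xs) × (p x ≡ true)
anyL-elim p (x ∷ xs) h with p x in eq
... | true  = x , 1st , eq
... | false = let y , m , q = anyL-elim p xs h in y , there m , q

anyL-intro : {X : Set} (p : X → Bool) {xs : List X} {x : X} → x ∈ xs → p x ≡ true → anyL p xs ≡ true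
anyL-intro p {y ∷ xs} 1st h rewrite h = refl
anyL-intro p {y ∷ xs} (there m) h with p y
... | true  = refl
... | false = anyL-intro p m h

·-comm : ∀ p q → p · q ≡ q · p
·-comm plus plus = refl
·-comm plus minus = refl
·-comm minus plus = refl
·-comm minus minus = refl

·-assoc : ∀ p q r → p · q · r ≡ p · (q · r)
·-assoc plus q r = refl
·-assoc minus plus r = refl
·-assoc minus minus plus = refl
·-assoc minus minus minus = refl

just-inj : ∀ {x y : Sign} {m} → m ≡ just x → m ≡ just y → x ≡ y
just-inj refl refl = refl

negTri-false : ∀ p q r → negTri p q r ≡ false → r ≡ p · q
negTri-false plus  plus  plus  _ = refl
negTri-false plus  minus minus _ = refl
negTri-false minus plus  minus _ = refl
negTri-false minus minus plus  _ = refl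

negTri-swap : ∀ p q r → negTri p q r ✓ → negTri q p r ✓
negTri-swap p q r h = trans (cong (λ z → isMinus (z · r)) (·-comm q p)) h

negTri-rotate : ∀ p q r → negTri p q r ✓ → negTri r p q ✓
negTri-rotate p q r h = trans (cong isMinus (trans (·-assoc r p q) (·-comm r (p · q)))) h

record Rel : Set where
  constructor rel
  field
    st    : Maybe Sign
    w⁺ w⁻ : Bool
open Rel public

none : Rel
none = rel nothing false false

wk : Rel → Sign → Bool
wk r plus  = w⁺ r
wk r minus = w⁻ r

sc wc cost : Rel → ℕ
sc (rel nothing  _ _) = 0
sc (rel (just _) _ _) = 1
wc r = 𝟙 (w⁺ r) + 𝟙 (w⁻ r)
cost r = 2 * sc r + wc r

record OK (r : Rel) (i j : Color) : Set where
  constructor mkOK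
  field
    strongOK : ∀ s → st r ≡ just s → okS s i j ≡ true
    weaklyOK : ∀ σ → wk r σ ≡ true → weakOK σ i j ≡ true
open OK public

OK-sym : ∀ {r i j} → OK r i j → OK r j i
OK-sym {i = i} {j} (mkOK a b) = mkOK (λ s e → okS-sym s i j (a s e)) (λ ω e → weakOK-sym ω i j (b ω e))

OK-none : ∀ {i j} → OK none i j
OK-none = mkOK (λ _ ()) (λ { plus () ; minus () })

OK-trivial : ∀ {r i j} → (∀ s → st r ≡ just s → okS s i j ≡ true) → trivial i j ≡ true → OK r i j
OK-trivial {r} {i} {j} h t = mkOK h λ { plus _ → proj₁ (∧-elim t) ; minus _ → proj₂ (∧-elim {weakOK plus i j} t) }

record Inst (n : ℕ) : Set where
  field
    c    : Fin n → Fin n → Rel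
    csym : ∀ u v → c u v ≡ c v u
    cirr : ∀ u → c u u ≡ none
open Inst public

excRel : Rel → Color → List Color
excRel r j = (if w⁺ r then excl plus j ∷ [] else []) ++ (if w⁻ r then excl minus j ∷ [] else [])

length-excRel : ∀ r j → length (excRel r j) ≡ wc r
length-excRel (rel _ true  true)  j = refl
length-excRel (rel _ true  false) j = refl
length-excRel (rel _ false true)  j = refl
length-excRel (rel _ false false) j = refl

excRel-sound : ∀ r i j → i ∉ excRel r j → ∀ σ → wk r σ ≡ true → weakOK σ i j ≡ true
excRel-sound (rel _ true _) i j h plus _ = weakOK-intro plus i j (h ∘ here)
excRel-sound (rel _ true true) i j h minus _ = weakOK-intro minus i j (h ∘ there ∘ here)
excRel-sound (rel _ false true) i j h minus _ = weakOK-intro minus i j (h ∘ here)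

addWk : Sign → Rel → Rel
addWk plus  r = record r { w⁺ = true }
addWk minus r = record r { w⁻ = true }

addWk-cost : ∀ σ r → cost (addWk σ r) ≤ cost r + 1
addWk-cost plus  (rel nothing  true  true ) = n≤1+n _
addWk-cost minus (rel nothing  true  true ) = n≤1+n _
addWk-cost plus  (rel nothing  true  false) = n≤1+n _
addWk-cost minus (rel nothing  true  false) = ≤-refl
addWk-cost plus  (rel nothing  false true ) = ≤-refl
addWk-cost minus (rel nothing  false true ) = n≤1+n _
addWk-cost plus  (rel nothing  false false) = ≤-refl
addWk-cost minus (rel nothing  false false) = ≤-refl
addWk-cost plus  (rel (just _) true  true ) = n≤1+n _
addWk-cost minus (rel (just _) true  true ) = n≤1+n _
addWk-cost plus  (rel (just _) true  false) = n≤1+n _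
addWk-cost minus (rel (just _) true  false) = ≤-refl
addWk-cost plus  (rel (just _) false true ) = ≤-refl
addWk-cost minus (rel (just _) false true ) = n≤1+n _
addWk-cost plus  (rel (just _) false false) = ≤-refl
addWk-cost minus (rel (just _) false false) = ≤-refl

-- An existing strong constraint stays, even if its sign differs. The new sign is guaranteed only
-- where no strong constraint was present before.
addSt : Sign → Rel → Rel
addSt s (rel nothing  x y) = rel (just s) x y
addSt s (rel (just q) x y) = rel (just q) x y

addSt-cost : ∀ s r → cost (addSt s r) ≤ cost r + 2
addSt-cost s (rel nothing  x y) = ≤-reflexive (+-comm 2 _)
addSt-cost s (rel (just _) x y) = m≤m+n _ 2

OK-addSt : ∀ s r {i j} → OK (addSt s r) i j → OK r i j
OK-addSt s (rel nothing  x y) (mkOK a b) = mkOK (λ _ ()) (λ { plus e → b plus e ; minus e → b minus e })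
OK-addSt s (rel (just q) x y) (mkOK a b) = mkOK a (λ { plus e → b plus e ; minus e → b minus e })

addSt-at : ∀ s r → st r ≡ nothing → st (addSt s r) ≡ just s
addSt-at s (rel nothing x y) _ = refl

-- Potentials, changes of an instance, and partial colourings

module _ {n : ℕ} where

  V : Set
  V = Fin n

  _[_] : (V → Color) → List (V × Color) → V → Color
  (f [ [] ]) w = f w
  (f [ (v , k) ∷ ps ]) w with w ≟ v
  ... | yes _ = k
  ... | no  _ = (f [ ps ]) w

  dom : List (V × Color) → List V
  dom = map proj₁

  []-out : ∀ f ps {w} → w ∉ dom ps → (f [ ps ]) w ≡ f w
  []-out f [] _ = refl
  []-out f ((v , k) ∷ ps) {w} q with w ≟ v
  ... | yes refl = ⊥-elim (q 1st)
  ... | no  _    = []-out f ps (q ∘ there)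

  []-here : ∀ f v k ps → (f [ (v , k) ∷ ps ]) v ≡ k
  []-here f v k ps with v ≟ v
  ... | yes _ = refl
  ... | no q  = ⊥-elim (q refl)

  []-there : ∀ f v k ps {w} → w ≢ v → (f [ (v , k) ∷ ps ]) w ≡ (f [ ps ]) w
  []-there f v k ps {w} q with w ≟ v
  ... | yes e = ⊥-elim (q e)
  ... | no _  = refl

  isPair : V → V → V → V → Bool
  isPair a b u v = (does (u ≟ a) ∧ does (v ≟ b)) ∨ (does (u ≟ b) ∧ does (v ≟ a))

  isPair-elim : ∀ a b u v → isPair a b u v ≡ true → ((u ≡ a) × (v ≡ b)) ⊎ ((u ≡ b) × (v ≡ a))
  isPair-elim a b u v h with u ≟ a | v ≟ b | u ≟ b | v ≟ a
  ... | yes p | yes q | _     | _     = inj₁ (p , q)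
  ... | yes p | no _  | yes q | yes r = inj₂ (q , r)
  ... | no _  | _     | yes q | yes r = inj₂ (q , r)
  isPair-elim a b u v () | yes _ | no _ | yes _ | no _
  isPair-elim a b u v () | yes _ | no _ | no _ | _
  isPair-elim a b u v () | no _ | _ | yes _ | no _
  isPair-elim a b u v () | no _ | _ | no _ | _

  isPair-intro : ∀ a b → isPair a b a b ≡ true
  isPair-intro a b with a ≟ a | b ≟ b
  ... | yes _ | yes _ = refl
  ... | yes _ | no q = ⊥-elim (q refl)
  ... | no q | _ = ⊥-elim (q refl)

  isPair-sym : ∀ a b u v → isPair a b u v ≡ isPair a b v u
  isPair-sym a b u v = trans (∨-comm (does (u ≟ a) ∧ does (v ≟ b)) _)
    (cong₂ _∨_ (∧-comm (does (u ≟ b)) _) (∧-comm (does (u ≟ a)) _))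

  modify : (I : Inst n) (a b : V) → a ≢ b → (Rel → Rel) → Inst n
  modify I a b a≢b g = record
    { c    = λ u v → if isPair a b u v then g (c I u v) else c I u v
    ; csym = λ u v → cong₂ (λ p r → if p then g r else r) (isPair-sym a b u v) (csym I u v)
    ; cirr = λ u → irr u
    }
    where
      irr : ∀ u → (if isPair a b u u then g (c I u u) else c I u u) ≡ none
      irr u with isPair a b u u in eq
      ... | false = cirr I u
      ... | true with isPair-elim a b u u eq
      ...   | inj₁ (refl , e) = ⊥-elim (a≢b e)
      ...   | inj₂ (refl , e) = ⊥-elim (a≢b (sym e))

  -- The potential of S relative to the precoloured vertices P is 3 * length S ∸ cst I P S.
  κ : Inst n → V → List V → ℕ
  κ I u Y = ∑ Y (λ v → cost (c I u v))

  cst : Inst n → List V → List V → ℕ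
  cst I P []      = 0
  cst I P (u ∷ S) = cst I P S + κ I u (S ++ P)

  module _ (I : Inst n) (a b : V) (a≢b : a ≢ b) (g : Rel → Rel) (d : ℕ)
           (gd : ∀ r → cost (g r) ≤ cost r + d) where
    private J = modify I a b a≢b g

    modify-at : c J a b ≡ g (c I a b)
    modify-at rewrite isPair-intro a b = refl

    modify-other : ∀ u v → isPair a b u v ≡ false → c J u v ≡ c I u v
    modify-other u v e rewrite e = refl

    κ-same : ∀ u Y → (∀ {v} → v ∈ Y → isPair a b u v ≡ false) → κ J u Y ≡ κ I u Y
    κ-same u Y h = ∑-cong Y (λ {v} m → cong cost (modify-other u v (h m)))

    κ-once : ∀ u Y → Unique Y → κ J u Y ≤ κ I u Y + d
    κ-once u [] _ = z≤n
    κ-once u (v ∷ Y) uq with Bool-cases (isPair a b u v)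
    ... | inj₂ e = ≤-trans (+-mono-≤ (≤-reflexive (cong cost (modify-other u v e))) (κ-once u Y (Unique-tail uq)))
                     (≤-reflexive (sym (+-assoc (cost (c I u v)) _ d)))
    ... | inj₁ e = ≤-trans (+-mono-≤ (≤-trans (≤-reflexive (cong cost at)) (gd (c I u v)))
                             (≤-reflexive (κ-same u Y rest)))
                     (≤-reflexive (shuffle (cost (c I u v)) d _))
      where
        at : c J u v ≡ g (c I u v)
        at rewrite e = refl
        shuffle : ∀ x y z → x + y + z ≡ x + z + y
        shuffle = solve-∀
        rest : ∀ {w} → w ∈ Y → isPair a b u w ≡ false
        rest {w} m with Bool-cases (isPair a b u w)
        ... | inj₂ e′ = e′
        ... | inj₁ e′ with isPair-elim a b u v e | isPair-elim a b u w e′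
        ...   | inj₁ (_ , refl) | inj₁ (_ , refl) = ⊥-elim (Unique-head uq m)
        ...   | inj₂ (_ , refl) | inj₂ (_ , refl) = ⊥-elim (Unique-head uq m)
        ...   | inj₁ (refl , _) | inj₂ (p , _) = ⊥-elim (a≢b p)
        ...   | inj₂ (refl , _) | inj₁ (p , _) = ⊥-elim (a≢b (sym p))

    cst-same : ∀ P S → (a ∉ S ++ P) ⊎ (b ∉ S ++ P) → cst J P S ≡ cst I P S
    cst-same P [] h = refl
    cst-same P (u ∷ S) h = cong₂ _+_ (cst-same P S ([ (λ q → inj₁ (q ∘ there)) , (λ q → inj₂ (q ∘ there)) ]′ h))
      (κ-same u (S ++ P) λ {v} m → no-pair v m h)
      where
        no-pair : ∀ v → v ∈ S ++ P → (a ∉ u ∷ S ++ P) ⊎ (b ∉ u ∷ S ++ P) → isPair a b u v ≡ false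
        no-pair v m h with Bool-cases (isPair a b u v)
        ... | inj₂ e = e
        ... | inj₁ e with isPair-elim a b u v e | h
        ...   | inj₁ (refl , refl) | inj₁ q = ⊥-elim (q 1st)
        ...   | inj₁ (refl , refl) | inj₂ q = ⊥-elim (q (there m))
        ...   | inj₂ (refl , refl) | inj₁ q = ⊥-elim (q (there m))
        ...   | inj₂ (refl , refl) | inj₂ q = ⊥-elim (q 1st)

    cst-once : ∀ P S → Unique (S ++ P) → cst J P S ≤ cst I P S + d
    cst-once P [] _ = z≤n
    cst-once P (u ∷ S) uq = go (u ≟ a) (u ≟ b)
      where
        shuffle : ∀ x y z → x + y + z ≡ x + z + y
        shuffle = solve-∀
        end : (a ∉ S ++ P) ⊎ (b ∉ S ++ P) → cst J P (u ∷ S) ≤ cst I P (u ∷ S) + d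
        end h = ≤-trans (+-mono-≤ (≤-reflexive (cst-same P S h)) (κ-once u (S ++ P) (Unique-tail uq)))
                  (≤-reflexive (sym (+-assoc (cst I P S) _ d)))
        no-pair : u ≢ a → u ≢ b → ∀ {v} → v ∈ S ++ P → isPair a b u v ≡ false
        no-pair p q {v} m with Bool-cases (isPair a b u v)
        ... | inj₂ e = e
        ... | inj₁ e with isPair-elim a b u v e
        ...   | inj₁ (e′ , _) = ⊥-elim (p e′)
        ...   | inj₂ (e′ , _) = ⊥-elim (q e′)
        go : Dec (u ≡ a) → Dec (u ≡ b) → cst J P (u ∷ S) ≤ cst I P (u ∷ S) + d
        go (yes refl) _          = end (inj₁ (Unique-head uq))
        go (no _)     (yes refl) = end (inj₂ (Unique-head uq))
        go (no p)     (no q)     =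
          ≤-trans (+-mono-≤ (cst-once P S (Unique-tail uq)) (≤-reflexive (κ-same u (S ++ P) (no-pair p q))))
            (≤-reflexive (shuffle (cst I P S) d _))

  -- Constraints between two precoloured vertices are left out, in agreement with `cst`, which does
  -- not charge them.
  Good : Inst n → List V → List V → (V → Color) → Set
  Good I P L f = ∀ {u v} → u ∈ L → v ∈ L ++ P → OK (c I u v) (f u) (f v)

  Ext : Inst n → List V → List V → (V → Color) → Set
  Ext I P L f₀ = ∃ λ f → (∀ v → v ∉ L → f v ≡ f₀ v) × Good I P L f

  Sparse : Inst n → List V → List V → Set
  Sparse I P L = ∀ S → Unique S → S ⊆ L → cst I P S ≤ 3 * length S

  tri : Inst n → V → V → V → Bool
  tri I u v w with st (c I u v) | st (c I u w) | st (c I v w)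
  ... | just p | just q | just r = negTri p q r
  ... | _ | _ | _ = false

  record Neg3 (I : Inst n) (u v w : V) : Set where
    constructor neg3
    field
      {s₁ s₂ s₃} : Sign
      e₁ : st (c I u v) ≡ just s₁
      e₂ : st (c I u w) ≡ just s₂
      e₃ : st (c I v w) ≡ just s₃
      neg : negTri s₁ s₂ s₃ ≡ true

  tri-sound : ∀ I u v w → tri I u v w ≡ true → Neg3 I u v w
  tri-sound I u v w h with st (c I u v) in e₁ | st (c I u w) in e₂ | st (c I v w) in e₃
  ... | just p | just q | just r = neg3 e₁ e₂ e₃ h

  tri-complete : ∀ I u v w → Neg3 I u v w → tri I u v w ≡ true
  tri-complete I u v w (neg3 e₁ e₂ e₃ h) rewrite e₁ | e₂ | e₃ = h

  Neg3-swap₁ : ∀ {I u v w} → Neg3 I u v w → Neg3 I v u w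
  Neg3-swap₁ {I} {u} {v} {w} (neg3 {s₁} {s₂} {s₃} e₁ e₂ e₃ h) =
    neg3 (trans (cong st (csym I v u)) e₁) e₃ e₂
      (negTri-swap s₃ s₁ s₂ (negTri-rotate s₁ s₂ s₃ h))

  Neg3-swap₂ : ∀ {I u v w} → Neg3 I u v w → Neg3 I u w v
  Neg3-swap₂ {I} {u} {v} {w} (neg3 {s₁} {s₂} {s₃} e₁ e₂ e₃ h) =
    neg3 e₂ e₁ (trans (cong st (csym I w v)) e₃) (negTri-swap s₁ s₂ s₃ h)

  record K4 (I : Inst n) (a b x y : V) : Set where
    constructor k4
    field
      abx : Neg3 I a b x
      aby : Neg3 I a b y
      axy : Neg3 I a x y
      bxy : Neg3 I b x y

  NoK4 : Inst n → List V → Set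
  NoK4 I L = ∀ {a b x y} → a ∈ L → b ∈ L → x ∈ L → y ∈ L → K4 I a b x y → ⊥

  excs : Inst n → V → List V → (V → Color) → List Color
  excs I v []      f = []
  excs I v (w ∷ Y) f = excRel (c I v w) (f w) ++ excs I v Y f

  τ σ : Inst n → V → List V → ℕ
  τ I v Y = ∑ Y (λ w → wc (c I v w))
  σ I v Y = ∑ Y (λ w → sc (c I v w))

  κ≡ : ∀ I v Y → κ I v Y ≡ 2 * σ I v Y + τ I v Y
  κ≡ I v [] = refl
  κ≡ I v (w ∷ Y) = trans (cong (cost (c I v w) +_) (κ≡ I v Y)) (arith (sc (c I v w)) (wc (c I v w)) (σ I v Y) (τ I v Y))
    where
      arith : ∀ a b s t → (2 * a + b) + (2 * s + t) ≡ 2 * (a + s) + (b + t)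
      arith = solve-∀

  length-excs : ∀ I v Y f → length (excs I v Y f) ≡ τ I v Y
  length-excs I v [] f = refl
  length-excs I v (w ∷ Y) f = trans (length-++ (excRel (c I v w) (f w)))
    (cong₂ _+_ (length-excRel (c I v w) (f w)) (length-excs I v Y f))

  excs-sound : ∀ I v Y f {k w} → k ∉ excs I v Y f → w ∈ Y → ∀ ω → wk (c I v w) ω ≡ true → weakOK ω k (f w) ≡ true
  excs-sound I v (y ∷ Y) f {k} q 1st = excRel-sound (c I v y) k (f y) (q ∘ ∈-++⁺ˡ)
  excs-sound I v (y ∷ Y) f q (there m) = excs-sound I v Y f (q ∘ ∈-++⁺ʳ (excRel (c I v y) (f y))) m

  -- Each newly coloured vertex is compared with `Y` and with later entries of the list only. The
  -- symmetry of the constraints supplies the other order in `compat-good`.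
  Compat : Inst n → (V → Color) → List V → List (V × Color) → Set
  Compat I f Y [] = ⊤
  Compat I f Y ((v , k) ∷ ps) =
    (∀ {w} → w ∈ Y → OK (c I v w) k (f w)) × All (λ (w , l) → OK (c I v w) k l) ps × Compat I f Y ps

  ∈dom : ∀ f ps {w} → w ∈ dom ps → ∃ λ k → ((w , k) ∈ ps) × ((f [ ps ]) w ≡ k)
  ∈dom f ((v , k) ∷ ps) {w} m with w ≟ v
  ... | yes refl = k , 1st , refl
  ∈dom f ((v , k) ∷ ps) 1st | no q = ⊥-elim (q refl)
  ∈dom f ((v , k) ∷ ps) (there m) | no q = let l , a , b = ∈dom f ps m in l , there a , b

  compat-good : ∀ I P X f ps → Unique (dom ps ++ X ++ P) → Good I P X f → Compat I f (X ++ P) ps →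
    Good I P (dom ps ++ X) (f [ ps ])
  compat-good I P X f [] uq g _ = g
  compat-good I P X f ((v , k) ∷ ps) uq g (o , i , cs) {x₀} {y₀} = go x₀ y₀
    where
      f′ = f [ (v , k) ∷ ps ]
      rec = compat-good I P X f ps (Unique-tail uq) g cs
      assoc : ∀ {y} → y ∈ (dom ps ++ X) ++ P → y ∈ dom ps ++ X ++ P
      assoc {y} m = subst (y ∈_) (++-assoc (dom ps) X P) m
      ne : ∀ {y} → y ∈ dom ps ++ X ++ P → y ≢ v
      ne m refl = Unique-head uq m
      old : ∀ {y} → y ∈ dom ps ++ X ++ P → f′ y ≡ (f [ ps ]) y
      old m = []-there f v k ps (ne m)
      base : ∀ {y} → y ∈ dom ps ++ X ++ P → OK (c I v y) k ((f [ ps ]) y)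
      base {y} m with y ∈? dom ps
      ... | yes q = let l , a , b = ∈dom f ps q in subst (OK (c I v y) k) (sym b) (All.lookup i a)
      ... | no q with ∈-++⁻ (dom ps) m
      ...   | inj₁ q′ = ⊥-elim (q q′)
      ...   | inj₂ q′ = subst (OK (c I v y) k) (sym ([]-out f ps q)) (o q′)
      toR : ∀ {y} → y ∈ dom ps ++ X → y ∈ dom ps ++ X ++ P
      toR m = assoc (∈-++⁺ˡ m)
      go : ∀ x y → x ∈ v ∷ dom ps ++ X → y ∈ (v ∷ dom ps ++ X) ++ P → OK (c I x y) (f′ x) (f′ y)
      go x y 1st 1st = subst (λ r → OK r (f′ x) (f′ x)) (sym (cirr I x)) OK-none
      go x y 1st (there q) = subst₂ (OK (c I x y)) (sym ([]-here f x k ps)) (sym (old (assoc q))) (base (assoc q))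
      go x y (there p) 1st = subst₂ (OK (c I x y)) (sym (old (toR p))) (sym ([]-here f y k ps))
        (subst (λ r → OK r ((f [ ps ]) x) k) (csym I y x) (OK-sym (base (toR p))))
      go x y (there p) (there q) = subst₂ (OK (c I x y)) (sym (old (toR p))) (sym (old (assoc q))) (rec p q)

  K4-swap₁ : ∀ {I a b x y} → K4 I a b x y → K4 I b a x y
  K4-swap₁ (k4 p q r s) = k4 (Neg3-swap₁ p) (Neg3-swap₁ q) s r

  K4-swap₂ : ∀ {I a b x y} → K4 I a b x y → K4 I a x b y
  K4-swap₂ (k4 p q r s) = k4 (Neg3-swap₂ p) r q (Neg3-swap₁ s)

  K4-swap₃ : ∀ {I a b x y} → K4 I a b x y → K4 I a b y x
  K4-swap₃ (k4 p q r s) = k4 q p (Neg3-swap₂ r) (Neg3-swap₂ s)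

  K4ᵇ : Inst n → V → V → V → V → Bool
  K4ᵇ I a b x y = tri I a b x ∧ tri I a b y ∧ tri I a x y ∧ tri I b x y

  K4ᵇ-intro : ∀ {I a b x y} → K4 I a b x y → K4ᵇ I a b x y ≡ true
  K4ᵇ-intro {I} {a} {b} {x} {y} (k4 p q r s) =
    ∧-intro (tri-complete I a b x p) (∧-intro (tri-complete I a b y q)
      (∧-intro (tri-complete I a x y r) (tri-complete I b x y s)))

  K4ᵇ-elim : ∀ {I a b x y} → K4ᵇ I a b x y ≡ true → K4 I a b x y
  K4ᵇ-elim {I} {a} {b} {x} {y} h =
    let p , h₁ = ∧-elim {tri I a b x} h
        q , h₂ = ∧-elim {tri I a b y} h₁
        r , s  = ∧-elim {tri I a x y} h₂
    in k4 (tri-sound I a b x p) (tri-sound I a b y q) (tri-sound I a x y r) (tri-sound I b x y s)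

OK-addWk : ∀ ω r {i j} → OK (addWk ω r) i j → OK r i j
OK-addWk plus  r (mkOK a b) = mkOK a λ { plus _ → b plus refl ; minus e → b minus e }
OK-addWk minus r (mkOK a b) = mkOK a λ { plus e → b plus e ; minus _ → b minus refl }

OK-addWk-at : ∀ ω r {i j} → OK (addWk ω r) i j → weakOK ω i j ≡ true
OK-addWk-at plus  r o = weaklyOK o plus refl
OK-addWk-at minus r o = weaklyOK o minus refl

st-addWk : ∀ ω r → st (addWk ω r) ≡ st r
st-addWk plus  r = refl
st-addWk minus r = refl

module _ {n : ℕ} where

  cst-++ : ∀ (I : Inst n) P S′ S → cst I P (S′ ++ S) ≡ cst I (S ++ P) S′ + cst I P S
  cst-++ I P []       S = refl
  cst-++ I P (u ∷ S′) S = trans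
    (cong₂ _+_ (cst-++ I P S′ S) (cong (κ I u) (++-assoc S′ S P)))
    (shuffle (cst I (S ++ P) S′) (cst I P S) _)
    where
      shuffle : ∀ x y z → x + y + z ≡ x + z + y
      shuffle = solve-∀

  OK-modify : ∀ (I : Inst n) a b a≢b g u v {i j} → (∀ {i j} → OK (g (c I u v)) i j → OK (c I u v) i j) →
    OK (c (modify I a b a≢b g) u v) i j → OK (c I u v) i j
  OK-modify I a b a≢b g u v h o with isPair a b u v
  ... | true  = h o
  ... | false = o

  st-modify : ∀ (I : Inst n) a b a≢b g → (∀ r → st (g r) ≡ st r) → ∀ u v →
    st (c (modify I a b a≢b g) u v) ≡ st (c I u v)
  st-modify I a b a≢b g h u v with isPair a b u v
  ... | true  = h (c I u v)
  ... | false = refl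

  Neg3-st : ∀ {I J : Inst n} → (∀ u v → st (c J u v) ≡ st (c I u v)) → ∀ {u v w} → Neg3 J u v w → Neg3 I u v w
  Neg3-st h {u} {v} {w} (neg3 e₁ e₂ e₃ q) =
    neg3 (trans (sym (h u v)) e₁) (trans (sym (h u w)) e₂) (trans (sym (h v w)) e₃) q

  NoK4-st : ∀ {I J : Inst n} {L L′} → (∀ u v → st (c J u v) ≡ st (c I u v)) → L′ ⊆ L → NoK4 I L → NoK4 J L′
  NoK4-st h s nk a b x y (k4 p q r t) =
    nk (s a) (s b) (s x) (s y) (k4 (Neg3-st h p) (Neg3-st h q) (Neg3-st h r) (Neg3-st h t))

  ∈-single : {v w : Fin n} → w ∈ v ∷ [] → w ≡ v
  ∈-single (here e) = e

  isStrong : Inst n → Fin n → Fin n → Bool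
  isStrong I v w with st (c I v w)
  ... | just _  = true
  ... | nothing = false

  isStrong-elim : ∀ I v w → isStrong I v w ≡ true → ∃ λ s → st (c I v w) ≡ just s
  isStrong-elim I v w h with st (c I v w)
  ... | just s = s , refl

  isStrong-intro : ∀ I v w {s} → st (c I v w) ≡ just s → isStrong I v w ≡ true
  isStrong-intro I v w e rewrite e = refl

  sc≡𝟙 : ∀ I v w → sc (c I v w) ≡ 𝟙 (isStrong I v w)
  sc≡𝟙 I v w with c I v w
  ... | rel (just _) _ _ = refl
  ... | rel nothing _ _  = refl

∑-2* : {X : Set} (xs : List X) (g : X → ℕ) → ∑ xs (λ x → 2 * g x) ≡ 2 * ∑ xs g
∑-2* []       g = refl
∑-2* (x ∷ xs) g = trans (cong (2 * g x +_) (∑-2* xs g)) (sym (*-distribˡ-+ 2 (g x) (∑ xs g)))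

at-most-one : {X : Set} {xs : List X} → Unique xs → (∀ {x y} → x ∈ xs → y ∈ xs → x ≡ y) → length xs ≤ 1
at-most-one {xs = []}         u h = z≤n
at-most-one {xs = x ∷ []}     u h = s≤s z≤n
at-most-one {xs = x ∷ y ∷ xs} u h = ⊥-elim (Unique-head u (here (h 1st 2nd)))

one-of : {X : Set} {xs : List X} → 1 ≤ length xs → ∃ λ x → x ∈ xs
one-of {xs = x ∷ _} _ = x , 1st

two-of : {X : Set} {xs : List X} → Unique xs → 2 ≤ length xs → ∃ λ x → ∃ λ y → (x ∈ xs) × (y ∈ xs) × (x ≢ y)
two-of {xs = x ∷ y ∷ _} u _ = x , y , 1st , 2nd , λ { refl → Unique-head u 1st }
two-of {xs = x ∷ []} u (s≤s ())

-- Here `K` and `M` count the payments of 1 and of 2 made by a vertex of strong degree `s` and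
-- degree `d`; the constant 13 instead of 12 makes the balance strict. If `s` is at least 4, then
-- `2 * d` is at least `4 * s`, hence at least `12 + s`, and the payments stay below `s`. If `s` is
-- at most 3, the payments are at most 2, and a total of 2 forces `d` to be at least 8.
account : ∀ K M s d → 7 ≤ d → 2 * s ≤ d → M ≤ 1 → (1 ≤ M → (K + 3 ≤ s) × (8 ≤ d)) → (1 ≤ K → K + 1 ≤ s) →
  (2 ≤ K → s ≤ 3 → d ≤ 7 → ⊥) → 13 + (K + 2 * M) ≤ 2 * d
account K M s d d7 sd m h₁ h₂ h₃ = go M K m h₁ h₂ h₃
  where
    heavy : 4 ≤ s → 12 + s ≤ 2 * d
    heavy l = lin 0 (+-mono-≤ (*-monoʳ-≤ 3 l) (*-monoʳ-≤ 2 sd)) (arith s d)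
      where
        arith : ∀ s d → 12 + s + (3 * s + 2 * d) + 0 ≡ 2 * d + (12 + 2 * (2 * s))
        arith = solve-∀
    go : ∀ M K → M ≤ 1 → (1 ≤ M → (K + 3 ≤ s) × (8 ≤ d)) → (1 ≤ K → K + 1 ≤ s) → (2 ≤ K → s ≤ 3 → d ≤ 7 → ⊥) →
      13 + (K + 2 * M) ≤ 2 * d
    go 0 0 _ _ _ _ = ≤-trans (n≤1+n 13) (*-monoʳ-≤ 2 d7)
    go 0 1 _ _ _ _ = *-monoʳ-≤ 2 d7
    go 0 (suc (suc K)) _ _ h₂ h₃ with s ≤? 3 | d ≤? 7
    ... | yes p | yes q = ⊥-elim (h₃ (s≤s (s≤s z≤n)) p q)
    ... | yes p | no q  = ≤-trans (lin 1 (≤-trans (h₂ (s≤s z≤n)) p) (arith K)) (*-monoʳ-≤ 2 (≰⇒> q))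
      where
        arith : ∀ K → 13 + (2 + K + 0) + 3 + 1 ≡ 16 + (2 + K + 1)
        arith = solve-∀
    ... | no p  | _     = ≤-trans (lin 0 (h₂ (s≤s z≤n)) (arith K s)) (heavy (≰⇒> p))
      where
        arith : ∀ K s → 13 + (2 + K + 0) + s + 0 ≡ 12 + s + (2 + K + 1)
        arith = solve-∀
    go 1 K _ h₁ _ _ with h₁ (s≤s z≤n) | s ≤? 3
    ... | a , b | yes p = ≤-trans (lin 1 (≤-trans a p) (arith K)) (*-monoʳ-≤ 2 b)
      where
        arith : ∀ K → 13 + (K + 2) + 3 + 1 ≡ 16 + (K + 3)
        arith = solve-∀
    ... | a , b | no p = ≤-trans (lin 0 a (arith K s)) (heavy (≰⇒> p))
      where
        arith : ∀ K s → 13 + (K + 2) + s + 0 ≡ 12 + s + (K + 3)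
        arith = solve-∀
    go (suc (suc M)) K (s≤s ()) _ _ _

-- Switching functions with few frustrated edges

module Switching {n : ℕ} (L : List (Fin n)) (uL : Unique L)
  (e g : Fin n → Fin n → Bool) (e-sym : ∀ u v → e u v ≡ e v u) (g-sym : ∀ u v → g u v ≡ g v u) where

  -- The graph is `e` and its negative edges are marked by `g`. After switching at the vertices
  -- where `δ` is true, `frus δ` are the negative and `calm δ` the positive edges.
  frus calm : (Fin n → Bool) → Fin n → Fin n → Bool
  frus δ u v = e u v ∧ (g u v xor (δ u xor δ v))
  calm δ u v = e u v ∧ not (g u v xor (δ u xor δ v))

  frus-sym : ∀ δ u v → frus δ u v ≡ frus δ v u
  frus-sym δ u v = cong₂ _∧_ (e-sym u v) (cong₂ _xor_ (g-sym u v) (xor-comm (δ u) (δ v)))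

  calm-sym : ∀ δ u v → calm δ u v ≡ calm δ v u
  calm-sym δ u v = cong₂ (λ x y → x ∧ not y) (e-sym u v) (cong₂ _xor_ (g-sym u v) (xor-comm (δ u) (δ v)))

  frus-calm : ∀ δ u v → 𝟙 (frus δ u v) + 𝟙 (calm δ u v) ≡ 𝟙 (e u v)
  frus-calm δ u v with e u v | g u v xor (δ u xor δ v)
  ... | true  | true  = refl
  ... | true  | false = refl
  ... | false | _     = refl

  not-both : ∀ δ u v → frus δ u v ≡ true → calm δ u v ≡ true → ⊥
  not-both δ u v p q with e u v | g u v xor (δ u xor δ v)
  not-both δ u v p () | true | true

  cross : (Fin n → Fin n → Bool) → List (Fin n) → List (Fin n) → ℕ
  cross h X Y = ∑ X (λ x → ∑ Y (λ y → 𝟙 (h x y)))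

  cross-+ : ∀ δ X Y → cross (frus δ) X Y + cross (calm δ) X Y ≡ cross e X Y
  cross-+ δ X Y = trans (sym (∑-+ X _ _)) (∑-cong X λ {x} _ → trans (sym (∑-+ Y _ _)) (∑-cong Y λ {y} _ → frus-calm δ x y))

  cross-swap : ∀ h → (∀ u v → h u v ≡ h v u) → ∀ X Y → cross h Y X ≡ cross h X Y
  cross-swap h hs X Y = trans (∑-swap Y X (λ y x → 𝟙 (h y x))) (∑-cong X λ {x} _ → ∑-cong Y λ {y} _ → cong 𝟙 (hs y x))

  -- Ordered pairs are counted, so every frustrated edge counts twice.
  size : (Fin n → Bool) → ℕ
  size δ = cross (frus δ) L L

  flipOn : List (Fin n) → (Fin n → Bool) → Fin n → Bool
  flipOn X δ v = does (v ∈? X) xor δ v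

  flip-in : ∀ X δ {v} → v ∈ X → flipOn X δ v ≡ not (δ v)
  flip-in X δ {v} m with v ∈? X
  ... | yes _ = refl
  ... | no q  = ⊥-elim (q m)

  flip-out : ∀ X δ {v} → v ∉ X → flipOn X δ v ≡ δ v
  flip-out X δ {v} m with v ∈? X
  ... | yes q = ⊥-elim (m q)
  ... | no _  = refl

  ∑-split : ∀ X → Unique X → X ⊆ L → (F : Fin n → ℕ) → ∑ L F ≡ ∑ X F + ∑ (L ∖ X) F
  ∑-split X uX sX F = trans (≤-antisym
      (∑-⊆ F uL (λ {v} m → case v ∈? X of λ { (yes q) → ∈-++⁺ˡ q ; (no q) → ∈-++⁺ʳ X (∈-∖⁺ m q) }))
      (∑-⊆ F (Unique-++ uX (Unique-∖ uL) (λ m m′ → proj₂ (∈-∖⁻ L m′) m)) (λ m → [ sX , ∖-⊆ ]′ (∈-++⁻ X m))))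
    (∑-++ X (L ∖ X) F)

  size-split : ∀ δ X → Unique X → X ⊆ L → size δ ≡
    (cross (frus δ) X X + cross (frus δ) X (L ∖ X)) + (cross (frus δ) X (L ∖ X) + cross (frus δ) (L ∖ X) (L ∖ X))
  size-split δ X uX sX = trans (∑-split X uX sX _) (cong₂ _+_ (inside X)
      (trans (inside (L ∖ X)) (cong (_+ cross (frus δ) (L ∖ X) (L ∖ X)) (cross-swap (frus δ) (frus-sym δ) X (L ∖ X)))))
    where
      inside : ∀ Z → cross (frus δ) Z L ≡ cross (frus δ) Z X + cross (frus δ) Z (L ∖ X)
      inside Z = trans (∑-cong Z (λ {z} _ → ∑-split X uX sX (λ y → 𝟙 (frus δ z y)))) (∑-+ Z _ _)

  flip-frus : ∀ X δ → cross (frus (flipOn X δ)) X (L ∖ X) ≡ cross (calm δ) X (L ∖ X)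
  flip-frus X δ = ∑-cong X λ {x} x∈ → ∑-cong (L ∖ X) λ {y} y∈ → cong 𝟙 (cong (e x y ∧_)
    (trans (cong₂ (λ p q → g x y xor (p xor q)) (flip-in X δ x∈) (flip-out X δ (proj₂ (∈-∖⁻ L y∈)))) (toggle (g x y) (δ x) (δ y))))
    where
      toggle : ∀ a b d → a xor (not b xor d) ≡ not (a xor (b xor d))
      toggle = toWitness {a? = allB? λ _ → allB? λ _ → allB? λ _ → Data.Bool.Properties._≟_ _ _} tt

  flip-same-in : ∀ X δ → cross (frus (flipOn X δ)) X X ≡ cross (frus δ) X X
  flip-same-in X δ = ∑-cong X λ {x} x∈ → ∑-cong X λ {y} y∈ → cong 𝟙 (cong (e x y ∧_) (cong (g x y xor_)
    (trans (cong₂ _xor_ (flip-in X δ x∈) (flip-in X δ y∈)) (toggle (δ x) (δ y)))))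
    where
      toggle : ∀ a b → not a xor not b ≡ a xor b
      toggle = toWitness {a? = allB? λ _ → allB? λ _ → Data.Bool.Properties._≟_ _ _} tt

  flip-same-out : ∀ X δ → cross (frus (flipOn X δ)) (L ∖ X) (L ∖ X) ≡ cross (frus δ) (L ∖ X) (L ∖ X)
  flip-same-out X δ = ∑-cong (L ∖ X) λ {x} x∈ → ∑-cong (L ∖ X) λ {y} y∈ → cong 𝟙 (cong (e x y ∧_) (cong (g x y xor_)
    (cong₂ _xor_ (flip-out X δ (proj₂ (∈-∖⁻ L x∈))) (flip-out X δ (proj₂ (∈-∖⁻ L y∈))))))

  -- Flipping `X` exchanges frustrated and calm edges across the cut and changes nothing else. A cut
  -- with more frustrated than calm edges would make `size` drop.
  optimal : ∀ δ X → Unique X → X ⊆ L → (size (flipOn X δ) < size δ → ⊥) →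
    cross (frus δ) X (L ∖ X) ≤ cross (calm δ) X (L ∖ X)
  optimal δ X uX sX no-better with cross (frus δ) X (L ∖ X) ≤? cross (calm δ) X (L ∖ X)
  ... | yes q = q
  ... | no q  = ⊥-elim (no-better (lin 1 (+-mono-≤ (≰⇒> q) (≰⇒> q)) eq))
    where
      F = cross (frus δ) X (L ∖ X)
      C = cross (calm δ) X (L ∖ X)
      arith : ∀ a b f c → suc ((a + c) + (c + b)) + (f + f) + 1 ≡ ((a + f) + (f + b)) + (suc c + suc c)
      arith = solve-∀
      eq : suc (size (flipOn X δ)) + (F + F) + 1 ≡ size δ + (suc C + suc C)
      eq = trans (cong (λ z → suc z + (F + F) + 1) (trans (size-split (flipOn X δ) X uX sX)
             (cong₂ _+_ (cong₂ _+_ (flip-same-in X δ) (flip-frus X δ)) (cong₂ _+_ (flip-frus X δ) (flip-same-out X δ)))))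
           (trans (arith (cross (frus δ) X X) (cross (frus δ) (L ∖ X) (L ∖ X)) F C) (cong (_+ (suc C + suc C)) (sym (size-split δ X uX sX))))

-- Unmatched vertices are coloured 0, the two ends of a frustrated edge ±2, or ±1 where a calm edge
-- joins ends of opposite sides.
tint : Bool → Bool → Bool → Bool → Color
tint d m h w = if d then anti (base m h w) else base m h w
  where
    base : Bool → Bool → Bool → Color
    base false _     _     = # 0
    base true  true  true  = # 1
    base true  true  false = # 2
    base true  false true  = # 9
    base true  false false = # 8

opaque
  unfolding okS shift

  -- After switching, the ends have colours 1 or 2 on one side and 9 or 8 on the other. Only the
  -- pair 1, 9 is too close for a negative edge, and it would require both `w` and `w′`.
  tint-frus : ∀ q d d′ h h′ w w′ → (isMinus q xor (d xor d′)) ✓ → (h xor h′) ✓ → not (w ∧ w′) ✓ →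
    okS q (tint d true h w) (tint d′ true h′ w′) ✓
  tint-frus = toWitness {a? = allS? λ _ → allB? λ _ → allB? λ _ → allB? λ _ → allB? λ _ → allB? λ _ → allB? λ _ → imp? (imp? (imp? chk))} tt

  -- Colour 0 is within distance 2 of all colours in use, and two colours of the same side are
  -- within distance 1. Across the sides only 1 and 9 are close enough, which is why both ends have
  -- to be marked.
  tint-calm : ∀ q d d′ m m′ h h′ w w′ → not (isMinus q xor (d xor d′)) ✓ → (m ∧ m′ ∧ (h xor h′) ⇒ w ∧ w′) ✓ →
    okS q (tint d m h w) (tint d′ m′ h′ w′) ✓
  tint-calm = toWitness {a? = allS? λ _ → allB? λ _ → allB? λ _ → allB? λ _ → allB? λ _ → allB? λ _ → allB? λ _ → allB? λ _ → allB? λ _ →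
    imp? (imp? chk)} tt

-- The minimal counterexample to the extension statement

record Counterexample (n : ℕ) : Set where
  field
    I      : Inst n
    P L    : List (Fin n)
    f₀     : Fin n → Color
    uq     : Unique (L ++ P)
    sparse : Sparse I P L
    nok4   : NoK4 I L
    -- Only the number of uncoloured vertices has to fall; the instance and the precolouring may
    -- change freely. Each use ends in a contradiction with `N`, so a doubly negated extension is
    -- enough.
    IH     : ∀ (I′ : Inst n) P′ L′ f′ → length L′ < length L → Unique (L′ ++ P′) → Sparse I′ P′ L′ → NoK4 I′ L′ →
             ¬ ¬ Ext I′ P′ L′ f′
    N      : ¬ Ext I P L f₀

module Min {n : ℕ} (M : Counterexample n) where
  open Counterexample M

  A : List (Fin n)
  A = L ++ P

  inA : ∀ {v} → v ∈ L → v ∈ A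
  inA = ∈-++⁺ˡ

  uqL : Unique L
  uqL = Unique-++ˡ L uq

  uqP : Unique P
  uqP = Unique-++ʳ L uq

  L∌P : ∀ {v} → v ∈ L → v ∉ P
  L∌P = Unique-++-disjoint L uq

  uq-sub : ∀ {S} → Unique S → S ⊆ L → Unique (S ++ P)
  uq-sub u s = Unique-++ u uqP (λ m → L∌P (s m))

  uq∖ : ∀ R → Unique ((L ∖ R) ++ P)
  uq∖ R = uq-sub (Unique-∖ uqL) ∖-⊆

  ∖P⊆A : ∀ R → ((L ∖ R) ++ P) ⊆ A
  ∖P⊆A R m with ∈-++⁻ (L ∖ R) m
  ... | inj₁ q = ∈-++⁺ˡ {xs = L} (∖-⊆ {R = R} q)
  ... | inj₂ q = ∈-++⁺ʳ L q

  ∖P∌R : ∀ R {v} → v ∈ L → v ∈ R → v ∉ (L ∖ R) ++ P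
  ∖P∌R R v∈L v∈R m with ∈-++⁻ (L ∖ R) m
  ... | inj₁ q = proj₂ (∈-∖⁻ L q) v∈R
  ... | inj₂ q = L∌P v∈L q

  A∖ : ∀ R {v} → v ∈ A → v ∉ R → v ∈ (L ∖ R) ++ P
  A∖ R m q with ∈-++⁻ L m
  ... | inj₁ l = ∈-++⁺ˡ (∈-∖⁺ l q)
  ... | inj₂ p = ∈-++⁺ʳ (L ∖ R) p

  Agree : List (Fin n) → (Fin n → Color) → Set
  Agree X f = ∀ v → v ∉ X → f v ≡ f₀ v

  length∖ : ∀ {R r} → r ∈ L → r ∈ R → length (L ∖ R) < length L
  length∖ {R} r∈L r∈R = length-missing (Unique-∖ uqL) ∖-⊆ r∈L (λ m → proj₂ (∈-∖⁻ L m) r∈R)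

  -- A tight set could be coloured first, since the remaining vertices are sparse relative to it.
  H₁ : ∀ {S x} → Unique S → S ⊆ L → x ∈ S → length S < length L → cst I P S + 1 ≤ 3 * length S
  H₁ {S} {x} u s x∈S l with (cst I P S + 1) ≤? (3 * length S)
  ... | yes q = q
  ... | no  q = ⊥-elim (IH I P S f₀ l (uq-sub u s) (λ T uT sT → sparse T uT (s ∘ sT))
                          (NoK4-st (λ _ _ → refl) s nok4) step₁)
    where
      tight : 3 * length S ≤ cst I P S
      tight = +-cancelʳ-≤ 1 _ _ (≤-trans (≤-reflexive (+-comm _ 1)) (≰⇒> q))
      P′ = S ++ P
      L′ = L ∖ S
      L′∌S : ∀ {y} → y ∈ L′ → y ∉ S
      L′∌S m = proj₂ (∈-∖⁻ L m)
      uq′ : Unique (L′ ++ P′)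
      uq′ = Unique-++ (Unique-∖ uqL) (uq-sub u s) λ m k →
        [ L′∌S m , L∌P (∖-⊆ m) ]′ (∈-++⁻ S k)
      sparse′ : Sparse I P′ L′
      sparse′ T uT sT = lin 0 (+-mono-≤ (sparse (T ++ S) (Unique-++ uT u (λ m → L′∌S (sT m)))
                           (λ m → [ ∖-⊆ ∘ sT , s ]′ (∈-++⁻ T m))) tight) eq
        where
          arith : ∀ a b c d → a + (3 * (c + d) + b) + 0 ≡ 3 * c + (a + b + 3 * d)
          arith = solve-∀
          eq : cst I P′ T + (3 * length (T ++ S) + cst I P S) + 0 ≡ 3 * length T + (cst I P (T ++ S) + 3 * length S)
          eq = trans (cong (λ z → cst I P′ T + (3 * z + cst I P S) + 0) (length-++ T))
               (trans (arith (cst I P′ T) (cst I P S) (length T) (length S))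
                 (cong (λ z → 3 * length T + (z + 3 * length S)) (sym (cst-++ I P T S))))
      step₁ : ¬ Ext I P S f₀
      step₁ (f₁ , ag₁ , g₁) = IH I P′ L′ f₁ (length∖ (s x∈S) x∈S) uq′ sparse′ (NoK4-st (λ _ _ → refl) ∖-⊆ nok4) step₂
        where
          step₂ : ¬ Ext I P′ L′ f₁
          step₂ (f₂ , ag₂ , g₂) = N (f₂ , ag , λ {a} {b} → good a b)
            where
              ag : Agree L f₂
              ag v v∉ = trans (ag₂ v (v∉ ∘ ∖-⊆)) (ag₁ v (v∉ ∘ s))
              old : ∀ {y} → y ∈ S ++ P → f₂ y ≡ f₁ y
              old {y} m = ag₂ y λ k → [ L′∌S k , L∌P (∖-⊆ k) ]′ (∈-++⁻ S m)
              good : ∀ a b → a ∈ L → b ∈ A → OK (c I a b) (f₂ a) (f₂ b)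
              good a b a∈ b∈ with a ∈? S | b ∈? S | ∈-++⁻ L b∈
              ... | yes p | yes q′ | _ = subst₂ (OK (c I a b)) (sym (old (∈-++⁺ˡ p))) (sym (old (∈-++⁺ˡ q′))) (g₁ p (∈-++⁺ˡ q′))
              ... | yes p | no _ | inj₂ r = subst₂ (OK (c I a b)) (sym (old (∈-++⁺ˡ p))) (sym (old (∈-++⁺ʳ S r))) (g₁ p (∈-++⁺ʳ S r))
              ... | yes p | no q′ | inj₁ r = subst (λ z → OK z (f₂ a) (f₂ b)) (csym I b a)
                    (OK-sym (g₂ (∈-∖⁺ r q′) (∈-++⁺ʳ L′ (∈-++⁺ˡ p))))
              ... | no p | yes q′ | _ = g₂ (∈-∖⁺ a∈ p) (∈-++⁺ʳ L′ (∈-++⁺ˡ q′))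
              ... | no p | no q′ | inj₁ r = g₂ (∈-∖⁺ a∈ p) (∈-++⁺ˡ (∈-∖⁺ r q′))
              ... | no p | no q′ | inj₂ r = g₂ (∈-∖⁺ a∈ p) (∈-++⁺ʳ L′ (∈-++⁺ʳ S r))

  Rest : List (Fin n) → Set
  Rest R = ∀ f → Agree (L ∖ R) f → Good I P (L ∖ R) f → ⊥

  direct : ∀ ps → Unique (dom ps) → dom ps ⊆ L → ∀ f → Agree (L ∖ dom ps) f → Good I P (L ∖ dom ps) f →
    Compat I f ((L ∖ dom ps) ++ P) ps → ⊥
  direct ps u s f ag g cp = N (f [ ps ] , ag′ , λ a b → good (in-X a) (in-XP b))
    where
      X = L ∖ dom ps
      in-X : ∀ {v} → v ∈ L → v ∈ dom ps ++ X
      in-X {v} m with v ∈? dom ps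
      ... | yes q = ∈-++⁺ˡ q
      ... | no q  = ∈-++⁺ʳ (dom ps) (∈-∖⁺ m q)
      in-XP : ∀ {v} → v ∈ A → v ∈ (dom ps ++ X) ++ P
      in-XP m with ∈-++⁻ L m
      ... | inj₁ q = ∈-++⁺ˡ (in-X q)
      ... | inj₂ q = ∈-++⁺ʳ (dom ps ++ X) q
      good = compat-good I P X f ps
        (Unique-++ u (uq∖ (dom ps)) (λ m → ∖P∌R (dom ps) (s m) m)) g cp
      ag′ : Agree L (f [ ps ])
      ag′ v q = trans ([]-out f ps (q ∘ s)) (ag v (q ∘ ∖-⊆))

  reduce-with : ∀ (J : Inst n) {R r} → r ∈ L → r ∈ R → Sparse J P (L ∖ R) → NoK4 J (L ∖ R) →
    (∀ f → Agree (L ∖ R) f → Good J P (L ∖ R) f → ⊥) → ⊥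
  reduce-with J {R} r∈L r∈R sp nk k = IH J P (L ∖ R) f₀ (length∖ r∈L r∈R) (uq∖ R) sp nk
    (λ { (f , ag , g) → k f ag g })

  reduce : ∀ {R r} → r ∈ L → r ∈ R → Rest R → ⊥
  reduce r∈L r∈R = reduce-with I r∈L r∈R (λ T uT sT → sparse T uT (∖-⊆ ∘ sT)) (NoK4-st (λ _ _ → refl) ∖-⊆ nok4)

  H₁′ : ∀ {R r} → r ∈ L → r ∈ R → ∀ S → Unique S → S ⊆ L ∖ R → 1 ≤ length S → cst I P S + 1 ≤ 3 * length S
  H₁′ r∈L r∈R (x ∷ S) u s _ = H₁ u (∖-⊆ ∘ s) 1st
    (length-missing u (∖-⊆ ∘ s) r∈L (λ m → proj₂ (∈-∖⁻ L (s m)) r∈R))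

  -- After a deletion every nonempty remaining set is proper and has slack 1 by `H₁`. This pays for
  -- one weak constraint anywhere, even towards a precoloured vertex.
  reduce-weak : ∀ {R r} a b ω → a ≢ b → r ∈ L → r ∈ R → a ∈ L ∖ R → b ∈ (L ∖ R) ++ P →
    (∀ f → Agree (L ∖ R) f → Good I P (L ∖ R) f → weakOK ω (f a) (f b) ≡ true → ⊥) → ⊥
  reduce-weak {R} a b ω a≢b r∈L r∈R a∈ b∈ k =
    reduce-with J r∈L r∈R sp (NoK4-st (st-modify I a b a≢b (addWk ω) (st-addWk ω)) ∖-⊆ nok4)
      (λ f ag g → k f ag (λ {u} {v} p q → OK-modify I a b a≢b (addWk ω) u v (OK-addWk ω (c I u v)) (g p q))
        (OK-addWk-at ω (c I a b) (subst (λ r → OK r (f a) (f b)) (modify-at I a b a≢b (addWk ω) 1 (addWk-cost ω)) (g a∈ b∈))))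
    where
      J = modify I a b a≢b (addWk ω)
      sp : Sparse J P (L ∖ R)
      sp [] u s = z≤n
      sp S@(_ ∷ _) u s = ≤-trans (cst-once I a b a≢b (addWk ω) 1 (addWk-cost ω) P S (uq-sub u (∖-⊆ ∘ s)))
        (H₁′ r∈L r∈R S u s (s≤s z≤n))

  -- Strong degree, number of weak constraints, and vertices of small degree

  s t : Fin n → ℕ
  s v = σ I v A
  t v = τ I v A

  record Nb (v : Fin n) (ns : List (Fin n)) : Set where
    field
      uniq     : Unique ns
      sub      : ns ⊆ A
      strong   : ∀ {w} → w ∈ ns → ∃ λ q → st (c I v w) ≡ just q
      complete : ∀ {w q} → w ∈ A → st (c I v w) ≡ just q → w ∈ ns
  open Nb public

  nbs : Fin n → List (Fin n)
  nbs v = filterᵇ (isStrong I v) A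

  nb : ∀ v → Nb v (nbs v)
  nb v = record
    { uniq = Unique-filterᵇ (isStrong I v) uq
    ; sub = λ m → proj₁ (∈filterᵇ (isStrong I v) A m)
    ; strong = λ m → isStrong-elim I v _ (proj₂ (∈filterᵇ (isStrong I v) A m))
    ; complete = λ m e → filterᵇ∈ (isStrong I v) m (isStrong-intro I v _ e)
    }

  length-nbs : ∀ v → length (nbs v) ≡ s v
  length-nbs v = trans (length-filterᵇ (isStrong I v) A) (∑-cong A (λ {w} _ → sym (sc≡𝟙 I v w)))

  nb0 : ∀ {v} → s v ≡ 0 → Nb v []
  nb0 {v} e with nbs v | nb v | trans (length-nbs v) e
  ... | [] | h | _ = h

  nb1 : ∀ {v} → s v ≡ 1 → ∃ λ a → Nb v (a ∷ [])
  nb1 {v} e with nbs v | nb v | trans (length-nbs v) e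
  ... | a ∷ [] | h | _ = a , h

  nb2 : ∀ {v} → s v ≡ 2 → ∃ λ a → ∃ λ b → Nb v (a ∷ b ∷ [])
  nb2 {v} e with nbs v | nb v | trans (length-nbs v) e
  ... | a ∷ b ∷ [] | h | _ = a , b , h

  excs-≤ : ∀ v R f → length (excs I v ((L ∖ R) ++ P) f) ≤ t v
  excs-≤ v R f = ≤-trans (≤-reflexive (length-excs I v ((L ∖ R) ++ P) f)) (∑-⊆ _ (uq∖ R) (∖P⊆A R))

  outer : ∀ v R f {k} → (∀ {w q} → w ∈ (L ∖ R) ++ P → st (c I v w) ≡ just q → okS q k (f w) ≡ true) →
    k ∉ excs I v ((L ∖ R) ++ P) f → ∀ {w} → w ∈ (L ∖ R) ++ P → OK (c I v w) k (f w)
  outer v R f h q m = mkOK (λ _ e → h m e) (excs-sound I v _ f q m)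

  no-loop : ∀ {v w q} → st (c I v w) ≡ just q → v ≢ w
  no-loop {v} e refl with trans (sym e) (cong st (cirr I v))
  ... | ()

  st-sym : ∀ {v w q} → st (c I v w) ≡ just q → st (c I w v) ≡ just q
  st-sym {v} {w} e = trans (cong st (csym I w v)) e

  light₀ : ∀ {v} → v ∈ L → s v ≡ 0 → t v ≤ 9 → ⊥
  light₀ {v} v∈ e l = reduce v∈ 1st λ f ag g →
    let R = v ∷ []
        k , _ , q = pick (λ _ → true) (excs I v ((L ∖ R) ++ P) f) (≤-trans (s≤s (≤-trans (excs-≤ v R f) l)) cnt-true)
    in direct ((v , k) ∷ []) ([] ∷ []) (λ { 1st → v∈ }) f ag g
         (outer v R f (λ m e′ → case complete (nb0 e) (∖P⊆A R m) e′ of λ ()) q , [] , tt)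

  light₁ : ∀ {v} → v ∈ L → s v ≡ 1 → t v ≤ 4 → ⊥
  light₁ {v} v∈ e l with nb1 e
  ... | a , h with strong h 1st
  ...   | q₁ , e₁ = reduce v∈ 1st λ f ag g →
    let R = v ∷ []
        k , o , q = pick (λ k → okS q₁ k (f a)) (excs I v ((L ∖ R) ++ P) f)
                      (≤-trans (s≤s (≤-trans (excs-≤ v R f) l)) (okS-5 q₁ (f a)))
    in direct ((v , k) ∷ []) ([] ∷ []) (λ { 1st → v∈ }) f ag g
         (outer v R f (λ m e′ → case complete h (∖P⊆A R m) e′ of
            λ { 1st → subst (λ z → okS z k (f a) ≡ true) (just-inj e₁ e′) o }) q , [] , tt)

  -- The path through `v` is replaced by the weak constraint it imposes. At least one end is still
  -- uncoloured, since with two precoloured ends `v` alone would have potential at most 3 - 4.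
  light₂ : ∀ {v} → v ∈ L → s v ≡ 2 → t v ≡ 0 → ⊥
  light₂ {v} v∈ e l with nb2 e
  ... | a , b , h with strong h 1st | strong h 2nd
  ...   | q₁ , e₁ | q₂ , e₂ = go (∈-++⁻ L (sub h 1st)) (∈-++⁻ L (sub h 2nd))
    where
      R = v ∷ []
      a≢b : a ≢ b
      a≢b refl = Unique-head (uniq h) 1st
      a≢v : a ≢ v
      a≢v refl = no-loop e₁ refl
      b≢v : b ≢ v
      b≢v refl = no-loop e₂ refl
      end : ∀ f → Agree (L ∖ R) f → Good I P (L ∖ R) f → weakOK (q₁ · q₂) (f a) (f b) ≡ true → ⊥
      end f ag g w with path-extends q₁ q₂ (f a) (f b) w
      ... | k , o , o′ = direct ((v , k) ∷ []) ([] ∷ []) (λ { 1st → v∈ }) f ag g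
         (outer v R f (λ m e′ → case complete h (∖P⊆A R m) e′ of
            λ { 1st → subst (λ z → okS z k (f a) ≡ true) (just-inj e₁ e′) o
              ; 2nd → subst (λ z → okS z k (f b) ≡ true) (just-inj e₂ e′) o′ })
            (λ m → case subst (λ z → k ∈ z) (len0 _ (≤-trans (excs-≤ v R f) (≤-reflexive l))) m of λ ()) , [] , tt)
        where
          len0 : ∀ (xs : List Color) → length xs ≤ 0 → xs ≡ []
          len0 [] _ = refl
      go : (a ∈ L) ⊎ (a ∈ P) → (b ∈ L) ⊎ (b ∈ P) → ⊥
      go (inj₁ a∈) _ = reduce-weak a b (q₁ · q₂) a≢b v∈ 1st (∈-∖⁺ a∈ (a≢v ∘ ∈-single))
        (A∖ R (sub h 2nd) (b≢v ∘ ∈-single)) end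
      go (inj₂ _) (inj₁ b∈) = reduce-weak b a (q₁ · q₂) (a≢b ∘ sym) v∈ 1st (∈-∖⁺ b∈ (b≢v ∘ ∈-single))
        (A∖ R (sub h 1st) (a≢v ∘ ∈-single)) (λ f ag g w → end f ag g (weakOK-sym (q₁ · q₂) (f b) (f a) w))
      go (inj₂ a∈) (inj₂ b∈) = <⇒≱ {3} {4} (≤ᵇ⇒≤ 4 4 tt) (≤-trans four (sparse (v ∷ []) ([] ∷ []) (λ { 1st → v∈ })))
        where
          two : ∀ w {q} → st (c I v w) ≡ just q → 2 ≤ cost (c I v w)
          two w e with c I v w
          ... | rel (just _) _ _ = s≤s (s≤s z≤n)
          four : 4 ≤ κ I v P
          four = ≤-trans (+-mono-≤ (two a e₁) (≤-trans (two b e₂) (m≤m+n _ 0)))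
            (∑-⊆ (λ w → cost (c I v w)) {a ∷ b ∷ []} (uniq h) (λ { 1st → a∈ ; 2nd → b∈ }))

  Strong : Fin n → Fin n → Set
  Strong v w = ∃ λ q → st (c I v w) ≡ just q

  Strong-sym : ∀ {v w} → Strong v w → Strong w v
  Strong-sym (q , e) = q , st-sym e

  cost-strong : ∀ {v w} → Strong v w → 2 ≤ cost (c I v w)
  cost-strong {v} {w} (_ , e) with c I v w
  ... | rel (just _) _ _ = s≤s (s≤s z≤n)

  κ-lower : ∀ v {ys Y} → Unique ys → ys ⊆ Y → (∀ {w} → w ∈ ys → Strong v w) → 2 * length ys ≤ κ I v Y
  κ-lower v {ys} {Y} u i h = ≤-trans
    (≤-trans (≤-reflexive (sym (∑-const ys 2))) (∑-mono ys (λ m → cost-strong (h m))))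
    (∑-⊆ (λ w → cost (c I v w)) u i)

  full : ∀ v ns → Unique ns → ns ⊆ A → (∀ {w} → w ∈ ns → Strong v w) → s v ≤ length ns →
    ∀ {w q} → w ∈ A → st (c I v w) ≡ just q → w ∈ ns
  full v ns u i h l m e = covers {xs = ns} {nbs v} u
    (λ k → let q , e′ = h k in filterᵇ∈ (isStrong I v) (i k) (isStrong-intro I v _ e′))
    (≤-trans (≤-reflexive (length-nbs v)) l) (complete (nb v) m e)

  -- Adding `u` to `S` allows 3 and costs at least 4. If the larger set is proper, its own slack of
  -- 1 yields slack 2 for `S`. If it is everything, it has slack 0 only, but then all constraints at
  -- `u` are charged, which costs at least 5 by hypothesis.
  two-slack : ∀ {u a b} → u ∈ L → 5 ≤ κ I u A → Strong u a → Strong u b → a ≢ b →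
    ∀ S → Unique S → S ⊆ L → a ∈ S → b ∈ S → u ∉ S → cst I P S + 2 ≤ 3 * length S
  two-slack {u} {a} {b} u∈ five ea eb a≢b S uS sS a∈ b∈ u∉ with length (u ∷ S) <? length L
  ... | yes l = lin 0 (+-mono-≤ (H₁ (u∉ ∷ᵘ uS) (λ { 1st → u∈ ; (there m) → sS m }) 1st l) four)
                  (arith (cst I P S) (length S) _)
    where
      four : 4 ≤ κ I u (S ++ P)
      four = κ-lower u {a ∷ b ∷ []} ((λ { (here e) → a≢b e }) ∷ᵘ ((λ ()) ∷ᵘ []))
        (λ { 1st → ∈-++⁺ˡ a∈ ; 2nd → ∈-++⁺ˡ b∈ })
        (λ { 1st → ea ; 2nd → eb })
      arith : ∀ x l k → x + 2 + (3 * (1 + l) + k) + 0 ≡ 3 * l + (x + k + 1 + 4)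
      arith = solve-∀
  ... | no l = lin 0 (+-mono-≤ (sparse (u ∷ S) (u∉ ∷ᵘ uS) inL) five′) (arith (cst I P S) (length S) _)
    where
      inL : (u ∷ S) ⊆ L
      inL 1st = u∈
      inL (there m)   = sS m
      cover : A ⊆ u ∷ S ++ P
      cover m with ∈-++⁻ L m
      ... | inj₂ p = there (∈-++⁺ʳ S p)
      ... | inj₁ q with covers (u∉ ∷ᵘ uS) inL (≮⇒≥ l) q
      ...   | here e = here e
      ...   | there k = there (∈-++⁺ˡ k)
      five′ : 5 ≤ κ I u (S ++ P)
      five′ = ≤-trans five (≤-trans (∑-⊆ (λ w → cost (c I u w)) uq cover)
        (≤-reflexive (cong (λ r → cost r + κ I u (S ++ P)) (cirr I u))))
      arith : ∀ x l k → x + 2 + (3 * (1 + l) + k) + 0 ≡ 3 * l + (x + k + 5)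
      arith = solve-∀

  κA : ∀ v → κ I v A ≡ 2 * s v + t v
  κA v = κ≡ I v A

  -- K₄ without the edge ab, negative once ab is added with the sign that u imposes.
  record Kite (u a b x y : Fin n) : Set where
    field
      {ua ub ax ay bx by xy} : Sign
      eua : st (c I u a) ≡ just ua
      eub : st (c I u b) ≡ just ub
      eax : st (c I a x) ≡ just ax
      eay : st (c I a y) ≡ just ay
      ebx : st (c I b x) ≡ just bx
      eby : st (c I b y) ≡ just by
      exy : st (c I x y) ≡ just xy
      n₁  : negTri ax ay xy ✓
      n₂  : negTri bx by xy ✓
      n₃  : negTri (ua · ub) ax bx ✓
      a∈  : a ∈ L
      b∈  : b ∈ L
      x∈  : x ∈ L
      y∈  : y ∈ L
      a≢b : a ≢ b
      x≢u : x ≢ u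
      y≢u : y ≢ u

  -- Delete u and join its neighbours a and b by an edge of sign ua · ub.
  module Gadget {u a b : Fin n} (u∈ : u ∈ L) (a∈ : a ∈ L) (b∈ : b ∈ L) {ua ub : Sign}
    (ea : st (c I u a) ≡ just ua) (eb : st (c I u b) ≡ just ub) (a≢b : a ≢ b)
    (s2 : s u ≡ 2) (t1 : 1 ≤ t u) (t2 : t u ≤ 2) where

    J : Inst n
    J = modify I a b a≢b (addSt (ua · ub))

    R : List (Fin n)
    R = u ∷ []

    five : 5 ≤ κ I u A
    five = ≤-trans (+-mono-≤ (≤-reflexive (cong (2 *_) (sym s2))) t1) (≤-reflexive (sym (κA u)))

    ab-only : ∀ {w q} → w ∈ A → st (c I u w) ≡ just q → w ∈ a ∷ b ∷ []
    ab-only = full u (a ∷ b ∷ []) ((λ { (here e) → a≢b e }) ∷ᵘ ((λ ()) ∷ᵘ []))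
      (λ { 1st → ∈-++⁺ˡ a∈ ; 2nd → ∈-++⁺ˡ b∈ })
      (λ { 1st → ua , ea ; 2nd → ub , eb }) (≤-reflexive s2)

    end : ∀ f → Agree (L ∖ R) f → Good I P (L ∖ R) f → okS (ua · ub) (f a) (f b) ≡ true → ⊥
    end f ag g o with pick (λ k → okS ua k (f a) ∧ okS ub k (f b)) (excs I u ((L ∖ R) ++ P) f)
        (≤-trans (s≤s (≤-trans (excs-≤ u R f) t2)) (edge-extends ua ub (f a) (f b) o))
    ... | k , h , q = direct ((u , k) ∷ []) ([] ∷ []) (λ { 1st → u∈ }) f ag g
      (outer u R f (λ m e → case ab-only (∖P⊆A R m) e of
        λ { 1st → subst (λ z → okS z k (f a) ≡ true) (just-inj ea e) (proj₁ (∧-elim h))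
          ; 2nd → subst (λ z → okS z k (f b) ≡ true) (just-inj eb e) (proj₂ (∧-elim {okS ua k (f a)} h)) }) q , [] , tt)

    kite? : Fin n → Fin n → Bool
    kite? x y = K4ᵇ J a b x y

    hasKite : Bool
    hasKite = anyL (λ x → anyL (kite? x) (L ∖ R)) (L ∖ R)

    hasKite-intro : ∀ {x y} → x ∈ L ∖ R → y ∈ L ∖ R → K4 J a b x y → hasKite ≡ true
    hasKite-intro {x} {y} x∈ y∈ k =
      anyL-intro (λ x → anyL (kite? x) (L ∖ R)) x∈ (anyL-intro (kite? x) y∈ (K4ᵇ-intro k))

    -- Only sets containing both `a` and `b` are charged for the new edge, and `two-slack` provides
    -- these with its cost 2.
    sparseJ : Sparse J P (L ∖ R)
    sparseJ S uS sS with a ∈? S | b ∈? S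
    ... | yes p | yes q = ≤-trans (cst-once I a b a≢b _ 2 (addSt-cost (ua · ub)) P S (uq-sub uS (∖-⊆ ∘ sS)))
            (two-slack u∈ five (ua , ea) (ub , eb) a≢b S uS (∖-⊆ ∘ sS) p q (λ m → proj₂ (∈-∖⁻ L (sS m)) 1st))
    ... | no p | _ = ≤-trans (≤-reflexive (cst-same I a b a≢b _ 2 (addSt-cost (ua · ub)) P S (inj₁ (out p a∈))))
            (sparse S uS (∖-⊆ ∘ sS))
      where
        out : ∀ {v} → v ∉ S → v ∈ L → v ∉ S ++ P
        out p v∈ m = [ p , L∌P v∈ ]′ (∈-++⁻ S m)
    ... | yes _ | no p = ≤-trans (≤-reflexive (cst-same I a b a≢b _ 2 (addSt-cost (ua · ub)) P S (inj₂ (out p b∈))))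
            (sparse S uS (∖-⊆ ∘ sS))
      where
        out : ∀ {v} → v ∉ S → v ∈ L → v ∉ S ++ P
        out p v∈ m = [ p , L∌P v∈ ]′ (∈-++⁻ S m)

    Neg3-old : ∀ {x y z} → isPair a b x y ≡ false → isPair a b x z ≡ false → isPair a b y z ≡ false →
      Neg3 J x y z → Neg3 I x y z
    Neg3-old {x} {y} {z} p q r (neg3 e₁ e₂ e₃ h) = neg3 (trans (cong st (sym (same x y p))) e₁)
      (trans (cong st (sym (same x z q))) e₂) (trans (cong st (sym (same y z r))) e₃) h
      where same = modify-other I a b a≢b (addSt (ua · ub)) 2 (addSt-cost (ua · ub))

    new-K4 : hasKite ≡ false → ∀ {x₁ x₂ x₃ x₄} → isPair a b x₁ x₂ ≡ true → x₃ ∈ L ∖ R → x₄ ∈ L ∖ R → K4 J x₁ x₂ x₃ x₄ → ⊥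
    new-K4 nk {x₁} {x₂} {x₃} {x₄} p m₃ m₄ k with isPair-elim a b x₁ x₂ p
    ... | inj₁ (refl , refl) = true≢false (hasKite-intro m₃ m₄ k) nk
    ... | inj₂ (refl , refl) = true≢false (hasKite-intro m₃ m₄ (K4-swap₁ k)) nk

    noK4J : hasKite ≡ false → NoK4 J (L ∖ R)
    noK4J nk {x₁} {x₂} {x₃} {x₄} m₁ m₂ m₃ m₄ k
      with Bool-cases (isPair a b x₁ x₂) | Bool-cases (isPair a b x₁ x₃) | Bool-cases (isPair a b x₁ x₄)
         | Bool-cases (isPair a b x₂ x₃) | Bool-cases (isPair a b x₂ x₄) | Bool-cases (isPair a b x₃ x₄)
    ... | inj₂ p₁₂ | inj₂ p₁₃ | inj₂ p₁₄ | inj₂ p₂₃ | inj₂ p₂₄ | inj₂ p₃₄ =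
      nok4 (∖-⊆ m₁) (∖-⊆ m₂) (∖-⊆ m₃) (∖-⊆ m₄)
        (k4 (Neg3-old p₁₂ p₁₃ p₂₃ (K4.abx k)) (Neg3-old p₁₂ p₁₄ p₂₄ (K4.aby k))
            (Neg3-old p₁₃ p₁₄ p₃₄ (K4.axy k)) (Neg3-old p₂₃ p₂₄ p₃₄ (K4.bxy k)))
    ... | inj₁ p | _ | _ | _ | _ | _ = new-K4 nk p m₃ m₄ k
    ... | inj₂ _ | inj₁ p | _ | _ | _ | _ = new-K4 nk p m₂ m₄ (K4-swap₂ k)
    ... | inj₂ _ | inj₂ _ | inj₁ p | _ | _ | _ = new-K4 nk p m₂ m₃ (K4-swap₂ (K4-swap₃ k))
    ... | inj₂ _ | inj₂ _ | inj₂ _ | inj₁ p | _ | _ = new-K4 nk p m₁ m₄ (K4-swap₂ (K4-swap₁ k))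
    ... | inj₂ _ | inj₂ _ | inj₂ _ | inj₂ _ | inj₁ p | _ = new-K4 nk p m₁ m₃ (K4-swap₂ (K4-swap₃ (K4-swap₁ k)))
    ... | inj₂ _ | inj₂ _ | inj₂ _ | inj₂ _ | inj₂ _ | inj₁ p =
      new-K4 nk p m₁ m₂ (K4-swap₂ (K4-swap₁ (K4-swap₃ (K4-swap₂ k))))

    a≢u : a ≢ u
    a≢u refl = no-loop ea refl

    b≢u : b ≢ u
    b≢u refl = no-loop eb refl

    a∈′ : a ∈ L ∖ R
    a∈′ = ∈-∖⁺ a∈ (a≢u ∘ ∈-single)

    b∈′ : b ∈ (L ∖ R) ++ P
    b∈′ = ∈-++⁺ˡ (∈-∖⁺ b∈ (b≢u ∘ ∈-single))

    -- The triangle is positive, so the edge already present between `a` and `b` has the sign wanted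
    -- for the new one, and deleting `u` is enough.
    gadget-edge : ∀ {q} → tri I u a b ≡ false → st (c I a b) ≡ just q → ⊥
    gadget-edge {q} nt e = reduce u∈ 1st λ f ag g → end f ag g
          (subst (λ z → okS z (f a) (f b) ≡ true) same (strongOK (g a∈′ b∈′) q e))
      where
        same : q ≡ ua · ub
        same with negTri ua ub q in h
        ... | true = ⊥-elim (true≢false (tri-complete I u a b (neg3 ea eb e h)) nt)
        ... | false = negTri-false ua ub q h

    stJ : st (c I a b) ≡ nothing → st (c J a b) ≡ just (ua · ub)
    stJ e = trans (cong st (modify-at I a b a≢b (addSt (ua · ub)) 2 (addSt-cost (ua · ub)))) (addSt-at (ua · ub) (c I a b) e)

    gadget-new : hasKite ≡ false → st (c I a b) ≡ nothing → ⊥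
    gadget-new nk e = reduce-with J u∈ 1st sparseJ (noK4J nk) λ f ag g → end f ag
          (λ {x} {y} p q → OK-modify I a b a≢b (addSt (ua · ub)) x y (OK-addSt (ua · ub) (c I x y)) (g p q))
          (strongOK (g a∈′ b∈′) (ua · ub) (stJ e))

    no-loopJ : ∀ {v w q} → st (c J v w) ≡ just q → v ≢ w
    no-loopJ {v} e refl with trans (sym e) (cong st (cirr J v))
    ... | ()

    -- Sparsity survives the new edge, so the induction can only fail because a negative K₄ through
    -- `ab` appears. Its five other edges were there before.
    kite : tri I u a b ≡ false → ∃ λ x → ∃ λ y → Kite u a b x y
    kite nt = go (st (c I a b)) refl
      where
        go : ∀ m → st (c I a b) ≡ m → ∃ λ x → ∃ λ y → Kite u a b x y
        go (just q) e = ⊥-elim (gadget-edge nt e)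
        go nothing e with Bool-cases hasKite
        ... | inj₂ nk = ⊥-elim (gadget-new nk e)
        ... | inj₁ hk with anyL-elim (λ x → anyL (kite? x) (L ∖ R)) (L ∖ R) hk
        ...   | x , x∈ , h with anyL-elim (kite? x) (L ∖ R) h
        ...     | y , y∈ , h′ with K4ᵇ-elim {I = J} {a} {b} {x} {y} h′
        ...       | k4 (neg3 {p} e₁ e₂ e₃ n₁) _ (neg3 f₁ f₂ f₃ n₂) (neg3 {q₁} {q₂} g₁ g₂ g₃ n₃) =
          x , y , record
            { eua = ea ; eub = eb
            ; eax = old a≢x (no-pairˡ x≢b) f₁
            ; eay = old a≢y (no-pairˡ y≢b) f₂
            ; ebx = old b≢x (no-pairʳ x≢a) g₁
            ; eby = old b≢y (no-pairʳ y≢a) g₂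
            ; exy = old (no-loopJ f₃) (no-pairˣ {z = y} (a≢x ∘ sym) (b≢x ∘ sym)) f₃
            ; n₁ = n₂ ; n₂ = subst (λ z → negTri q₁ q₂ z ≡ true) (just-inj g₃ f₃) n₃
            ; n₃ = subst₂ (λ z w → negTri z w _ ≡ true) (just-inj e₁ (stJ e)) (just-inj e₂ f₁)
                     (subst (λ z → negTri p _ z ≡ true) (just-inj e₃ g₁) n₁)
            ; a∈ = a∈ ; b∈ = b∈ ; x∈ = ∖-⊆ x∈ ; y∈ = ∖-⊆ y∈
            ; a≢b = a≢b
            ; x≢u = λ { refl → proj₂ (∈-∖⁻ L x∈) 1st }
            ; y≢u = λ { refl → proj₂ (∈-∖⁻ L y∈) 1st }
            }
          where
            a≢x = no-loopJ f₁
            a≢y = no-loopJ f₂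
            b≢x = no-loopJ g₁
            b≢y = no-loopJ g₂
            x≢a = a≢x ∘ sym
            y≢a = a≢y ∘ sym
            x≢b = b≢x ∘ sym
            y≢b = b≢y ∘ sym
            no-pairˡ : ∀ {z} → z ≢ b → isPair a b a z ≢ true
            no-pairˡ {z} z≢b h with isPair-elim a b a z h
            ... | inj₁ (_ , q) = z≢b q
            ... | inj₂ (q , _) = a≢b q
            no-pairʳ : ∀ {z} → z ≢ a → isPair a b b z ≢ true
            no-pairʳ {z} z≢a h with isPair-elim a b b z h
            ... | inj₁ (q , _) = a≢b (sym q)
            ... | inj₂ (_ , q) = z≢a q
            no-pairˣ : ∀ {v z} → v ≢ a → v ≢ b → isPair a b v z ≢ true
            no-pairˣ {v} {z} v≢a v≢b h with isPair-elim a b v z h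
            ... | inj₁ (q , _) = v≢a q
            ... | inj₂ (q , _) = v≢b q
            old : ∀ {v z q} → v ≢ z → isPair a b v z ≢ true → st (c J v z) ≡ just q → st (c I v z) ≡ just q
            old {v} {z} _ np e with Bool-cases (isPair a b v z)
            ... | inj₁ h = ⊥-elim (np h)
            ... | inj₂ h = trans (cong st (sym (modify-other I a b a≢b (addSt (ua · ub)) 2 (addSt-cost (ua · ub)) v z h))) e

  -- Reducible triangles

  at : ∀ {v w q i j} → st (c I v w) ≡ just q → okS q i j ≡ true → ∀ q′ → st (c I v w) ≡ just q′ → okS q′ i j ≡ true
  at {i = i} {j} e o q′ e′ = subst (λ z → okS z i j ≡ true) (just-inj e e′) o

  inner : ∀ {v w q i j} → st (c I v w) ≡ just q → okS q i j ≡ true → trivial i j ≡ true → OK (c I v w) i j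
  inner e o tr = OK-trivial (at e o) tr

  full₂ : ∀ {v a b} → Strong v a → Strong v b → a ≢ b → a ∈ A → b ∈ A → s v ≤ 2 →
    ∀ {w q} → w ∈ A → st (c I v w) ≡ just q → w ∈ a ∷ b ∷ []
  full₂ {v} {a} {b} ea eb a≢b a∈ b∈ = full v (a ∷ b ∷ []) ((λ { (here e) → a≢b e }) ∷ᵘ ((λ ()) ∷ᵘ []))
    (λ { 1st → a∈ ; 2nd → b∈ }) (λ { 1st → ea ; 2nd → eb })

  full₃ : ∀ {v a b d} → Strong v a → Strong v b → Strong v d → a ≢ b → a ≢ d → b ≢ d → a ∈ A → b ∈ A → d ∈ A → s v ≤ 3 →
    ∀ {w q} → w ∈ A → st (c I v w) ≡ just q → w ∈ a ∷ b ∷ d ∷ []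
  full₃ {v} {a} {b} {d} ea eb ed a≢b a≢d b≢d a∈ b∈ d∈ = full v (a ∷ b ∷ d ∷ [])
    ((λ { (here e) → a≢b e ; (there (here e)) → a≢d e }) ∷ᵘ ((λ { (here e) → b≢d e }) ∷ᵘ ((λ ()) ∷ᵘ [])))
    (λ { 1st → a∈ ; 2nd → b∈ ; 3rd → d∈ })
    (λ { 1st → ea ; 2nd → eb ; 3rd → ed })

  no-excs : ∀ v R f {k} → t v ≤ 0 → k ∉ excs I v ((L ∖ R) ++ P) f
  no-excs v R f {k} t0 m with excs I v ((L ∖ R) ++ P) f | excs-≤ v R f
  no-excs v R f t0 () | [] | _
  ... | _ ∷ _ | l = <⇒≱ (s≤s z≤n) (≤-trans l t0)

  uq₂ : {a b : Fin n} → a ≢ b → Unique (a ∷ b ∷ [])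
  uq₂ p = (λ { (here e) → p e }) ∷ᵘ ((λ ()) ∷ᵘ [])

  uq₃ : {a b d : Fin n} → a ≢ b → a ≢ d → b ≢ d → Unique (a ∷ b ∷ d ∷ [])
  uq₃ p q r = (λ { (here e) → p e ; (there (here e)) → q e }) ∷ᵘ uq₂ r

  -- At most three colours are forbidden by weak constraints at `u` and `a`, which is the bound
  -- required by `tri-choose`.
  tri-two : ∀ {u a b} → u ∈ L → a ∈ L → b ∈ A → Neg3 I u a b → s u ≤ 2 → t u ≤ 1 → s a ≤ 2 → t a ≤ 2 → ⊥
  tri-two {u} {a} {b} u∈ a∈ b∈ (neg3 {ua} {ub} {ab} e₁ e₂ e₃ ng) su tu sa ta =
    reduce u∈ 1st λ f ag g →
    let Y = (L ∖ R) ++ P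
        k , l , o₁ , o₂ , o₃ , k∉ , l∉ = tri-choose ua ub ab (f b) (excs I a Y f) (excs I u Y f) ng
          (+-mono-≤ (≤-trans (excs-≤ a R f) ta) (≤-trans (excs-≤ u R f) tu))
    in direct ((u , l) ∷ (a , k) ∷ []) (uq₂ (no-loop e₁)) (λ { 1st → u∈ ; 2nd → a∈ }) f ag g
      ( outer u R f (λ m e → case full₂ (ua , e₁) (ub , e₂) (no-loop e₃) (inA a∈) b∈ su (∖P⊆A R m) e of
          λ { 1st → ⊥-elim (∖P∌R R a∈ 2nd m)
            ; 2nd → at e₂ o₃ _ e }) l∉
      , inner e₁ o₂ (negTri-trivial ua ub ab l k (f b) ng o₂ o₃ o₁) ∷ []
      , outer a R f (λ m e → case full₂ (ua , st-sym e₁) (ab , e₃) (no-loop e₂) (inA u∈) b∈ sa (∖P⊆A R m) e of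
          λ { 1st → ⊥-elim (∖P∌R R u∈ 1st m)
            ; 2nd → at e₃ o₁ _ e }) k∉
      , [] , tt)
    where
      R : List (Fin n)
      R = u ∷ a ∷ []

  -- With the triangle switched to three negative edges, `u` has two choices when `a` is at distance
  -- 3 from `b`. The five colours that `α` allows at `a` miss both colours at this distance only if
  -- they are centred at the colour of `b`. The weak constraint added between `b` and `α` excludes
  -- precisely that.
  tri-three-nbr : ∀ {u a b α aα} → u ∈ L → a ∈ L → b ∈ L → α ∈ A → Neg3 I u a b → st (c I a α) ≡ just aα → α ≢ u → α ≢ b →
    s u ≤ 2 → t u ≤ 1 → s a ≤ 3 → t a ≤ 0 → ⊥
  tri-three-nbr {u} {a} {b} {α} {aα} u∈ a∈ b∈ α∈ (neg3 {ua} {ub} {ab} e₁ e₂ e₃ ng) e₄ α≢u α≢b su tu sa ta =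
    reduce-weak b α (ab · aα) (α≢b ∘ sym) u∈ 1st
      (∈-∖⁺ b∈ λ { 1st → no-loop e₂ refl ; 2nd → no-loop e₃ refl })
      (A∖ R α∈ λ { (here e) → α≢u e ; 2nd → no-loop e₄ refl })
      λ f ag g w →
    let Y = (L ∖ R) ++ P
        k , o₁ , o₄ , two = tri-pendant ua ub ab aα (f b) (f α) ng w
        l , h , l∉ = pick (λ u → okS ua u k ∧ okS ub u (f b)) (excs I u Y f) (≤-trans (s≤s (≤-trans (excs-≤ u R f) tu)) two)
        o₂ , o₃ = ∧-elim {okS ua l k} h
    in direct ((u , l) ∷ (a , k) ∷ []) (uq₂ (no-loop e₁)) (λ { 1st → u∈ ; 2nd → a∈ }) f ag g
      ( outer u R f (λ m e → case full₂ (ua , e₁) (ub , e₂) (no-loop e₃) (inA a∈) (inA b∈) su (∖P⊆A R m) e of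
          λ { 1st → ⊥-elim (∖P∌R R a∈ 2nd m)
            ; 2nd → at e₂ o₃ _ e }) l∉
      , inner e₁ o₂ (negTri-trivial ua ub ab l k (f b) ng o₂ o₃ o₁) ∷ []
      , outer a R f (λ m e → case full₃ (ua , st-sym e₁) (ab , e₃) (aα , e₄) (no-loop e₂) (α≢u ∘ sym) (α≢b ∘ sym)
                                   (inA u∈) (inA b∈) α∈ sa (∖P⊆A R m) e of
          λ { 1st → ⊥-elim (∖P∌R R u∈ 1st m)
            ; 2nd → at e₃ o₁ _ e
            ; 3rd → at e₄ o₄ _ e }) (no-excs a R f ta)
      , [] , tt)
    where
      R : List (Fin n)
      R = u ∷ a ∷ []

  -- By `diamond` there are two choices for `v`, then two for each apex; each of these vertices
  -- loses at most one colour to a weak constraint.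
  two-tri : ∀ {v w u₁ u₂} → v ∈ L → w ∈ A → u₁ ∈ L → u₂ ∈ L → u₁ ≢ u₂ → Neg3 I u₁ v w → Neg3 I u₂ v w →
    s v ≤ 3 → t v ≤ 1 → s u₁ ≤ 2 → t u₁ ≤ 1 → s u₂ ≤ 2 → t u₂ ≤ 1 → ⊥
  two-tri {v} {w} {u₁} {u₂} v∈ w∈ u₁∈ u₂∈ u₁≢u₂ (neg3 {v₁} {w₁} {vw} e₁ e₂ e₃ n₁) (neg3 {v₂} {w₂} {vw′} e₄ e₅ e₆ n₂′) sv tv s₁ t₁ s₂ t₂ =
    reduce v∈ 3rd λ f ag g →
    case pick (λ v → okS vw v (f w) ∧ (2 ≤ᵇ cnt λ u → okS v₁ u v ∧ okS w₁ u (f w)) ∧ (2 ≤ᵇ cnt λ u → okS v₂ u v ∧ okS w₂ u (f w)))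
          (excs I v ((L ∖ R) ++ P) f) (≤-trans (s≤s (≤-trans (excs-≤ v R f) tv)) (diamond vw v₁ w₁ v₂ w₂ (f w) n₁ n₂)) of λ { (k , h , k∉) →
    case ∧-elim {okS vw k (f w)} h of λ { (o , h′) →
    case ∧-elim {2 ≤ᵇ cnt λ u → okS v₁ u k ∧ okS w₁ u (f w)} h′ of λ { (c₁ , c₂) →
    case pick (λ u → okS v₁ u k ∧ okS w₁ u (f w)) (excs I u₁ ((L ∖ R) ++ P) f)
          (≤-trans (s≤s (≤-trans (excs-≤ u₁ R f) t₁)) (≤ᵇ-elim {2} c₁)) of λ { (k₁ , h₁ , k₁∉) →
    case ∧-elim {okS v₁ k₁ k} h₁ of λ { (o₁ , o₂) →
    -- The apex `u₂` is coloured last, so a weak constraint towards `u₁` counts among its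
    -- exclusions. Together with the outside ones there are still at most `t u₂`.
    case pick (λ u → okS v₂ u k ∧ okS w₂ u (f w)) (excRel (c I u₂ u₁) k₁ ++ excs I u₂ ((L ∖ R) ++ P) f)
          (≤-trans (s≤s (≤-trans (≤-reflexive (trans (length-++ (excRel (c I u₂ u₁) k₁)) (cong₂ _+_ (length-excRel (c I u₂ u₁) k₁) (length-excs I u₂ ((L ∖ R) ++ P) f))))
            (≤-trans (∑-⊆ (λ w → wc (c I u₂ w)) {u₁ ∷ (L ∖ R) ++ P} (∖P∌R R u₁∈ 2nd ∷ᵘ uq∖ R)
                       (λ { 1st → ∈-++⁺ˡ u₁∈ ; (there m) → ∖P⊆A R m })) t₂))) (≤ᵇ-elim {2} c₂)) of λ { (k₂ , h₂ , k₂∉) →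
    case ∧-elim {okS v₂ k₂ k} h₂ of λ { (o₃ , o₄) →
    direct ((u₂ , k₂) ∷ (u₁ , k₁) ∷ (v , k) ∷ []) (uq₃ (u₁≢u₂ ∘ sym) (no-loop e₄) (no-loop e₁))
         (λ { 1st → u₂∈ ; 2nd → u₁∈ ; 3rd → v∈ }) f ag g
      ( outer u₂ R f (λ m e → case only₂ (∖P⊆A R m) e of
          λ { 1st → ⊥-elim (∖P∌R R v∈ 3rd m)
            ; 2nd → at e₅ o₄ _ e }) (∉-++ʳ (excRel (c I u₂ u₁) k₁) k₂∉)
      , mkOK (λ q e → case only₂ (inA u₁∈) e of
          λ { 1st → ⊥-elim (no-loop e₁ refl) ; 2nd → ⊥-elim (no-loop e₂ refl) })
          (excRel-sound (c I u₂ u₁) k₂ k₁ (∉-++ˡ k₂∉))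
        ∷ inner e₄ o₃ (negTri-trivial v₂ w₂ vw k₂ k (f w) n₂ o₃ o₄ o) ∷ []
      , outer u₁ R f (λ m e → case full₂ (v₁ , e₁) (w₁ , e₂) (no-loop e₃) (inA v∈) w∈ s₁ (∖P⊆A R m) e of
          λ { 1st → ⊥-elim (∖P∌R R v∈ 3rd m)
            ; 2nd → at e₂ o₂ _ e }) k₁∉
      , inner e₁ o₁ (negTri-trivial v₁ w₁ vw k₁ k (f w) n₁ o₁ o₂ o) ∷ []
      , outer v R f (λ m e → case full₃ (v₁ , st-sym e₁) (v₂ , st-sym e₄) (vw , e₃) u₁≢u₂ (no-loop e₂) (no-loop e₅)
                                   (inA u₁∈) (inA u₂∈) w∈ sv (∖P⊆A R m) e of
          λ { 1st → ⊥-elim (∖P∌R R u₁∈ 2nd m)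
            ; 2nd → ⊥-elim (∖P∌R R u₂∈ 1st m)
            ; 3rd → at e₃ o _ e }) k∉
      , [] , tt) }}}}}}}
    where
      R : List (Fin n)
      R = u₂ ∷ u₁ ∷ v ∷ []
      n₂ : negTri v₂ w₂ vw ≡ true
      n₂ = subst (λ z → negTri v₂ w₂ z ≡ true) (just-inj e₆ e₃) n₂′
      only₂ : ∀ {z q} → z ∈ A → st (c I u₂ z) ≡ just q → z ∈ v ∷ w ∷ []
      only₂ = full₂ (v₂ , e₄) (w₂ , e₅) (no-loop e₃) (inA v∈) w∈ s₂

  -- b takes the colour r and u, a follow by rotation; p is what b still allows.
  tri-rotate : ∀ {u a b} → u ∈ L → a ∈ L → b ∈ L → Neg3 I u a b → s u ≤ 2 → s a ≤ 2 →
    (p : (Fin n → Color) → Color → Bool) →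
    (∀ f → t u + (t a + t b) < cnt (p f)) →
    (∀ f {r w q} → p f r ≡ true → w ∈ (L ∖ (u ∷ a ∷ b ∷ [])) ++ P → st (c I b w) ≡ just q → okS q r (f w) ≡ true) → ⊥
  tri-rotate {u} {a} {b} u∈ a∈ b∈ (neg3 {ua} {ub} {ab} e₁ e₂ e₃ ng) su sa p big good =
    reduce u∈ 1st λ f ag g →
    let Y = (L ∖ R) ++ P
        Eu = map (ρ⁻ 3 (minus · ub)) (excs I u Y f)
        Ea = map (ρ⁻ 6 (minus · ab)) (excs I a Y f)
        Eb = excs I b Y f
        r , pr , r∉ = pick (p f) (Eu ++ (Ea ++ Eb)) (≤-trans (s≤s (≤-trans
          (≤-reflexive (trans (length-++ Eu) (cong₂ _+_ (length-map _ (excs I u Y f))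
            (trans (length-++ Ea) (cong (_+ length Eb) (length-map _ (excs I a Y f)))))))
          (+-mono-≤ (excs-≤ u R f) (+-mono-≤ (excs-≤ a R f) (excs-≤ b R f))))) (big f))
        o₁ , o₂ , o₃ = rot-tri ua ub ab r ng
        k = ρ 3 (minus · ub) r
        l = ρ 6 (minus · ab) r
    in direct ((u , k) ∷ (a , l) ∷ (b , r) ∷ []) (uq₃ (no-loop e₁) (no-loop e₂) (no-loop e₃))
         (λ { 1st → u∈ ; 2nd → a∈ ; 3rd → b∈ }) f ag g
      ( outer u R f (λ m e → case full₂ (ua , e₁) (ub , e₂) (no-loop e₃) (inA a∈) (inA b∈) su (∖P⊆A R m) e of
          λ { 1st → ⊥-elim (∖P∌R R a∈ 2nd m)
            ; 2nd → ⊥-elim (∖P∌R R b∈ 3rd m) })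
          (ρ-avoid c3 (minus · ub) _ (∉-++ˡ r∉))
      , inner e₁ o₁ (negTri-trivial ua ub ab k l r ng o₁ o₂ o₃)
        ∷ inner e₂ o₂ (negTri-trivial ub ua ab k r l (negTri-swap ua ub ab ng) o₂ o₁ (okS-sym ab l r o₃)) ∷ []
      , outer a R f (λ m e → case full₂ (ua , st-sym e₁) (ab , e₃) (no-loop e₂) (inA u∈) (inA b∈) sa (∖P⊆A R m) e of
          λ { 1st → ⊥-elim (∖P∌R R u∈ 1st m)
            ; 2nd → ⊥-elim (∖P∌R R b∈ 3rd m) })
          (ρ-avoid c6 (minus · ab) _ (∉-++ˡ (∉-++ʳ Eu r∉)))
      , inner e₃ o₃ (negTri-trivial ab ua ub l r k (negTri-rotate ua ub ab ng) o₃ (okS-sym ua k l o₁) (okS-sym ub k r o₂)) ∷ []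
      , outer b R f (λ m e → good f pr m e) (∉-++ʳ Ea (∉-++ʳ Eu r∉))
      , [] , tt)
    where
      R : List (Fin n)
      R = u ∷ a ∷ b ∷ []
      c3 c6 : Color
      c3 = suc (suc (suc zero))
      c6 = suc (suc (suc (suc (suc (suc zero)))))

  tri-two-three : ∀ {u a b α β aα bβ} → u ∈ L → a ∈ L → b ∈ L → α ∈ A → β ∈ A → Neg3 I u a b →
    st (c I a α) ≡ just aα → α ≢ u → α ≢ b → st (c I b β) ≡ just bβ → β ≢ u → β ≢ a →
    s u ≤ 2 → t u ≤ 2 → s a ≤ 3 → t a ≤ 0 → s b ≤ 3 → t b ≤ 0 → ⊥
  tri-two-three {u} {a} {b} {α} {β} {aα} {bβ} u∈ a∈ b∈ α∈ β∈ (neg3 {ua} {ub} {ab} e₁ e₂ e₃ ng) e₄ α≢u α≢b e₅ β≢u β≢a su tu sa ta sb tb =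
    reduce u∈ 1st λ f ag g →
    case tri-spread ua ub ab aα bβ (f α) (f β) (excs I u ((L ∖ R) ++ P) f) ng (≤-trans (excs-≤ u R f) tu) of
    λ { (k , l , r , o₁ , o₂ , o₃ , o₄ , o₅ , k∉) → direct ((u , k) ∷ (a , l) ∷ (b , r) ∷ []) (uq₃ (no-loop e₁) (no-loop e₂) (no-loop e₃))
         (λ { 1st → u∈ ; 2nd → a∈ ; 3rd → b∈ }) f ag g
      ( outer u R f (λ m e → case full₂ (ua , e₁) (ub , e₂) (no-loop e₃) (inA a∈) (inA b∈) su (∖P⊆A R m) e of
          λ { 1st → ⊥-elim (∖P∌R R a∈ 2nd m)
            ; 2nd → ⊥-elim (∖P∌R R b∈ 3rd m) }) k∉
      , inner e₁ o₁ (negTri-trivial ua ub ab k l r ng o₁ o₂ o₃)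
        ∷ inner e₂ o₂ (negTri-trivial ub ua ab k r l (negTri-swap ua ub ab ng) o₂ o₁ (okS-sym ab l r o₃)) ∷ []
      , outer a R f (λ m e → case full₃ (ua , st-sym e₁) (ab , e₃) (aα , e₄) (no-loop e₂) (α≢u ∘ sym) (α≢b ∘ sym)
                                   (inA u∈) (inA b∈) α∈ sa (∖P⊆A R m) e of
          λ { 1st → ⊥-elim (∖P∌R R u∈ 1st m)
            ; 2nd → ⊥-elim (∖P∌R R b∈ 3rd m)
            ; 3rd → at e₄ o₄ _ e }) (no-excs a R f ta)
      , inner e₃ o₃ (negTri-trivial ab ua ub l r k (negTri-rotate ua ub ab ng) o₃ (okS-sym ua k l o₁) (okS-sym ub k r o₂)) ∷ []
      , outer b R f (λ m e → case full₃ (ub , st-sym e₂) (ab , st-sym e₃) (bβ , e₅) (no-loop e₁) (β≢u ∘ sym) (β≢a ∘ sym)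
                                   (inA u∈) (inA a∈) β∈ sb (∖P⊆A R m) e of
          λ { 1st → ⊥-elim (∖P∌R R u∈ 1st m)
            ; 2nd → ⊥-elim (∖P∌R R a∈ 2nd m)
            ; 3rd → at e₅ o₅ _ e }) (no-excs b R f tb)
      , [] , tt) }
    where
      R : List (Fin n)
      R = u ∷ a ∷ b ∷ []

  -- Kites

  outer-closed : ∀ v R ns f {k} → R ⊆ L → ns ⊆ R → (∀ {w q} → w ∈ A → st (c I v w) ≡ just q → w ∈ ns) →
    k ∉ excs I v ((L ∖ R) ++ P) f → ∀ {w} → w ∈ (L ∖ R) ++ P → OK (c I v w) k (f w)
  outer-closed v R ns f R⊆L ns⊆R h q = outer v R f
    (λ m e → let z = ns⊆R (h (∖P⊆A R m) e) in ⊥-elim (∖P∌R R (R⊆L z) z m)) q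

  grow : ∀ v S {ys k} → Unique ys → ys ⊆ S → (∀ {w} → w ∈ ys → Strong v w) → k ≤ cst I P S →
    k + 2 * length ys ≤ cst I P (v ∷ S)
  grow v S u i h l = +-mono-≤ l (κ-lower v u (∈-++⁺ˡ ∘ i) h)

  s-lower : ∀ v {ys} → Unique ys → ys ⊆ A → (∀ {w} → w ∈ ys → Strong v w) → length ys ≤ s v
  s-lower v {ys} u i h = ≤-trans (length-⊆ u (λ m → complete (nb v) (i m) (proj₂ (h m)))) (≤-reflexive (length-nbs v))

  module KiteFacts {u a b x y : Fin n} (u∈ : u ∈ L) (K : Kite u a b x y) where
    open Kite K public
    u≢a : u ≢ a
    u≢a = no-loop eua
    u≢b : u ≢ b
    u≢b = no-loop eub
    a≢x : a ≢ x
    a≢x = no-loop eax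
    a≢y : a ≢ y
    a≢y = no-loop eay
    b≢x : b ≢ x
    b≢x = no-loop ebx
    b≢y : b ≢ y
    b≢y = no-loop eby
    x≢y : x ≢ y
    x≢y = no-loop exy

    K⊆L : (a ∷ b ∷ x ∷ y ∷ []) ⊆ L
    K⊆L 1st = a∈
    K⊆L 2nd = b∈
    K⊆L 3rd = x∈
    K⊆L 4th = y∈

    uqK : Unique (a ∷ b ∷ x ∷ y ∷ [])
    uqK = (λ { (here e) → a≢b e ; (there (here e)) → a≢x e ; (there (there (here e))) → a≢y e }) ∷ᵘ uq₃ b≢x b≢y x≢y

    u∉K : u ∉ a ∷ b ∷ x ∷ y ∷ []
    u∉K (here e) = u≢a e
    u∉K (there (here e)) = u≢b e
    u∉K (there (there (here e))) = x≢u (sym e)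
    u∉K (there (there (there (here e)))) = y≢u (sym e)

    only-u : s u ≤ 2 → ∀ {w q} → w ∈ A → st (c I u w) ≡ just q → w ∈ a ∷ b ∷ []
    only-u = full₂ (ua , eua) (ub , eub) a≢b (inA a∈) (inA b∈)

    only-a : s a ≤ 3 → ∀ {w q} → w ∈ A → st (c I a w) ≡ just q → w ∈ u ∷ x ∷ y ∷ []
    only-a = full₃ (ua , st-sym eua) (ax , eax) (ay , eay) (x≢u ∘ sym) (y≢u ∘ sym) x≢y (inA u∈) (inA x∈) (inA y∈)

    only-b : s b ≤ 3 → ∀ {w q} → w ∈ A → st (c I b w) ≡ just q → w ∈ u ∷ x ∷ y ∷ []
    only-b = full₃ (ub , st-sym eub) (bx , ebx) (by , eby) (x≢u ∘ sym) (y≢u ∘ sym) x≢y (inA u∈) (inA x∈) (inA y∈)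

    only-x : s x ≤ 3 → ∀ {w q} → w ∈ A → st (c I x w) ≡ just q → w ∈ a ∷ b ∷ y ∷ []
    only-x = full₃ (ax , st-sym eax) (bx , st-sym ebx) (xy , exy) a≢b a≢y b≢y (inA a∈) (inA b∈) (inA y∈)

    only-y : s y ≤ 3 → ∀ {w q} → w ∈ A → st (c I y w) ≡ just q → w ∈ a ∷ b ∷ x ∷ []
    only-y = full₃ (ay , st-sym eay) (by , st-sym eby) (xy , st-sym exy) a≢b a≢x b≢x (inA a∈) (inA b∈) (inA x∈)

    -- All strong neighbours of the five vertices lie in the configuration, and the pattern of
    -- `rot-K` meets every weak constraint inside it. Each weak constraint to the outside spoils one
    -- of the ten rotations, and there are at most nine.
    kite-rotate : s u ≤ 2 → s a ≤ 3 → s b ≤ 3 → s x ≤ 3 → s y ≤ 3 → t u + (t a + (t b + (t x + t y))) ≤ 9 → ⊥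
    kite-rotate su sa sb sx sy total = reduce u∈ 1st λ f ag g →
      case pick (λ _ → true) (E f) (≤-trans (s≤s (≤-trans (lenE f) total)) cnt-true) of λ { (r , _ , r∉) →
      case rot-K ua ub ax ay bx by xy r n₁ n₂ n₃ of
      λ { ((o₁ , o₂ , o₃ , o₄ , o₅ , o₆ , o₇) , (t₁ , t₂ , t₃ , t₄ , t₅ , t₆ , t₇ , t₈ , t₉ , t₁₀)) →
      direct ((u , ρ 4 (ua · minus · ax) r) ∷ (a , ρ 6 (minus · ax) r) ∷ (b , ρ 7 (minus · bx) r) ∷ (x , r) ∷ (y , ρ 3 (minus · xy) r) ∷ [])
        (u∉K ∷ᵘ uqK) R⊆L f ag g
        ( outer-closed u R (a ∷ b ∷ []) f R⊆L (λ { 1st → 2nd ; 2nd → 3rd })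
            (only-u su) (ρ-avoid (# 4) (ua · minus · ax) (excs I u (Y) f) (∉-++ˡ r∉))
        , inner eua o₁ t₁ ∷ inner eub o₂ t₂
          ∷ OK-trivial (λ q e → case only-u su (inA x∈) e of λ { (here z) → ⊥-elim (a≢x (sym z)) ; (there (here z)) → ⊥-elim (b≢x (sym z)) }) t₃
          ∷ OK-trivial (λ q e → case only-u su (inA y∈) e of λ { (here z) → ⊥-elim (a≢y (sym z)) ; (there (here z)) → ⊥-elim (b≢y (sym z)) }) t₄ ∷ []
        , outer-closed a R (u ∷ x ∷ y ∷ []) f R⊆L uxy (only-a sa)
            (ρ-avoid (# 6) (minus · ax) (excs I a Y f) (∉-++ˡ (∉-++ʳ (Eu f) r∉)))
        , OK-trivial (λ q e → case only-a sa (inA b∈) e of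
             λ { (here z) → ⊥-elim (u≢b (sym z)) ; (there (here z)) → ⊥-elim (b≢x z) ; (there (there (here z))) → ⊥-elim (b≢y z) }) t₅
          ∷ inner eax o₃ t₆ ∷ inner eay o₄ t₇ ∷ []
        , outer-closed b R (u ∷ x ∷ y ∷ []) f R⊆L uxy (only-b sb)
            (ρ-avoid (# 7) (minus · bx) (excs I b Y f) (∉-++ˡ (∉-++ʳ (Ea f) (∉-++ʳ (Eu f) r∉))))
        , inner ebx o₅ t₈ ∷ inner eby o₆ t₉ ∷ []
        , outer-closed x R (a ∷ b ∷ y ∷ []) f R⊆L
            (λ { 1st → 2nd ; 2nd → 3rd
               ; 3rd → 5th })
            (only-x sx) (∉-++ˡ (∉-++ʳ (Eb f) (∉-++ʳ (Ea f) (∉-++ʳ (Eu f) r∉))))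
        , inner exy o₇ t₁₀ ∷ []
        , outer-closed y R (a ∷ b ∷ x ∷ []) f R⊆L
            (λ { 1st → 2nd ; 2nd → 3rd
               ; 3rd → 4th })
            (only-y sy) (ρ-avoid (# 3) (minus · xy) (excs I y Y f) (∉-++ʳ (excs I x Y f) (∉-++ʳ (Eb f) (∉-++ʳ (Ea f) (∉-++ʳ (Eu f) r∉)))))
        , [] , tt) }}
      where
        R Y : List (Fin n)
        R = u ∷ a ∷ b ∷ x ∷ y ∷ []
        Y = (L ∖ R) ++ P
        R⊆L : R ⊆ L
        R⊆L 1st = u∈
        R⊆L (there m)   = K⊆L m
        uxy : (u ∷ x ∷ y ∷ []) ⊆ R
        uxy 1st = 1st
        uxy 2nd = 4th
        uxy 3rd = 5th
        Eu Ea Eb Ey E : (Fin n → Color) → List Color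
        Eu f = map (ρ⁻ 4 (ua · minus · ax)) (excs I u Y f)
        Ea f = map (ρ⁻ 6 (minus · ax)) (excs I a Y f)
        Eb f = map (ρ⁻ 7 (minus · bx)) (excs I b Y f)
        Ey f = map (ρ⁻ 3 (minus · xy)) (excs I y Y f)
        E f = Eu f ++ (Ea f ++ (Eb f ++ (excs I x Y f ++ Ey f)))
        len-map : ∀ v f g → length (map g (excs I v Y f)) ≤ t v
        len-map v f g = ≤-trans (≤-reflexive (length-map g (excs I v Y f))) (excs-≤ v R f)
        _⊹_ : ∀ {X Z : List Color} {p q} → length X ≤ p → length Z ≤ q → length (X ++ Z) ≤ p + q
        _⊹_ {X} i j = ≤-trans (≤-reflexive (length-++ X)) (+-mono-≤ i j)
        lenE : ∀ f → length (E f) ≤ t u + (t a + (t b + (t x + t y)))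
        lenE f = _⊹_ {Eu f} (len-map u f _) (_⊹_ {Ea f} (len-map a f _) (_⊹_ {Eb f} (len-map b f _)
          (_⊹_ {excs I x Y f} (excs-≤ x R f) (len-map y f _))))

    cstK : 10 ≤ cst I P (a ∷ b ∷ x ∷ y ∷ [])
    cstK = grow a (b ∷ x ∷ y ∷ []) (uq₂ x≢y) (λ { 1st → 2nd ; 2nd → 3rd })
               (λ { 1st → ax , eax ; 2nd → ay , eay })
             (grow b (x ∷ y ∷ []) (uq₂ x≢y) (λ m → m) (λ { 1st → bx , ebx ; 2nd → by , eby })
               (grow x (y ∷ []) ((λ ()) ∷ᵘ []) (λ m → m) (λ { 1st → xy , exy }) z≤n))

    3≤sa : 3 ≤ s a
    3≤sa = s-lower a (uq₃ (x≢u ∘ sym) (y≢u ∘ sym) x≢y)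
      (λ { 1st → ∈-++⁺ˡ u∈ ; 2nd → ∈-++⁺ˡ x∈ ; 3rd → ∈-++⁺ˡ y∈ })
      (λ { 1st → ua , st-sym eua ; 2nd → ax , eax ; 3rd → ay , eay })

    3≤sb : 3 ≤ s b
    3≤sb = s-lower b (uq₃ (x≢u ∘ sym) (y≢u ∘ sym) x≢y)
      (λ { 1st → ∈-++⁺ˡ u∈ ; 2nd → ∈-++⁺ˡ x∈ ; 3rd → ∈-++⁺ˡ y∈ })
      (λ { 1st → ub , st-sym eub ; 2nd → bx , ebx ; 3rd → by , eby })

    3≤sx : 3 ≤ s x
    3≤sx = s-lower x (uq₃ a≢b a≢y b≢y)
      (λ { 1st → ∈-++⁺ˡ a∈ ; 2nd → ∈-++⁺ˡ b∈ ; 3rd → ∈-++⁺ˡ y∈ })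
      (λ { 1st → ax , st-sym eax ; 2nd → bx , st-sym ebx ; 3rd → xy , exy })

    3≤sy : 3 ≤ s y
    3≤sy = s-lower y (uq₃ a≢b a≢x b≢x)
      (λ { 1st → ∈-++⁺ˡ a∈ ; 2nd → ∈-++⁺ˡ b∈ ; 3rd → ∈-++⁺ˡ x∈ })
      (λ { 1st → ay , st-sym eay ; 2nd → by , st-sym eby ; 3rd → xy , st-sym exy })

    3≤sK : ∀ {v} → v ∈ a ∷ b ∷ x ∷ y ∷ [] → 3 ≤ s v
    3≤sK 1st = 3≤sa
    3≤sK 2nd = 3≤sb
    3≤sK 3rd = 3≤sx
    3≤sK 4th = 3≤sy

    -- The five edges of the kite cost 10 out of 12, and `two-slack` requires 2 to remain for every
    -- set with `a` and `b` but not `u`. So the vertices `ws` added to the kite can cost at most 3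
    -- each.
    overflow : 5 ≤ κ I u A → ∀ ws k → Unique (ws ++ a ∷ b ∷ x ∷ y ∷ []) → ws ⊆ L → u ∉ ws →
      10 + k ≤ cst I P (ws ++ a ∷ b ∷ x ∷ y ∷ []) → 3 * length ws + 12 < 12 + k → ⊥
    overflow five ws k uws ws⊆ u∉ low gap = <⇒≱ gap (≤-trans (≤-reflexive (arith₁ k)) (≤-trans (+-monoˡ-≤ 2 low)
      (≤-trans (two-slack u∈ five (ua , eua) (ub , eub) a≢b (ws ++ a ∷ b ∷ x ∷ y ∷ []) uws
          (λ m → [ ws⊆ , K⊆L ]′ (∈-++⁻ ws m)) (∈-++⁺ʳ ws 1st) (∈-++⁺ʳ ws 2nd)
          (λ m → [ u∉ , u∉K ]′ (∈-++⁻ ws m)))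
        (≤-reflexive (trans (cong (3 *_) (length-++ ws)) (arith₂ (length ws)))))))
      where
        arith₁ : ∀ k → 12 + k ≡ 10 + k + 2
        arith₁ = solve-∀
        arith₂ : ∀ l → 3 * (l + 4) ≡ 3 * l + 12
        arith₂ = solve-∀

    -- By the slack of sets containing a and b, a vertex outside has at most one neighbour in the kite.
    out₂ : 5 ≤ κ I u A → ∀ {w p q} → w ∈ L → w ∉ a ∷ b ∷ x ∷ y ∷ [] → w ≢ u → p ≢ q →
      p ∈ a ∷ b ∷ x ∷ y ∷ [] → q ∈ a ∷ b ∷ x ∷ y ∷ [] → Strong w p → Strong w q → ⊥
    out₂ five {w} {p} {q} w∈ w∉ w≢u p≢q p∈ q∈ ep eq = overflow five (w ∷ []) 4 (w∉ ∷ᵘ uqK)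
      (λ { 1st → w∈ }) (λ { (here e) → w≢u (sym e) })
      (grow w (a ∷ b ∷ x ∷ y ∷ []) (uq₂ p≢q) (λ { 1st → p∈ ; 2nd → q∈ }) (λ { 1st → ep ; 2nd → eq }) cstK)
      (≤ᵇ⇒≤ 16 16 tt)

  kite-swapᵃ : ∀ {u a b x y} → Kite u a b x y → Kite u b a x y
  kite-swapᵃ K = record
    { eua = eub ; eub = eua ; eax = ebx ; eay = eby ; ebx = eax ; eby = eay ; exy = exy ; n₁ = n₂ ; n₂ = n₁
    ; n₃ = sgn ua ub ax bx n₃ ; a∈ = b∈ ; b∈ = a∈ ; x∈ = x∈ ; y∈ = y∈ ; a≢b = a≢b ∘ sym ; x≢u = x≢u ; y≢u = y≢u }
    where
      open Kite K
      sgn : ∀ p q r w → negTri (p · q) r w ✓ → negTri (q · p) w r ✓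
      sgn = toWitness {a? = allS? λ _ → allS? λ _ → allS? λ _ → allS? λ _ → imp? chk} tt

  kite-swapˣ : ∀ {u a b x y} → Kite u a b x y → Kite u a b y x
  kite-swapˣ K = record
    { eua = eua ; eub = eub ; eax = eay ; eay = eax ; ebx = eby ; eby = ebx ; exy = st-sym exy
    ; n₁ = negTri-swap ax ay xy n₁ ; n₂ = negTri-swap bx by xy n₂ ; n₃ = sgn′ (ua · ub) ax ay bx by xy n₁ n₂ n₃
    ; a∈ = a∈ ; b∈ = b∈ ; x∈ = y∈ ; y∈ = x∈ ; a≢b = a≢b ; x≢u = y≢u ; y≢u = x≢u }
    where
      open Kite K
      sgn′ : ∀ m p q r w z → negTri p q z ✓ → negTri r w z ✓ → negTri m p r ✓ → negTri m q w ✓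
      sgn′ = toWitness {a? = allS? λ _ → allS? λ _ → allS? λ _ → allS? λ _ → allS? λ _ → allS? λ _ → imp? (imp? (imp? chk))} tt

  -- A second kite that meets the first would bring in vertices costing more than 3 each, against
  -- `overflow`. Exchanging names inside the second kite leaves two situations: `a′` and `x′` lie
  -- outside the first, or some vertex outside has two neighbours in it. Disjointness means that a
  -- vertex pays for at most one kite.
  module Disjoint {u a b x y : Fin n} (u∈ : u ∈ L) (K : Kite u a b x y) (five : 5 ≤ κ I u A) (su : s u ≤ 2) where
    module Q = KiteFacts u∈ K

    Kl : List (Fin n)
    Kl = a ∷ b ∷ x ∷ y ∷ []

    private
      module _ {u′ a′ b′ x′ y′ : Fin n} (u′∈ : u′ ∈ L) (K′ : Kite u′ a′ b′ x′ y′) where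
        private module F′ = KiteFacts u′∈ K′

        K′≢u : ∀ {v} → v ∈ a′ ∷ b′ ∷ x′ ∷ y′ ∷ [] → v ≢ u
        K′≢u m refl = <⇒≱ (F′.3≤sK m) su

        2-out : a′ ∉ Kl → x′ ∉ Kl → b′ ∈ Kl → y′ ∈ Kl → ⊥
        2-out a∉ x∉ b∈ y∈ = Q.overflow five (a′ ∷ x′ ∷ []) 8
          ((λ { (here e) → F′.a≢x e ; (there m) → a∉ m }) ∷ᵘ (x∉ ∷ᵘ Q.uqK))
          (λ { 1st → F′.a∈ ; 2nd → F′.x∈ })
          (λ { (here e) → K′≢u 1st (sym e) ; (there (here e)) → K′≢u 3rd (sym e) })
          (grow a′ (x′ ∷ Kl) (uq₂ F′.x≢y) (λ { 1st → 1st ; 2nd → there y∈ })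
              (λ { 1st → _ , F′.eax ; 2nd → _ , F′.eay })
            (grow x′ Kl (uq₂ F′.b≢y) (λ { 1st → b∈ ; 2nd → y∈ })
              (λ { 1st → _ , st-sym F′.ebx ; 2nd → _ , F′.exy }) Q.cstK))
          (≤ᵇ⇒≤ 19 20 tt)

        3-outᵇ : a′ ∉ Kl → x′ ∉ Kl → b′ ∉ Kl → y′ ∈ Kl → ⊥
        3-outᵇ a∉ x∉ b∉ y∈ = Q.overflow five (a′ ∷ b′ ∷ x′ ∷ []) 10
          ((λ { (here e) → F′.a≢b e ; (there (here e)) → F′.a≢x e ; (there (there m)) → a∉ m }) ∷ᵘ
            ((λ { (here e) → F′.b≢x e ; (there m) → b∉ m }) ∷ᵘ (x∉ ∷ᵘ Q.uqK)))
          (λ { 1st → F′.a∈ ; 2nd → F′.b∈ ; 3rd → F′.x∈ })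
          (λ { (here e) → K′≢u 1st (sym e) ; (there (here e)) → K′≢u 2nd (sym e)
             ; (there (there (here e))) → K′≢u 3rd (sym e) })
          (grow a′ (b′ ∷ x′ ∷ Kl) (uq₂ F′.x≢y) (λ { 1st → 2nd ; 2nd → there (there y∈) })
              (λ { 1st → _ , F′.eax ; 2nd → _ , F′.eay })
            (grow b′ (x′ ∷ Kl) (uq₂ F′.x≢y) (λ { 1st → 1st ; 2nd → there y∈ })
                (λ { 1st → _ , F′.ebx ; 2nd → _ , F′.eby })
              (grow x′ Kl ((λ ()) ∷ᵘ []) (λ { 1st → y∈ }) (λ { 1st → _ , F′.exy }) Q.cstK)))
          (≤ᵇ⇒≤ 22 22 tt)

        3-outʸ : a′ ∉ Kl → x′ ∉ Kl → b′ ∈ Kl → y′ ∉ Kl → ⊥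
        3-outʸ a∉ x∉ b∈ y∉ = Q.overflow five (a′ ∷ x′ ∷ y′ ∷ []) 10
          ((λ { (here e) → F′.a≢x e ; (there (here e)) → F′.a≢y e ; (there (there m)) → a∉ m }) ∷ᵘ
            ((λ { (here e) → F′.x≢y e ; (there m) → x∉ m }) ∷ᵘ (y∉ ∷ᵘ Q.uqK)))
          (λ { 1st → F′.a∈ ; 2nd → F′.x∈ ; 3rd → F′.y∈ })
          (λ { (here e) → K′≢u 1st (sym e) ; (there (here e)) → K′≢u 3rd (sym e)
             ; (there (there (here e))) → K′≢u 4th (sym e) })
          (grow a′ (x′ ∷ y′ ∷ Kl) (uq₂ F′.x≢y) (λ { 1st → 1st ; 2nd → 2nd })
              (λ { 1st → _ , F′.eax ; 2nd → _ , F′.eay })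
            (grow x′ (y′ ∷ Kl) (uq₂ (F′.b≢y ∘ sym)) (λ { 1st → 1st ; 2nd → there b∈ })
                (λ { 1st → _ , F′.exy ; 2nd → _ , st-sym F′.ebx })
              (grow y′ Kl ((λ ()) ∷ᵘ []) (λ { 1st → b∈ }) (λ { 1st → _ , st-sym F′.eby }) Q.cstK)))
          (≤ᵇ⇒≤ 22 22 tt)

        ax-out : a′ ∉ Kl → x′ ∉ Kl → ∀ {v} → v ∈ Kl → v ∈ a′ ∷ b′ ∷ x′ ∷ y′ ∷ [] → ⊥
        ax-out a∉ x∉ {v} v∈ v∈′ with b′ ∈? Kl | y′ ∈? Kl
        ... | yes p | yes q = 2-out a∉ x∉ p q
        ... | no p | yes q = 3-outᵇ a∉ x∉ p q
        ... | yes p | no q = 3-outʸ a∉ x∉ p q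
        ... | no p | no q with v∈′
        ...   | 1st = a∉ v∈
        ...   | 2nd = p v∈
        ...   | 3rd = x∉ v∈
        ...   | 4th = q v∈

    swapˣ-∈ : ∀ {v p q r w : Fin n} → v ∈ p ∷ q ∷ r ∷ w ∷ [] → v ∈ p ∷ q ∷ w ∷ r ∷ []
    swapˣ-∈ (here e) = here e
    swapˣ-∈ (there (here e)) = there (here e)
    swapˣ-∈ (there (there (here e))) = there (there (there (here e)))
    swapˣ-∈ (there (there (there (here e)))) = there (there (here e))

    swapᵃ-∈ : ∀ {v p q : Fin n} {xs} → v ∈ p ∷ q ∷ xs → v ∈ q ∷ p ∷ xs
    swapᵃ-∈ (here e) = there (here e)
    swapᵃ-∈ (there (here e)) = here e
    swapᵃ-∈ (there (there m)) = there (there m)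

    a-out : ∀ {u′ a′ b′ x′ y′} → u′ ∈ L → Kite u′ a′ b′ x′ y′ → a′ ∉ Kl → ∀ {v} → v ∈ Kl → v ∈ a′ ∷ b′ ∷ x′ ∷ y′ ∷ [] → ⊥
    a-out {x′ = x′} {y′} u′∈ K′ a∉ v∈ v∈′ with x′ ∈? Kl | y′ ∈? Kl
    ... | no p  | _     = ax-out u′∈ K′ a∉ p v∈ v∈′
    ... | yes _ | no q  = ax-out u′∈ (kite-swapˣ K′) a∉ q v∈ (swapˣ-∈ v∈′)
    ... | yes p | yes q = Q.out₂ five F′.a∈ a∉ (λ { refl → <⇒≱ F′.3≤sa su }) F′.x≢y p q (_ , F′.eax) (_ , F′.eay)
      where module F′ = KiteFacts u′∈ K′

    disjoint : ∀ {u′ a′ b′ x′ y′} → u′ ∈ L → Kite u′ a′ b′ x′ y′ → s u′ ≤ 2 → u′ ≢ u →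
      ∀ {v} → v ∈ Kl → v ∈ a′ ∷ b′ ∷ x′ ∷ y′ ∷ [] → ⊥
    disjoint {u′} {a′} {b′} u′∈ K′ su′ u′≢u v∈ v∈′ with a′ ∈? Kl | b′ ∈? Kl
    ... | no p  | _     = a-out u′∈ K′ p v∈ v∈′
    ... | yes _ | no q  = a-out u′∈ (kite-swapᵃ K′) q v∈ (swapᵃ-∈ v∈′)
    ... | yes p | yes q = Q.out₂ five u′∈ (λ m → <⇒≱ (Q.3≤sK m) su′) u′≢u F′.a≢b p q (_ , F′.eua) (_ , F′.eub)
      where module F′ = KiteFacts u′∈ K′

  -- Discharging

  -- In this scale a cubic vertex without weak constraints has degree 6. A constraint towards a
  -- precoloured vertex is seen from one end only and hence counted twice, so that the degrees over
  -- `L` sum to twice the total cost.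
  deg : Fin n → ℕ
  deg v = κ I v L + 2 * κ I v P

  deg≡ : ∀ v → deg v ≡ 2 * s v + t v + κ I v P
  deg≡ v = trans (arith (κ I v L) (κ I v P)) (cong (_+ κ I v P) (trans (sym (∑-++ L P _)) (κA v)))
    where
      arith : ∀ x y → x + 2 * y ≡ x + y + y
      arith = solve-∀

  2s+t≤deg : ∀ v → 2 * s v + t v ≤ deg v
  2s+t≤deg v = ≤-trans (m≤m+n _ _) (≤-reflexive (sym (deg≡ v)))

  handshake-on : ∀ S → ∑ S (λ v → κ I v S + 2 * κ I v P) ≡ 2 * cst I P S
  handshake-on [] = refl
  handshake-on (u ∷ S) = begin
      (cost (c I u u) + κ I u S + 2 * κ I u P) + ∑ S (λ v → cost (c I v u) + κ I v S + 2 * κ I v P)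
        ≡⟨ cong₂ (λ x y → (x + κ I u S + 2 * κ I u P) + y) (cong cost (cirr I u)) split ⟩
      (κ I u S + 2 * κ I u P) + (κ I u S + 2 * cst I P S)
        ≡⟨ arith (κ I u S) (κ I u P) (cst I P S) ⟩
      2 * (cst I P S + (κ I u S + κ I u P))
        ≡⟨ cong (λ z → 2 * (cst I P S + z)) (sym (∑-++ S P _)) ⟩
      2 * (cst I P S + κ I u (S ++ P)) ∎
    where
      open ≡-Reasoning
      arith : ∀ x y z → (x + 2 * y) + (x + 2 * z) ≡ 2 * (z + (x + y))
      arith = solve-∀
      split : ∑ S (λ v → cost (c I v u) + κ I v S + 2 * κ I v P) ≡ κ I u S + 2 * cst I P S
      split = trans (∑-cong S (λ {v} _ → trans (+-assoc (cost (c I v u)) _ _) (cong (λ r → cost r + (κ I v S + 2 * κ I v P)) (csym I v u))))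
        (trans (∑-+ S (λ v → cost (c I u v)) _) (cong (κ I u S +_) (handshake-on S)))

  ∑deg≤ : ∑ L deg ≤ 6 * length L
  ∑deg≤ = ≤-trans (≤-reflexive (handshake-on L)) (≤-trans (*-monoʳ-≤ 2 (sparse L uqL id)) (≤-reflexive (arith (length L))))
    where
      arith : ∀ l → 2 * (3 * l) ≡ 6 * l
      arith = solve-∀

  big-s : ∀ {a b m k} → m ≤ a → 2 * a + b ≤ k → k < 2 * m → ⊥
  big-s {a} {b} ma h l = <⇒≱ l (≤-trans (*-monoʳ-≤ 2 ma) (≤-trans (m≤m+n _ b) h))

  data Type (v : Fin n) : Set where
    two   : s v ≡ 2 → 1 ≤ t v → t v ≤ 2 → Type v
    three : s v ≡ 3 → t v ≡ 0 → Type v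

  type : ∀ {v} → v ∈ L → deg v ≤ 6 → Type v
  type {v} v∈ d = go (s v) (t v) refl refl (≤-trans (2s+t≤deg v) d)
    where
      go : ∀ a b → s v ≡ a → t v ≡ b → 2 * a + b ≤ 6 → Type v
      go 0 b p q h = ⊥-elim (light₀ v∈ p (≤-trans (≤-reflexive q) (≤-trans h (≤ᵇ⇒≤ 6 9 tt))))
      go 1 b p q (s≤s (s≤s h)) = ⊥-elim (light₁ v∈ p (≤-trans (≤-reflexive q) h))
      go 2 0 p q h = ⊥-elim (light₂ v∈ p q)
      go 2 (suc b) p q (s≤s (s≤s (s≤s (s≤s h)))) = two p (≤-trans (s≤s z≤n) (≤-reflexive (sym q))) (≤-trans (≤-reflexive q) h)
      go 3 0 p q h = three p q
      go 3 (suc b) p q (s≤s (s≤s (s≤s (s≤s (s≤s (s≤s ()))))))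
      go (suc (suc (suc (suc a)))) b p q h = ⊥-elim (big-s {4 + a} {b} {4} {6} (m≤m+n 4 a) h (≤ᵇ⇒≤ 7 8 tt))

  U-type : ∀ {v} → v ∈ L → deg v ≤ 5 → (s v ≡ 2) × (t v ≡ 1)
  U-type {v} v∈ d with type v∈ (≤-trans d (n≤1+n 5))
  ... | three p q = ⊥-elim (<⇒≱ {5} {6} ≤-refl (≤-trans (≤-reflexive (sym (cong₂ (λ x y → 2 * x + y) p q))) (≤-trans (2s+t≤deg v) d)))
  ... | two p 1≤ _ = p , ≤-antisym
         (+-cancelˡ-≤ 4 _ _ (≤-trans (≤-reflexive (cong (λ x → 2 * x + t v) (sym p))) (≤-trans (2s+t≤deg v) d))) 1≤

  -- The constraints at `v` cost at least 5 by `type`, and a precoloured strong neighbour would be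
  -- counted with 2 more.
  nbr-in-L : ∀ {v w} → v ∈ L → deg v ≤ 6 → Strong v w → w ∈ A → w ∈ L
  nbr-in-L {v} {w} v∈ d e w∈ with ∈-++⁻ L w∈
  ... | inj₁ q = q
  ... | inj₂ q = ⊥-elim (<⇒≱ {6} {7} ≤-refl (≤-trans (+-mono-≤ (five (type v∈ d)) (≤-trans (cost-strong e) (term≤∑ (λ z → cost (c I v z)) q)))
                   (≤-trans (≤-reflexive (sym (deg≡ v))) d)))
    where
      five : Type v → 5 ≤ 2 * s v + t v
      five (two p l _) = ≤-trans (+-monoʳ-≤ 4 l) (≤-reflexive (cong (λ x → 2 * x + t v) (sym p)))
      five (three p _) = ≤-trans (≤-trans (n≤1+n 5) (m≤m+n 6 (t v))) (≤-reflexive (cong (λ x → 2 * x + t v) (sym p)))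

  third : ∀ {v} p q → s v ≡ 3 → ∃ λ α → (α ∈ A) × Strong v α × (α ≢ p) × (α ≢ q)
  third {v} p q e with pigeonhole (nbs v) (p ∷ q ∷ []) (uniq (nb v)) (≤-reflexive (sym (trans (length-nbs v) e)))
  ... | α , m , h = α , sub (nb v) m , strong (nb v) m , (λ z → h (here z)) , (λ z → h (there (here z)))

  small-tri : ∀ {u v b} → u ∈ L → v ∈ L → b ∈ L → Neg3 I u v b → s u ≤ 2 → t u ≤ 1 → deg v ≤ 6 → ⊥
  small-tri {u} {v} {b} u∈ v∈ b∈ ng su tu d with type v∈ d
  ... | two p _ q = tri-two u∈ v∈ (inA b∈) ng su tu (≤-reflexive p) q
  ... | three p q with third u b p
  ...   | α , α∈ , (_ , e) , α≢u , α≢b = tri-three-nbr u∈ v∈ b∈ α∈ ng e α≢u α≢b su tu (≤-reflexive p) (≤-reflexive q)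

  nbs₂ : ∀ {u} → s u ≡ 2 → ∃ λ a → ∃ λ b → nbs u ≡ a ∷ b ∷ []
  nbs₂ {u} e with nbs u | trans (length-nbs u) e
  ... | a ∷ b ∷ [] | _ = a , b , refl

  triL : Fin n → List (Fin n) → Bool
  triL u (a ∷ b ∷ []) = tri I u a b
  triL u _            = false

  opaque
    inTri : Fin n → Bool
    inTri u = triL u (nbs u)

    inTri-nbs : ∀ {u a b} → nbs u ≡ a ∷ b ∷ [] → inTri u ≡ tri I u a b
    inTri-nbs {u} q = cong (triL u) q

  record Ends (u a b : Fin n) : Set where
    field
      {ua ub} : Sign
      ea  : st (c I u a) ≡ just ua
      eb  : st (c I u b) ≡ just ub
      a≢b : a ≢ b
      a∈  : a ∈ L
      b∈  : b ∈ L
      inTri≡ : inTri u ≡ tri I u a b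

  ends : ∀ {u} → u ∈ L → deg u ≤ 6 → s u ≡ 2 → ∃ λ a → ∃ λ b → Ends u a b
  ends {u} u∈ d e with nbs₂ e
  ... | a , b , q = a , b , record
    { ea = proj₂ (str 1st) ; eb = proj₂ (str 2nd)
    ; a≢b = λ { refl → Unique-head (subst Unique q (uniq (nb u))) 1st }
    ; a∈ = inL 1st ; b∈ = inL 2nd ; inTri≡ = inTri-nbs q }
    where
      str : ∀ {w} → w ∈ a ∷ b ∷ [] → Strong u w
      str {w} m = strong (nb u) (subst (w ∈_) (sym q) m)
      inL : ∀ {w} → w ∈ a ∷ b ∷ [] → w ∈ L
      inL {w} m = nbr-in-L u∈ d (str m) (sub (nb u) (subst (w ∈_) (sym q) m))

  ends-only : ∀ {u a b} → s u ≡ 2 → Ends u a b → ∀ {w} → w ∈ A → Strong u w → w ∈ a ∷ b ∷ []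
  ends-only e E w∈ (_ , q) = full₂ (_ , ea) (_ , eb) a≢b (inA a∈) (inA b∈) (≤-reflexive e) w∈ q
    where open Ends E

  tri-partner : ∀ {u v} → u ∈ L → deg u ≤ 6 → s u ≡ 2 → inTri u ≡ true → v ∈ A → Strong u v →
    ∃ λ w → (w ∈ L) × (v ∈ L) × Neg3 I u v w
  tri-partner {u} u∈ d e h v∈ sv with ends u∈ d e
  ... | a , b , E with ends-only e E v∈ sv | tri-sound I u a b (trans (sym (Ends.inTri≡ E)) h)
  ...   | 1st | ng = b , Ends.b∈ E , Ends.a∈ E , ng
  ...   | 2nd | ng = a , Ends.a∈ E , Ends.b∈ E , Neg3-swap₂ ng

  kiteOf : ∀ {u} → u ∈ L → deg u ≤ 6 → s u ≡ 2 → 1 ≤ t u → t u ≤ 2 → inTri u ≡ false →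
    ∃ λ a → ∃ λ b → ∃ λ x → ∃ λ y → Kite u a b x y
  kiteOf {u} u∈ d e t1 t2 h with ends u∈ d e
  ... | a , b , E = let x , y , K = Gadget.kite u∈ (Ends.a∈ E) (Ends.b∈ E) (Ends.ea E) (Ends.eb E) (Ends.a≢b E) e t1 t2
                                      (trans (sym (Ends.inTri≡ E)) h) in a , b , x , y , K

  opaque
    isU : Fin n → Bool
    isU v = deg v ≤ᵇ 5

    isU-≤ : ∀ {v} → isU v ≡ true → deg v ≤ 5
    isU-≤ h = ≤ᵇ-elim h

    not-isU : ∀ {v} → isU v ≡ false → 6 ≤ deg v
    not-isU {v} h with deg v ≤? 5
    ... | yes q = ⊥-elim (subst T h (≤⇒≤ᵇ q))
    ... | no q  = ≰⇒> q

  Picked : Fin n → Fin n → Set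
  Picked u v = ∃ λ a → ∃ λ b → ∃ λ x → ∃ λ y → Kite u a b x y × (v ∈ a ∷ b ∷ x ∷ y ∷ []) × (8 ≤ deg v)

  U-five : ∀ {u} → s u ≡ 2 → t u ≡ 1 → 5 ≤ κ I u A
  U-five {u} p q = ≤-reflexive (sym (trans (κA u) (cong₂ (λ x y → 2 * x + y) p q)))

  -- If all four vertices had degree at most 7, each would have three strong neighbours and at most
  -- one weak constraint. With the one at `u` there would be at most five exclusions, and
  -- `kite-rotate` would apply.
  payer : ∀ {u} → u ∈ L → isU u ≡ true → inTri u ≡ false → ∃ (Picked u)
  payer {u} u∈ hu ht with U-type u∈ (isU-≤ hu)
  ... | su , tu with kiteOf u∈ (≤-trans (isU-≤ hu) (n≤1+n 5)) su (≤-reflexive (sym tu)) (≤-trans (≤-reflexive tu) (n≤1+n 1)) ht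
  ...   | a , b , x , y , K with 8 ≤? deg a | 8 ≤? deg b | 8 ≤? deg x | 8 ≤? deg y
  ...     | yes q | _ | _ | _ = a , a , b , x , y , K , 1st , q
  ...     | _ | yes q | _ | _ = b , a , b , x , y , K , 2nd , q
  ...     | _ | _ | yes q | _ = x , a , b , x , y , K , 3rd , q
  ...     | _ | _ | _ | yes q = y , a , b , x , y , K , 4th , q
  ...     | no p | no q | no r | no w = ⊥-elim (kite-rotate (≤-reflexive su) (s3 p) (s3 q) (s3 r) (s3 w)
             (≤-trans (+-mono-≤ (≤-reflexive tu) (+-mono-≤ (t1 3≤sa p) (+-mono-≤ (t1 3≤sb q) (+-mono-≤ (t1 3≤sx r) (t1 3≤sy w))))) (≤ᵇ⇒≤ 5 9 tt)))
    where
      open KiteFacts u∈ K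
      7≥ : ∀ {v} → ¬ (8 ≤ deg v) → 2 * s v + t v ≤ 7
      7≥ {v} p = ≤-trans (2s+t≤deg v) (+-cancelˡ-≤ 1 _ _ (≰⇒> p))
      s3 : ∀ {v} → ¬ (8 ≤ deg v) → s v ≤ 3
      s3 {v} p with s v ≤? 3
      ... | yes q = q
      ... | no q  = ⊥-elim (big-s {b = t v} (≰⇒> q) (7≥ p) ≤-refl)
      t1 : ∀ {v} → 3 ≤ s v → ¬ (8 ≤ deg v) → t v ≤ 1
      t1 {v} l p = +-cancelˡ-≤ 6 _ _ (≤-trans (+-monoˡ-≤ (t v) (*-monoʳ-≤ 2 l)) (7≥ p))

  opaque
    -- Made total so that `gets₂` can compare vertices with it; where nothing is owed, the value `u`
    -- is a placeholder.
    payer-of : ∀ u → ∃ λ v → u ∈ L → isU u ≡ true → inTri u ≡ false → Picked u v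
    payer-of u with u ∈? L | Bool-cases (isU u) | Bool-cases (inTri u)
    ... | yes p | inj₁ q | inj₂ r = let v , h = payer p q r in v , λ _ _ _ → h
    ... | no p  | _      | _      = u , λ q _ _ → ⊥-elim (p q)
    ... | _     | inj₂ p | _      = u , λ _ q _ → ⊥-elim (true≢false q p)
    ... | _     | _      | inj₁ p = u , λ _ _ q → ⊥-elim (true≢false p q)

  pk : Fin n → Fin n
  pk u = proj₁ (payer-of u)

  -- A vertex u with deg u ≤ 5 receives 1 from each strong neighbour if these form a negative triangle with u,
  -- and 2 from a vertex of large degree in its kite otherwise.
  gets₁ gets₂ : Fin n → Fin n → Bool
  gets₁ v u = isU u ∧ (inTri u ∧ isStrong I u v)
  gets₂ v u = isU u ∧ (not (inTri u) ∧ does (v ≟ pk u))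

  gets : Fin n → Fin n → ℕ
  gets u v = 𝟙 (gets₁ v u) + 2 * 𝟙 (gets₂ v u)

  gets₁-elim : ∀ {u v} → gets₁ v u ≡ true → (isU u ≡ true) × (inTri u ≡ true) × Strong u v
  gets₁-elim {u} {v} h = let p , h₁ = ∧-elim {isU u} h ; q , r = ∧-elim {inTri u} h₁ in p , q , isStrong-elim I u v r

  gets₂-elim : ∀ {u v} → u ∈ L → gets₂ v u ≡ true → (isU u ≡ true) × (inTri u ≡ false) × Picked u v
  gets₂-elim {u} {v} u∈ h = let p , h₁ = ∧-elim {isU u} h ; q , r = ∧-elim {not (inTri u)} h₁ in
      p , un q , subst (Picked u) (sym (eq r)) (proj₂ (payer-of u) u∈ p (un q))
    where
      un : ∀ {b} → not b ≡ true → b ≡ false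
      un {false} _ = refl
      eq : does (v ≟ pk u) ≡ true → v ≡ pk u
      eq z with v ≟ pk u
      ... | yes e = e

  K⊆L′ : ∀ {u v} → u ∈ L → Picked u v → v ∈ L
  K⊆L′ u∈ (a , b , x , y , K , m , _) = KiteFacts.K⊆L u∈ K m

  ≟-refl : ∀ (v : Fin n) → does (v ≟ v) ≡ true
  ≟-refl v with v ≟ v
  ... | yes _ = refl
  ... | no z  = ⊥-elim (z refl)

  -- Degrees are doubled in the balance: `u` lacks 1 up to 6, and the resulting 2 splits evenly
  -- between the two neighbours in a triangle.
  row : ∀ {u} → u ∈ L → 2 * 𝟙 (isU u) ≤ ∑ L (gets u)
  row {u} u∈ with Bool-cases (isU u)
  ... | inj₂ p = ≤-trans (≤-reflexive (cong (λ z → 2 * 𝟙 z) p)) z≤n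
  ... | inj₁ p = ≤-trans (≤-reflexive (cong (λ z → 2 * 𝟙 z) p)) (go (Bool-cases (inTri u)))
    where
      go : (inTri u ≡ true) ⊎ (inTri u ≡ false) → 2 ≤ ∑ L (gets u)
      go (inj₂ q) = ≤-trans (≤-reflexive (sym val)) (≤-trans (m≤n+m (2 * 𝟙 (gets₂ (pk u) u)) (𝟙 (gets₁ (pk u) u))) (term≤∑ {x = pk u} (gets u) (K⊆L′ u∈ (proj₂ (payer-of u) u∈ p q))))
        where
          val : 2 * 𝟙 (gets₂ (pk u) u) ≡ 2
          val = cong (λ z → 2 * 𝟙 z) (∧-intro p (∧-intro (cong not q) (≟-refl (pk u))))
      go (inj₁ q) = split (ends u∈ (≤-trans (isU-≤ p) (n≤1+n 5)) (proj₁ (U-type u∈ (isU-≤ p))))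
        where
          one : ∀ {w z} → st (c I u w) ≡ just z → 1 ≤ gets u w
          one {w} e = ≤-trans (≤-reflexive (sym (cong 𝟙 (∧-intro p (∧-intro q (isStrong-intro I u w e))))))
            (m≤m+n (𝟙 (gets₁ w u)) (2 * 𝟙 (gets₂ w u)))
          split : (∃ λ a → ∃ λ b → Ends u a b) → 2 ≤ ∑ L (gets u)
          split (a , b , E) = ≤-trans (+-mono-≤ (one (Ends.ea E)) (≤-trans (one (Ends.eb E)) (m≤m+n (gets u b) 0)))
              (∑-⊆ (gets u) {a ∷ b ∷ []} (uq₂ (Ends.a≢b E)) (λ { 1st → Ends.a∈ E ; 2nd → Ends.b∈ E }))

  U-props : ∀ {u} → u ∈ L → isU u ≡ true → (s u ≡ 2) × (t u ≡ 1) × (deg u ≤ 6)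
  U-props u∈ h = let p , q = U-type u∈ (isU-≤ h) in p , q , ≤-trans (isU-≤ h) (n≤1+n 5)

  tri-big : ∀ {u v} → u ∈ L → v ∈ L → gets₁ v u ≡ true → 7 ≤ deg v
  tri-big {u} {v} u∈ v∈ h with 7 ≤? deg v
  ... | yes q = q
  ... | no q  = let hu , ht , sv = gets₁-elim {u} {v} h
                    su , tu , du = U-props u∈ hu
                    w , w∈ , _ , ng = tri-partner u∈ du su ht (inA v∈) sv
                in ⊥-elim (small-tri u∈ v∈ w∈ ng (≤-reflexive su) (≤-reflexive tu) (+-cancelˡ-≤ 1 _ _ (≰⇒> q)))

  pays : ∀ v → ∑ L (λ u → gets u v) ≡ length (filterᵇ (gets₁ v) L) + 2 * length (filterᵇ (gets₂ v) L)
  pays v = trans (∑-+ L (𝟙 ∘ gets₁ v) (λ u → 2 * 𝟙 (gets₂ v u)))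
    (cong₂ _+_ (sym (length-filterᵇ (gets₁ v) L)) (trans (∑-2* L (𝟙 ∘ gets₂ v)) (cong (2 *_) (sym (length-filterᵇ (gets₂ v) L)))))

  module Column {v : Fin n} (v∈ : v ∈ L) where
    k₁ k₂ : List (Fin n)
    k₁ = filterᵇ (gets₁ v) L
    k₂ = filterᵇ (gets₂ v) L

    in₁ : ∀ {u} → u ∈ k₁ → (u ∈ L) × (gets₁ v u ≡ true)
    in₁ = ∈filterᵇ (gets₁ v) L

    in₂ : ∀ {u} → u ∈ k₂ → (u ∈ L) × (gets₂ v u ≡ true)
    in₂ = ∈filterᵇ (gets₂ v) L

    few₂ : length k₂ ≤ 1
    few₂ = at-most-one (Unique-filterᵇ (gets₂ v) uqL) same
      where
        same : ∀ {u u′} → u ∈ k₂ → u′ ∈ k₂ → u ≡ u′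
        same {u} {u′} m m′ with u ≟ u′
        ... | yes e = e
        ... | no ne with in₂ m | in₂ m′
        ...   | u∈ , h | u′∈ , h′ with gets₂-elim {v = v} u∈ h | gets₂-elim {v = v} u′∈ h′
        ...     | hu , _ , (a , b , x , y , K , v∈K , _) | hu′ , _ , (_ , _ , _ , _ , K′ , v∈K′ , _) with U-props u∈ hu | U-props u′∈ hu′
        ...       | su , tu , _ | su′ , _ = ⊥-elim (Disjoint.disjoint u∈ K (U-five su tu) (≤-reflexive su) u′∈ K′ (≤-reflexive su′) (ne ∘ sym) v∈K v∈K′)

    sub₁ : k₁ ⊆ nbs v
    sub₁ m = let u∈ , h = in₁ m ; _ , _ , q , e = gets₁-elim h in complete (nb v) (inA u∈) (st-sym e)

    room : ∀ ys → Unique ys → (∀ {w} → w ∈ ys → (w ∈ A) × Strong v w × (gets₁ v w ≢ true)) → length k₁ + length ys ≤ s v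
    room ys u h = ≤-trans (≤-reflexive (sym (length-++ k₁)))
      (≤-trans (length-⊆ (Unique-++ (Unique-filterᵇ (gets₁ v) uqL) u (λ m m′ → proj₂ (proj₂ (h m′)) (proj₂ (in₁ m))))
        (λ m → [ sub₁ , (λ m′ → let a , (q , e) , _ = h m′ in complete (nb v) a e) ]′ (∈-++⁻ k₁ m))) (≤-reflexive (length-nbs v)))

    not-U : ∀ {w} → w ∈ L → s w ≢ 2 → gets₁ v w ≢ true
    not-U w∈ ne h = ne (proj₁ (U-props w∈ (proj₁ (gets₁-elim h))))

    partner-big : ∀ {u w} → u ∈ L → w ∈ L → isU u ≡ true → inTri u ≡ true → Strong u w → 7 ≤ deg w
    partner-big {u} {w} u∈ w∈ hu ht e = tri-big u∈ w∈ (∧-intro hu (∧-intro ht (isStrong-intro I u w (proj₂ e))))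

    -- The third vertex of a paid triangle pays too, hence has degree at least 7, and is a strong
    -- neighbour of `v` that receives nothing.
    one₁ : 1 ≤ length k₁ → length k₁ + 1 ≤ s v
    one₁ l with one-of l
    ... | u , m with in₁ m
    ...   | u∈ , h with gets₁-elim h
    ...     | hu , ht , sv with U-props u∈ hu
    ...       | su , tu , du with tri-partner u∈ du su ht (inA v∈) sv
    ...         | w , w∈ , _ , neg3 e₁ e₂ e₃ _ = room (w ∷ []) ((λ ()) ∷ᵘ [])
          (λ { 1st → ∈-++⁺ˡ w∈ , (_ , e₃) , λ h′ → <⇒≱ {5} {7} (≤ᵇ⇒≤ 6 7 tt)
                 (≤-trans (partner-big u∈ w∈ hu ht (_ , e₂)) (isU-≤ (proj₁ (gets₁-elim h′)))) })

    -- Three strong neighbours of `v` lie in the kite or are its vertex `u`. None is paid through a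
    -- triangle: `u` is not in one, and the others have at least three strong neighbours.
    one₂ : 1 ≤ length k₂ → (length k₁ + 3 ≤ s v) × (8 ≤ deg v)
    one₂ l with one-of l
    ... | u , m with in₂ m
    ...   | u∈ , h with gets₂-elim u∈ h
    ...     | hu , ht , (a , b , x , y , K , v∈K , d) = go v∈K , d
      where
        open KiteFacts u∈ K
        u-not : gets₁ v u ≢ true
        u-not h = true≢false (proj₁ (proj₂ (gets₁-elim h))) ht
        K-not : ∀ {w} → w ∈ a ∷ b ∷ x ∷ y ∷ [] → gets₁ v w ≢ true
        K-not m = not-U (K⊆L m) (λ e → <⇒≱ (3≤sK m) (≤-reflexive e))
        go : v ∈ a ∷ b ∷ x ∷ y ∷ [] → length k₁ + 3 ≤ s v
        go 1st = room (u ∷ x ∷ y ∷ []) (uq₃ (x≢u ∘ sym) (y≢u ∘ sym) x≢y)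
          (λ { 1st → ∈-++⁺ˡ u∈ , (_ , st-sym eua) , u-not
             ; 2nd → ∈-++⁺ˡ x∈ , (_ , eax) , K-not 3rd
             ; 3rd → ∈-++⁺ˡ y∈ , (_ , eay) , K-not 4th })
        go 2nd = room (u ∷ x ∷ y ∷ []) (uq₃ (x≢u ∘ sym) (y≢u ∘ sym) x≢y)
          (λ { 1st → ∈-++⁺ˡ u∈ , (_ , st-sym eub) , u-not
             ; 2nd → ∈-++⁺ˡ x∈ , (_ , ebx) , K-not 3rd
             ; 3rd → ∈-++⁺ˡ y∈ , (_ , eby) , K-not 4th })
        go 3rd = room (a ∷ b ∷ y ∷ []) (uq₃ a≢b a≢y b≢y)
          (λ { 1st → ∈-++⁺ˡ a∈ , (_ , st-sym eax) , K-not 1st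
             ; 2nd → ∈-++⁺ˡ b∈ , (_ , st-sym ebx) , K-not 2nd
             ; 3rd → ∈-++⁺ˡ y∈ , (_ , exy) , K-not 4th })
        go 4th = room (a ∷ b ∷ x ∷ []) (uq₃ a≢b a≢x b≢x)
          (λ { 1st → ∈-++⁺ˡ a∈ , (_ , st-sym eay) , K-not 1st
             ; 2nd → ∈-++⁺ˡ b∈ , (_ , st-sym eby) , K-not 2nd
             ; 3rd → ∈-++⁺ˡ x∈ , (_ , st-sym exy) , K-not 3rd })

    -- With only three strong neighbours at `v`, both paid triangles have the same third vertex, the
    -- situation of `two-tri`.
    two₁ : 2 ≤ length k₁ → s v ≤ 3 → deg v ≤ 7 → ⊥
    two₁ l sv dv with two-of (Unique-filterᵇ (gets₁ v) uqL) l
    ... | u₁ , u₂ , m₁ , m₂ , ne with in₁ m₁ | in₁ m₂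
    ...   | u₁∈ , h₁ | u₂∈ , h₂ with gets₁-elim h₁ | gets₁-elim h₂
    ...     | hu₁ , ht₁ , e₁ | hu₂ , ht₂ , e₂ with U-props u₁∈ hu₁ | U-props u₂∈ hu₂
    ...       | su₁ , tu₁ , du₁ | su₂ , tu₂ , du₂
      with tri-partner u₁∈ du₁ su₁ ht₁ (inA v∈) e₁ | tri-partner u₂∈ du₂ su₂ ht₂ (inA v∈) e₂
    ... | w₁ , w₁∈ , _ , ng₁ | w₂ , w₂∈ , _ , ng₂ = end same
      where
        big : ∀ {u w} → 7 ≤ deg w → u ∈ L → isU u ≡ true → w ≢ u
        big d u∈ hu refl = <⇒≱ (≤-trans (≤ᵇ⇒≤ 6 7 tt) d) (isU-≤ hu)
        d₁ : 7 ≤ deg w₁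
        d₁ = partner-big u₁∈ w₁∈ hu₁ ht₁ (_ , Neg3.e₂ ng₁)
        d₂ : 7 ≤ deg w₂
        d₂ = partner-big u₂∈ w₂∈ hu₂ ht₂ (_ , Neg3.e₂ ng₂)
        same : w₂ ∈ u₁ ∷ u₂ ∷ w₁ ∷ []
        same = full₃ (Strong-sym e₁) (Strong-sym e₂) (_ , Neg3.e₃ ng₁) ne (big d₁ u₁∈ hu₁ ∘ sym) (big d₁ u₂∈ hu₂ ∘ sym)
          (inA u₁∈) (inA u₂∈) (inA w₁∈) sv (inA w₂∈) (Neg3.e₃ ng₂)
        s3 : s v ≤ 2 → ⊥
        s3 l′ = <⇒≱ (≤-trans (+-monoˡ-≤ 1 l) (one₁ (≤-trans (s≤s z≤n) l))) l′
        tv : t v ≤ 1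
        tv = +-cancelˡ-≤ 6 _ _ (≤-trans (+-monoˡ-≤ (t v) (*-monoʳ-≤ 2 (≰⇒> s3))) (≤-trans (2s+t≤deg v) dv))
        end : w₂ ∈ u₁ ∷ u₂ ∷ w₁ ∷ [] → ⊥
        end (here e) = big d₂ u₁∈ hu₁ e
        end (there (here e)) = big d₂ u₂∈ hu₂ e
        end 3rd = two-tri v∈ (inA w₁∈) u₁∈ u₂∈ ne ng₁ ng₂ sv tv
          (≤-reflexive su₁) (≤-reflexive tu₁) (≤-reflexive su₂) (≤-reflexive tu₂)

    strict : 7 ≤ deg v → 13 + ∑ L (λ u → gets u v) ≤ 2 * deg v
    strict d = ≤-trans (≤-reflexive (cong (13 +_) (pays v)))
      (account (length k₁) (length k₂) (s v) (deg v) d (≤-trans (m≤m+n _ (t v)) (2s+t≤deg v)) few₂ one₂ one₁ two₁)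

    small : ¬ (7 ≤ deg v) → 12 + ∑ L (λ u → gets u v) ≤ 2 * deg v + 2 * 𝟙 (isU v)
    small d = ≤-trans (≤-reflexive (trans (cong (12 +_) (∑-0 L none-paid)) (+-identityʳ 12))) (go (Bool-cases (isU v)))
      where
        zero₁ : ∀ {u} → u ∈ L → gets₁ v u ≡ false
        zero₁ {u} u∈ with Bool-cases (gets₁ v u)
        ... | inj₂ h = h
        ... | inj₁ h = ⊥-elim (d (tri-big u∈ v∈ h))
        zero₂ : ∀ {u} → u ∈ L → gets₂ v u ≡ false
        zero₂ {u} u∈ with Bool-cases (gets₂ v u)
        ... | inj₂ h = h
        ... | inj₁ h = let _ , _ , _ , _ , _ , _ , _ , _ , q = gets₂-elim u∈ h in ⊥-elim (d (≤-trans (n≤1+n 7) q))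
        none-paid : ∀ {u} → u ∈ L → gets u v ≡ 0
        none-paid u∈ = cong₂ (λ x y → 𝟙 x + 2 * 𝟙 y) (zero₁ u∈) (zero₂ u∈)
        go : (isU v ≡ true) ⊎ (isU v ≡ false) → 12 ≤ 2 * deg v + 2 * 𝟙 (isU v)
        go (inj₁ h) = let su , tu , _ = U-props v∈ h in
          +-mono-≤ (*-monoʳ-≤ 2 (≤-trans (≤-reflexive (sym (cong₂ (λ x y → 2 * x + y) su tu))) (2s+t≤deg v)))
                   (≤-reflexive (cong (λ z → 2 * 𝟙 z) (sym h)))
        go (inj₂ h) = ≤-trans (*-monoʳ-≤ 2 (not-isU h)) (m≤m+n _ _)

  column : ∀ {v} → v ∈ L → 12 + ∑ L (λ u → gets u v) ≤ 2 * deg v + 2 * 𝟙 (isU v)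
  column {v} v∈ with 7 ≤? deg v
  ... | yes d = ≤-trans (n≤1+n _) (≤-trans (Column.strict v∈ d) (m≤m+n _ _))
  ... | no d  = Column.small v∈ d

  balance : ∑ L (λ v → 2 * deg v + 2 * 𝟙 (isU v)) ≤ ∑ L (λ v → 12 + ∑ L (λ u → gets u v))
  balance = ≤-trans (≤-reflexive (∑-+ L (λ v → 2 * deg v) _))
    (≤-trans (+-mono-≤ (≤-trans (≤-reflexive (∑-2* L deg)) (≤-trans (*-monoʳ-≤ 2 ∑deg≤) (≤-reflexive (trans (arith (length L)) (sym (∑-const L 12))))))
                       (∑-mono L row))
      (≤-reflexive (trans (cong (∑ L (λ _ → 12) +_) (∑-swap L L gets)) (sym (∑-+ L (λ _ → 12) _)))))
    where
      arith : ∀ l → 2 * (6 * l) ≡ 12 * l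
      arith = solve-∀

  -- Summed up, `balance` forces equality in every `column`, whereas a vertex of degree at least 7
  -- satisfies its inequality strictly.
  deg≤6 : ∀ {v} → v ∈ L → deg v ≤ 6
  deg≤6 {v} v∈ with 7 ≤? deg v
  ... | no d  = +-cancelˡ-≤ 1 _ _ (≰⇒> d)
  ... | yes d = ⊥-elim (<⇒≱ (Column.strict v∈ d) (≤-trans (m≤m+n _ _) (∑-tight L column balance v∈)))

  -- The cubic case

  -- Every vertex now has one of the two types, so a cubic one carries no weak constraint and
  -- another at most two. With so few exclusions the colourings of triangles and kites always leave
  -- a choice.
  no-two : ∀ {u} → u ∈ L → s u ≡ 2 → 1 ≤ t u → t u ≤ 2 → ⊥
  no-two {u} u∈ su t1 t2 = go (Bool-cases (inTri u))
    where
      su≤ : s u ≤ 2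
      su≤ = ≤-reflexive su
      rotate : ∀ {a b} → a ∈ L → b ∈ L → Neg3 I u a b → s a ≡ 2 → t a ≤ 2 → Type b → ⊥
      rotate {a} {b} a∈ b∈ ng@(neg3 e₁ e₂ e₃ _) sa ta (two sb _ tb) = tri-rotate u∈ a∈ b∈ ng su≤ (≤-reflexive sa) (λ _ _ → true)
        (λ _ → ≤-trans (s≤s (+-mono-≤ t2 (+-mono-≤ ta tb))) (≤-trans (≤ᵇ⇒≤ 7 10 tt) cnt-true))
        (λ f _ m e → case full₂ (_ , st-sym e₂) (_ , st-sym e₃) (no-loop e₁) (inA u∈) (inA a∈) (≤-reflexive sb) (∖P⊆A (u ∷ a ∷ b ∷ []) m) e of
          λ { 1st → ⊥-elim (∖P∌R (u ∷ a ∷ b ∷ []) u∈ 1st m)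
            ; 2nd → ⊥-elim (∖P∌R (u ∷ a ∷ b ∷ []) a∈ 2nd m) })
      rotate {a} {b} a∈ b∈ ng@(neg3 e₁ e₂ e₃ _) sa ta (three sb tb) with third u a sb
      ... | β , β∈ , (q , e₄) , β≢u , β≢a = tri-rotate u∈ a∈ b∈ ng su≤ (≤-reflexive sa) (λ f r → okS q r (f β))
        (λ f → ≤-trans (s≤s (+-mono-≤ t2 (+-mono-≤ ta (≤-reflexive tb)))) (okS-5 q (f β)))
        (λ f {r} o m e → case full₃ (_ , st-sym e₂) (_ , st-sym e₃) (q , e₄) (no-loop e₁) (β≢u ∘ sym) (β≢a ∘ sym)
                             (inA u∈) (inA a∈) β∈ (≤-reflexive sb) (∖P⊆A (u ∷ a ∷ b ∷ []) m) e of
          λ { 1st → ⊥-elim (∖P∌R (u ∷ a ∷ b ∷ []) u∈ 1st m)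
            ; 2nd → ⊥-elim (∖P∌R (u ∷ a ∷ b ∷ []) a∈ 2nd m)
            ; 3rd → at e₄ o _ e })
      both : ∀ {a b} → a ∈ L → b ∈ L → Neg3 I u a b → Type a → Type b → ⊥
      both a∈ b∈ ng (two sa _ ta) tb = rotate a∈ b∈ ng sa ta tb
      both a∈ b∈ ng ty@(three _ _) (two sb _ tb) = rotate b∈ a∈ (Neg3-swap₂ ng) sb tb ty
      both {a} {b} a∈ b∈ ng (three sa ta) (three sb tb) with third u b sa | third u a sb
      ... | α , α∈ , (_ , e₁) , α≢u , α≢b | β , β∈ , (_ , e₂) , β≢u , β≢a =
        tri-two-three u∈ a∈ b∈ α∈ β∈ ng e₁ α≢u α≢b e₂ β≢u β≢a su≤ t2 (≤-reflexive sa) (≤-reflexive ta) (≤-reflexive sb) (≤-reflexive tb)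
      triangle : ∀ {a b} → Ends u a b → inTri u ≡ true → ⊥
      triangle {a} {b} E h = both a∈ b∈ (tri-sound I u a b (trans (sym inTri≡) h)) (type a∈ (deg≤6 a∈)) (type b∈ (deg≤6 b∈))
        where open Ends E
      kite-case : ∀ {a b x y} → Kite u a b x y → ⊥
      kite-case K = kite-rotate su≤ (proj₁ A₁) (proj₁ A₂) (proj₁ A₃) (proj₁ A₄)
          (≤-trans (+-mono-≤ t2 (+-mono-≤ (proj₂ A₁) (+-mono-≤ (proj₂ A₂) (+-mono-≤ (proj₂ A₃) (proj₂ A₄))))) (≤ᵇ⇒≤ 2 9 tt))
        where
          s3 : ∀ {v} → v ∈ L → 3 ≤ s v → (s v ≤ 3) × (t v ≤ 0)
          s3 v∈ l with type v∈ (deg≤6 v∈)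
          ... | two p _ _ = ⊥-elim (<⇒≱ l (≤-reflexive p))
          ... | three p q = ≤-reflexive p , ≤-reflexive q
          open KiteFacts u∈ K
          A₁ = s3 a∈ 3≤sa
          A₂ = s3 b∈ 3≤sb
          A₃ = s3 x∈ 3≤sx
          A₄ = s3 y∈ 3≤sy
      go : (inTri u ≡ true) ⊎ (inTri u ≡ false) → ⊥
      go (inj₁ h) = triangle (proj₂ (proj₂ (ends u∈ (deg≤6 u∈) su))) h
      go (inj₂ h) = kite-case (proj₂ (proj₂ (proj₂ (proj₂ (kiteOf u∈ (deg≤6 u∈) su t1 t2 h)))))

  cubic : ∀ {v} → v ∈ L → (s v ≡ 3) × (t v ≡ 0)
  cubic v∈ with type v∈ (deg≤6 v∈)
  ... | two p q r   = ⊥-elim (no-two v∈ p q r)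
  ... | three p q = p , q

  s≤3 : ∀ {v} → v ∈ L → s v ≤ 3
  s≤3 v∈ = ≤-reflexive (proj₁ (cubic v∈))

  t≤0 : ∀ {v} → v ∈ L → t v ≤ 0
  t≤0 v∈ = ≤-reflexive (proj₂ (cubic v∈))

  no-weak : ∀ {v w} → v ∈ L → w ∈ A → ∀ ω → wk (c I v w) ω ≡ true → ⊥
  no-weak {v} {w} v∈ w∈ ω h = <⇒≱ (s≤s z≤n) (≤-trans (pos ω h) (≤-trans (term≤∑ (λ z → wc (c I v z)) w∈) (t≤0 v∈)))
    where
      pos : ∀ ω → wk (c I v w) ω ≡ true → 1 ≤ wc (c I v w)
      pos plus  h rewrite h = s≤s z≤n
      pos minus h rewrite h = m≤n+m 1 _

  exact : ∀ {v w q i j} → v ∈ L → w ∈ A → st (c I v w) ≡ just q → okS q i j ≡ true → OK (c I v w) i j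
  exact v∈ w∈ e o = mkOK (at e o) (λ ω h → ⊥-elim (no-weak v∈ w∈ ω h))

  -- Negative triangles in a cubic instance

  record Third (v p q α : Fin n) : Set where
    constructor mkThird
    field
      {sgn} : Sign
      α∈  : α ∈ L
      e   : st (c I v α) ≡ just sgn
      α≢p : α ≢ p
      α≢q : α ≢ q

  thirdL : ∀ {v} p q → v ∈ L → ∃ (Third v p q)
  thirdL p q v∈ = let α , α∈ , (_ , e) , r , w = third p q (proj₁ (cubic v∈)) in
    α , mkThird (nbr-in-L v∈ (deg≤6 v∈) (_ , e) α∈) e r w

  swapThird : ∀ {v p q α} → Third v p q α → Third v q p α
  swapThird (mkThird a e p q) = mkThird a e q p

  module Triangle {a b d : Fin n} (a∈ : a ∈ L) (b∈ : b ∈ L) (d∈ : d ∈ L) (ng : Neg3 I a b d) where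
    open Neg3 ng renaming (s₁ to ab; s₂ to ad; s₃ to bd; e₁ to eab; e₂ to ead; e₃ to ebd)

    R : List (Fin n)
    R = a ∷ b ∷ d ∷ []

    R⊆L : R ⊆ L
    R⊆L 1st = a∈
    R⊆L 2nd = b∈
    R⊆L 3rd = d∈

    third∉R : ∀ {v p q α} → v ∈ L → Third v p q α → (∀ {w} → w ∈ R → w ∈ v ∷ p ∷ q ∷ []) → α ∉ R
    third∉R v∈ T i m with i m
    ... | 1st = no-loop (Third.e T) refl
    ... | 2nd = Third.α≢p T refl
    ... | 3rd = Third.α≢q T refl

    module Outer {α β γ : Fin n} (Tα : Third a b d α) (Tβ : Third b a d β) (Tγ : Third d a b γ) where
      open Third Tα public using () renaming (sgn to aα; α∈ to α∈; e to eα)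
      open Third Tβ public using () renaming (sgn to bβ; α∈ to β∈; e to eβ)
      open Third Tγ public using () renaming (sgn to dγ; α∈ to γ∈; e to eγ)

      α∉R : α ∉ R
      α∉R = third∉R a∈ Tα id
      β∉R : β ∉ R
      β∉R = third∉R b∈ Tβ λ { (here e) → there (here e) ; (there (here e)) → here e ; (there (there m)) → there (there m) }
      γ∉R : γ ∉ R
      γ∉R = third∉R d∈ Tγ λ { (here e) → there (here e) ; (there (here e)) → there (there (here e)) ; (there (there (here e))) → here e }

      finish : ∀ f → Agree (L ∖ R) f → Good I P (L ∖ R) f → ∀ {k l m} → okS aα k (f α) ✓ → okS bβ l (f β) ✓ → okS dγ m (f γ) ✓ →
        okS ab k l ✓ → okS ad k m ✓ → okS bd l m ✓ → ⊥
      finish f ag g {k} {l} {m} o₁ o₂ o₃ o₄ o₅ o₆ = direct ((a , k) ∷ (b , l) ∷ (d , m) ∷ [])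
        (uq₃ (no-loop eab) (no-loop ead) (no-loop ebd)) R⊆L f ag g
        ( outer a R f (λ z e → case full₃ (_ , eab) (_ , ead) (_ , eα) (no-loop ebd) (Third.α≢p Tα ∘ sym) (Third.α≢q Tα ∘ sym)
                                   (inA b∈) (inA d∈) (inA α∈) (s≤3 a∈) (∖P⊆A R z) e of
            λ { 1st → ⊥-elim (∖P∌R R b∈ 2nd z)
              ; 2nd → ⊥-elim (∖P∌R R d∈ 3rd z)
              ; 3rd → at eα o₁ _ e }) (no-excs a R f (t≤0 a∈))
        , exact a∈ (inA b∈) eab o₄ ∷ exact a∈ (inA d∈) ead o₅ ∷ []
        , outer b R f (λ z e → case full₃ (_ , st-sym eab) (_ , ebd) (_ , eβ) (no-loop ead) (Third.α≢p Tβ ∘ sym) (Third.α≢q Tβ ∘ sym)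
                                   (inA a∈) (inA d∈) (inA β∈) (s≤3 b∈) (∖P⊆A R z) e of
            λ { 1st → ⊥-elim (∖P∌R R a∈ 1st z)
              ; 2nd → ⊥-elim (∖P∌R R d∈ 3rd z)
              ; 3rd → at eβ o₂ _ e }) (no-excs b R f (t≤0 b∈))
        , exact b∈ (inA d∈) ebd o₆ ∷ []
        , outer d R f (λ z e → case full₃ (_ , st-sym ead) (_ , st-sym ebd) (_ , eγ) (no-loop eab) (Third.α≢p Tγ ∘ sym) (Third.α≢q Tγ ∘ sym)
                                   (inA a∈) (inA b∈) (inA γ∈) (s≤3 d∈) (∖P⊆A R z) e of
            λ { 1st → ⊥-elim (∖P∌R R a∈ 1st z)
              ; 2nd → ⊥-elim (∖P∌R R b∈ 2nd z)
              ; 3rd → at eγ o₃ _ e }) (no-excs d R f (t≤0 d∈))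
        , [] , tt)

      module _ (α≢β : α ≢ β) (α≢γ : α ≢ γ) (β≢γ : β ≢ γ) where
        w₁ w₂ w₃ : Sign
        w₁ = aα · ab · bβ
        w₂ = aα · ad · dγ
        w₃ = bβ · bd · dγ

        J₁ J₂ J₃ : Inst n
        J₁ = modify I α β α≢β (addWk w₁)
        J₂ = modify J₁ α γ α≢γ (addWk w₂)
        J₃ = modify J₂ β γ β≢γ (addWk w₃)

        -- A set missing one of `α`, `β`, `γ` contains at most one of the new constraints and has
        -- slack 1. If it contains all three, adding the triangle costs 12 and allows 9, so the set
        -- has slack 3, the cost of the three constraints.
        sparse₃ : Sparse J₃ P (L ∖ R)
        sparse₃ [] _ _ = z≤n
        sparse₃ S@(_ ∷ _) uS sS = go (α ∈? S) (β ∈? S) (γ ∈? S)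
          where
            out : ∀ {v} → v ∈ L → v ∉ S → v ∉ S ++ P
            out v∈ q m = [ q , L∌P v∈ ]′ (∈-++⁻ S m)
            uSP = uq-sub uS (∖-⊆ ∘ sS)
            once₁ = cst-once I α β α≢β (addWk w₁) 1 (addWk-cost w₁) P S uSP
            once₂ = cst-once J₁ α γ α≢γ (addWk w₂) 1 (addWk-cost w₂) P S uSP
            once₃ = cst-once J₂ β γ β≢γ (addWk w₃) 1 (addWk-cost w₃) P S uSP
            same₁ = cst-same I α β α≢β (addWk w₁) 1 (addWk-cost w₁) P S
            same₂ = cst-same J₁ α γ α≢γ (addWk w₂) 1 (addWk-cost w₂) P S
            same₃ = cst-same J₂ β γ β≢γ (addWk w₃) 1 (addWk-cost w₃) P S
            base : cst I P S + 1 ≤ 3 * length S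
            base = H₁′ a∈ 1st S uS sS (s≤s z≤n)
            ∉S : ∀ {v} → v ∈ R → v ∉ S
            ∉S v∈R m = proj₂ (∈-∖⁻ L (sS m)) v∈R
            go : Dec (α ∈ S) → Dec (β ∈ S) → Dec (γ ∈ S) → cst J₃ P S ≤ 3 * length S
            go (no p) _ _ = ≤-trans once₃ (≤-trans (≤-reflexive (cong (_+ 1) (trans (same₂ (inj₁ (out α∈ p))) (same₁ (inj₁ (out α∈ p)))))) base)
            go (yes _) (no p) _ = ≤-trans (≤-reflexive (same₃ (inj₁ (out β∈ p)))) (≤-trans once₂
              (≤-trans (≤-reflexive (cong (_+ 1) (same₁ (inj₂ (out β∈ p))))) base))
            go (yes _) (yes _) (no p) = ≤-trans (≤-reflexive (trans (same₃ (inj₂ (out γ∈ p))) (same₂ (inj₂ (out γ∈ p))))) (≤-trans once₁ base)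
            go (yes p) (yes q) (yes r) = ≤-trans (≤-trans once₃ (+-monoˡ-≤ 1 (≤-trans once₂ (+-monoˡ-≤ 1 once₁)))) slack
              where
                total : cst I P S + 2 + 4 + 6 ≤ cst I P (a ∷ b ∷ d ∷ S)
                total = grow a (b ∷ d ∷ S) {b ∷ d ∷ α ∷ []} (uq₃ (no-loop ebd) (Third.α≢p Tα ∘ sym) (Third.α≢q Tα ∘ sym))
                    (λ { 1st → 1st ; 2nd → 2nd ; 3rd → there (there p) })
                    (λ { 1st → _ , eab ; 2nd → _ , ead ; 3rd → _ , eα })
                  (grow b (d ∷ S) {d ∷ β ∷ []} (uq₂ (Third.α≢q Tβ ∘ sym))
                    (λ { 1st → 1st ; 2nd → there q })
                    (λ { 1st → _ , ebd ; 2nd → _ , eβ })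
                    (grow d S {γ ∷ []} ((λ ()) ∷ᵘ []) (λ { 1st → r }) (λ { 1st → _ , eγ }) ≤-refl))
                whole : cst I P (a ∷ b ∷ d ∷ S) ≤ 3 * (3 + length S)
                whole = sparse (a ∷ b ∷ d ∷ S)
                  ((λ { (here e) → no-loop eab e ; (there (here e)) → no-loop ead e ; (there (there m)) → ∉S 1st m }) ∷ᵘ
                    ((λ { (here e) → no-loop ebd e ; (there m) → ∉S 2nd m }) ∷ᵘ (∉S 3rd ∷ᵘ uS)))
                  (λ { 1st → a∈ ; 2nd → b∈ ; 3rd → d∈ ; (there (there (there m))) → ∖-⊆ (sS m) })
                arith : ∀ x l → x + 1 + 1 + 1 + 3 * (3 + l) + 0 ≡ 3 * l + (x + 2 + 4 + 6)
                arith = solve-∀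
                slack : cst I P S + 1 + 1 + 1 ≤ 3 * length S
                slack = lin 0 (≤-trans total whole) (arith (cst I P S) (length S))

        distinct : ⊥
        distinct = reduce-with J₃ a∈ 1st sparse₃
          (NoK4-st (λ u v → trans (st-modify J₂ β γ β≢γ (addWk w₃) (st-addWk w₃) u v)
                    (trans (st-modify J₁ α γ α≢γ (addWk w₂) (st-addWk w₂) u v) (st-modify I α β α≢β (addWk w₁) (st-addWk w₁) u v))) ∖-⊆ nok4)
          λ f ag g →
            let to₂ : ∀ {u v} → OK (c J₃ u v) (f u) (f v) → OK (c J₂ u v) (f u) (f v)
                to₂ {u} {v} = OK-modify J₂ β γ β≢γ (addWk w₃) u v (OK-addWk w₃ (c J₂ u v))
                to₁ : ∀ {u v} → OK (c J₂ u v) (f u) (f v) → OK (c J₁ u v) (f u) (f v)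
                to₁ {u} {v} = OK-modify J₁ α γ α≢γ (addWk w₂) u v (OK-addWk w₂ (c J₁ u v))
                to₀ : ∀ {u v} → OK (c J₁ u v) (f u) (f v) → OK (c I u v) (f u) (f v)
                to₀ {u} {v} = OK-modify I α β α≢β (addWk w₁) u v (OK-addWk w₁ (c I u v))
                α′ = ∈-∖⁺ α∈ α∉R ; β′ = ∈-∖⁺ β∈ β∉R ; γ′ = ∈-∖⁺ γ∈ γ∉R
                h₁ = OK-addWk-at w₁ (c I α β) (subst (λ r → OK r (f α) (f β)) (modify-at I α β α≢β (addWk w₁) 1 (addWk-cost w₁)) (to₁ {α} {β} (to₂ {α} {β} (g α′ (∈-++⁺ˡ β′)))))
                h₂ = OK-addWk-at w₂ (c J₁ α γ) (subst (λ r → OK r (f α) (f γ)) (modify-at J₁ α γ α≢γ (addWk w₂) 1 (addWk-cost w₂)) (to₂ {α} {γ} (g α′ (∈-++⁺ˡ γ′))))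
                h₃ = OK-addWk-at w₃ (c J₂ β γ) (subst (λ r → OK r (f β) (f γ)) (modify-at J₂ β γ β≢γ (addWk w₃) 1 (addWk-cost w₃)) (g β′ (∈-++⁺ˡ γ′)))
            in case tri-three ab ad bd aα bβ dγ (f α) (f β) (f γ) neg h₁ h₂ h₃ of
               λ { (k , l , m , o₁ , o₂ , o₃ , o₄ , o₅ , o₆) →
                   finish f ag (λ {u} {v} p q → to₀ {u} {v} (to₁ {u} {v} (to₂ {u} {v} (g p q)))) o₁ o₂ o₃ o₄ o₅ o₆ }

    positive : ∀ {α γ} → Third a b d α → Third b a d α → Third d a b γ → tri I a b α ≡ false → ⊥
    positive {α} {γ} Tα Tβ Tγ nt = reduce a∈ 1st λ f ag g →
      case tri-positive ab ad bd aα dγ (f α) (f γ) neg of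
      λ { (k , l , m , o₁ , o₂ , o₃ , o₄ , o₅ , o₆) →
          finish f ag g o₁ (subst (λ z → okS z l (f α) ≡ true) (sym same) o₂) o₃ o₄ o₅ o₆ }
      where
        open Outer Tα Tβ Tγ
        same : bβ ≡ ab · aα
        same with negTri ab aα bβ in h
        ... | true  = ⊥-elim (true≢false (tri-complete I a b α (neg3 eab eα eβ h)) nt)
        ... | false = negTri-false ab aα bβ h

    -- Both triangles on `ab` are negative and their apexes `d` and `α` are not adjacent. All four
    -- vertices are deleted at once, and each apex keeps one outer neighbour, as in `kite-extends`.
    negative : ∀ {α γ} → Third a b d α → Third b a d α → Third d a b γ → γ ≢ α → Neg3 I a b α → ⊥
    negative {α} {γ} Tα Tβ Tγ γ≢α ng′@(neg3 {p₁} {p₂} {p₃} f₁ f₂ f₃ n′) with thirdL a b (Third.α∈ Tα)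
    ... | δ , Tδ = reduce a∈ 1st λ f ag g →
      case kite-extends ab ad bd p₂ p₃ dγ (Third.sgn Tδ) (f γ) (f δ) neg n″ of
      λ { (k , l , m , r , o₁ , o₂ , o₃ , o₄ , o₅ , o₆ , o₇) →
        direct ((a , k) ∷ (b , l) ∷ (d , m) ∷ (α , r) ∷ []) uqR R⊆L′ f ag g
        ( outer-closed a R′ (b ∷ d ∷ α ∷ []) f R⊆L′ there
            (full₃ (_ , eab) (_ , ead) (_ , eα) (no-loop ebd) (b≢α) (d≢α) (inA b∈) (inA d∈) (inA α∈) (s≤3 a∈)) (no-excs a R′ f (t≤0 a∈))
        , exact a∈ (inA b∈) eab o₅ ∷ exact a∈ (inA d∈) ead o₃ ∷ exact a∈ (inA α∈) f₂ o₄ ∷ []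
        , outer-closed b R′ (a ∷ d ∷ α ∷ []) f R⊆L′ (λ { (here e) → here e ; (there m) → there (there m) })
            (full₃ (_ , st-sym eab) (_ , ebd) (_ , eβ) (no-loop ead) a≢α d≢α (inA a∈) (inA d∈) (inA α∈) (s≤3 b∈)) (no-excs b R′ f (t≤0 b∈))
        , exact b∈ (inA d∈) ebd o₆ ∷ exact b∈ (inA α∈) f₃ o₇ ∷ []
        , outer d R′ f (λ z e → case only-d (∖P⊆A R′ z) e of
            λ { 1st → ⊥-elim (∖P∌R R′ a∈ 1st z)
              ; 2nd → ⊥-elim (∖P∌R R′ b∈ 2nd z)
              ; 3rd → at eγ o₁ _ e }) (no-excs d R′ f (t≤0 d∈))
        , mkOK (λ q e → ⊥-elim (d≁α e)) (λ ω h → ⊥-elim (no-weak d∈ (inA α∈) ω h)) ∷ []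
        , outer α R′ f (λ z e → case full₃ (_ , st-sym eα) (_ , st-sym eβ) (_ , Third.e Tδ) (no-loop eab)
                                     (Third.α≢p Tδ ∘ sym) (Third.α≢q Tδ ∘ sym) (inA a∈) (inA b∈) (∈-++⁺ˡ (Third.α∈ Tδ)) (s≤3 α∈) (∖P⊆A R′ z) e of
            λ { 1st → ⊥-elim (∖P∌R R′ a∈ 1st z)
              ; 2nd → ⊥-elim (∖P∌R R′ b∈ 2nd z)
              ; 3rd → at (Third.e Tδ) o₂ _ e }) (no-excs α R′ f (t≤0 α∈))
        , [] , tt) }
      where
        open Outer Tα Tβ Tγ
        R′ : List (Fin n)
        R′ = a ∷ b ∷ d ∷ α ∷ []
        a≢α : a ≢ α
        a≢α = no-loop eα
        b≢α : b ≢ α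
        b≢α = no-loop eβ
        d≢α : d ≢ α
        d≢α = Third.α≢q Tα ∘ sym
        n″ : negTri ab p₂ p₃ ≡ true
        n″ = subst (λ z → negTri z p₂ p₃ ≡ true) (just-inj f₁ eab) n′
        uqR : Unique R′
        uqR = (λ { (here e) → no-loop eab e ; (there (here e)) → no-loop ead e ; (there (there (here e))) → a≢α e }) ∷ᵘ
          uq₃ (no-loop ebd) b≢α d≢α
        R⊆L′ : R′ ⊆ L
        R⊆L′ 1st = a∈
        R⊆L′ 2nd = b∈
        R⊆L′ 3rd = d∈
        R⊆L′ 4th = α∈
        only-d : ∀ {w q} → w ∈ A → st (c I d w) ≡ just q → w ∈ a ∷ b ∷ γ ∷ []
        only-d = full₃ (_ , st-sym ead) (_ , st-sym ebd) (_ , eγ) (no-loop eab) (Third.α≢p Tγ ∘ sym) (Third.α≢q Tγ ∘ sym)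
          (inA a∈) (inA b∈) (inA γ∈) (s≤3 d∈)
        d≁α : ∀ {q} → st (c I d α) ≡ just q → ⊥
        d≁α e with only-d (inA α∈) e
        ... | here z = a≢α (sym z)
        ... | there (here z) = b≢α (sym z)
        ... | there (there (here z)) = γ≢α (sym z)

  -- Each edge of K₄ lies in two triangles, so the signs of the four triangles multiply to plus.
  parity : ∀ ab ad bd aα bα dα → negTri ab ad bd ✓ → negTri ab aα bα ✓ → negTri ad aα dα ✓ → negTri bd bα dα ✓
  parity = toWitness {a? = allS? λ _ → allS? λ _ → allS? λ _ → allS? λ _ → allS? λ _ → allS? λ _ → imp? (imp? (imp? chk))} tt

  -- If `γ` equals `α` as well, the four vertices induce K₄. Then a further triangle at `α` is
  -- positive, or by `parity` all four are negative, against `nok4`.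
  diamond-free : ∀ {a b d α γ} → a ∈ L → b ∈ L → d ∈ L → Neg3 I a b d → Third a b d α → Third b a d α → Third d a b γ → ⊥
  diamond-free {a} {b} {d} {α} {γ} a∈ b∈ d∈ ng Tα Tβ Tγ with Bool-cases (tri I a b α) | γ ≟ α
  ... | inj₂ h | _ = Triangle.positive a∈ b∈ d∈ ng Tα Tβ Tγ h
  ... | inj₁ h | no ne = Triangle.negative a∈ b∈ d∈ ng Tα Tβ Tγ ne (tri-sound I a b α h)
  ... | inj₁ h | yes refl with Bool-cases (tri I a d α)
  ...   | inj₂ h′ = Triangle.positive a∈ d∈ b∈ (Neg3-swap₂ ng) (swapThird Tα) Tγ Tβ h′
  ...   | inj₁ h′ = K (tri-sound I a b α h) (tri-sound I a d α h′) ng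
    where
      K : Neg3 I a b α → Neg3 I a d α → Neg3 I a b d → ⊥
      K x@(neg3 {ab} {aα} {bα} e₁ e₂ e₃ n₁) y@(neg3 {ad} {aα′} {dα} e₄ e₅ e₆ n₂) z@(neg3 {ab′} {ad′} {bd} e₇ e₈ e₉ n₃) =
        nok4 a∈ b∈ d∈ (Third.α∈ Tα) (k4 z x y (neg3 e₉ e₃ e₆
          (parity ab ad bd aα bα dα
            (subst₂ (λ p q → negTri p q bd ≡ true) (just-inj e₇ e₁) (just-inj e₈ e₄) n₃) n₁
            (subst (λ p → negTri ad p dα ≡ true) (just-inj e₅ e₂) n₂))))

  no-neg : ∀ {a b d} → a ∈ L → b ∈ L → d ∈ L → Neg3 I a b d → ⊥
  no-neg {a} {b} {d} a∈ b∈ d∈ ng = go (thirdL b d a∈) (thirdL a d b∈) (thirdL a b d∈)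
    where
      cases : ∀ {α β γ} → Third a b d α → Third b a d β → Third d a b γ → Dec (α ≡ β) → Dec (α ≡ γ) → Dec (β ≡ γ) → ⊥
      cases Tα Tβ Tγ (yes refl) _ _ = diamond-free a∈ b∈ d∈ ng Tα Tβ Tγ
      cases Tα Tβ Tγ (no _) (yes refl) _ = diamond-free a∈ d∈ b∈ (Neg3-swap₂ ng) (swapThird Tα) Tγ Tβ
      cases Tα Tβ Tγ (no _) (no _) (yes refl) =
        diamond-free b∈ d∈ a∈ (Neg3-swap₂ (Neg3-swap₁ ng)) (swapThird Tβ) (swapThird Tγ) Tα
      cases Tα Tβ Tγ (no p) (no q) (no r) = Triangle.Outer.distinct a∈ b∈ d∈ ng Tα Tβ Tγ p q r
      go : ∃ (Third a b d) → ∃ (Third b a d) → ∃ (Third d a b) → ⊥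
      go (α , Tα) (β , Tβ) (γ , Tγ) = cases Tα Tβ Tγ (α ≟ β) (α ≟ γ) (β ≟ γ)

  -- Without negative triangles, a switching with fewest negative edges leaves them as a matching, and every
  -- matched vertex has at most one positive neighbour that is matched.

  isNeg : Fin n → Fin n → Bool
  isNeg u v with st (c I u v)
  ... | just q  = isMinus q
  ... | nothing = false

  isNeg-at : ∀ u v {q} → st (c I u v) ≡ just q → isNeg u v ≡ isMinus q
  isNeg-at u v e rewrite e = refl

  isStrong-sym : ∀ u v → isStrong I u v ≡ isStrong I v u
  isStrong-sym u v rewrite csym I u v = refl

  isNeg-sym : ∀ u v → isNeg u v ≡ isNeg v u
  isNeg-sym u v rewrite csym I u v = refl

  module S₁ = Switching L uqL (isStrong I) isNeg isStrong-sym isNeg-sym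

  strong-∑ : ∀ {x X} → x ∈ L → Unique X → X ⊆ L → ∑ X (λ y → 𝟙 (isStrong I x y)) ≤ 3
  strong-∑ {x} {X} x∈ uX sX = ≤-trans (∑-⊆ (λ y → 𝟙 (isStrong I x y)) {X} {A} uX (∈-++⁺ˡ ∘ sX))
    (≤-trans (≤-reflexive (∑-cong A (λ {y} _ → sym (sc≡𝟙 I x y)))) (s≤3 x∈))

  module Matching (δ : Fin n → Bool) (best : ∀ δ′ → S₁.size δ′ < S₁.size δ → ⊥) where
    neg pos : Fin n → Fin n → Bool
    neg = S₁.frus δ
    pos = S₁.calm δ

    neg-strong : ∀ {u v} → neg u v ≡ true → Strong u v
    neg-strong {u} {v} h = isStrong-elim I u v (proj₁ (∧-elim h))

    pos-strong : ∀ {u v} → pos u v ≡ true → Strong u v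
    pos-strong {u} {v} h = isStrong-elim I u v (proj₁ (∧-elim h))

    neg-sym : ∀ {u v} → neg u v ≡ true → neg v u ≡ true
    neg-sym {u} {v} h = trans (S₁.frus-sym δ v u) h

    pos-sym : ∀ {u v} → pos u v ≡ true → pos v u ≡ true
    pos-sym {u} {v} h = trans (S₁.calm-sym δ v u) h

    neg≢pos : ∀ {x y z} → neg x y ≡ true → pos x z ≡ true → y ≢ z
    neg≢pos {x} {y} p q refl = S₁.not-both δ x y p q

    loop : ∀ {u v} → Strong u v → v ≢ u
    loop (_ , e) = no-loop e ∘ sym

    -- By optimality of the cut around `x`, two negative edges would come with two positive ones,
    -- but `x` has three edges.
    one-neg : ∀ {x v w} → x ∈ L → v ∈ L → w ∈ L → neg x v ≡ true → neg x w ≡ true → v ≡ w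
    one-neg {x} {v} {w} x∈ v∈ w∈ p q with v ≟ w
    ... | yes e = e
    ... | no ne = ⊥-elim (<⇒≱ {3} {4} ≤-refl (≤-trans (+-mono-≤ two-neg (≤-trans two-neg opt)) (≤-trans (≤-reflexive (S₁.cross-+ δ X Y)) total)))
      where
        X Y : List (Fin n)
        X = x ∷ []
        Y = L ∖ X
        opt = S₁.optimal δ X ((λ ()) ∷ᵘ []) (λ { 1st → x∈ }) (best (S₁.flipOn X δ))
        two-neg : 2 ≤ S₁.cross neg X Y
        two-neg = ≤-trans (≤-trans (+-mono-≤ (≤-reflexive (sym (cong 𝟙 p))) (≤-trans (≤-reflexive (sym (cong 𝟙 q))) (m≤m+n _ 0)))
          (∑-⊆ (λ y → 𝟙 (neg x y)) {v ∷ w ∷ []} {Y} (uq₂ ne)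
            (λ { 1st → ∈-∖⁺ v∈ (loop (neg-strong p) ∘ ∈-single) ; 2nd → ∈-∖⁺ w∈ (loop (neg-strong q) ∘ ∈-single) })))
          (m≤m+n _ 0)
        total : S₁.cross (isStrong I) X Y ≤ 3
        total = ≤-trans (≤-reflexive (+-identityʳ _)) (strong-∑ x∈ (Unique-∖ uqL) ∖-⊆)

    matched : Fin n → Bool
    matched x = anyL (neg x) L

    mated : ∀ {x} → matched x ≡ true → ∃ λ x′ → (x′ ∈ L) × (neg x x′ ≡ true)
    mated {x} h = anyL-elim (neg x) L h

    -- Otherwise switching at x, y, z together would remove a negative edge.
    one-pos : ∀ {x y z} → x ∈ L → y ∈ L → z ∈ L → matched x ≡ true → matched y ≡ true → matched z ≡ true →
      pos x y ≡ true → pos x z ≡ true → y ≡ z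
    one-pos {x} {y} {z} x∈ y∈ z∈ mx my mz p q with y ≟ z
    ... | yes e = e
    ... | no ne with mated mx | mated my | mated mz
    ...   | x′ , x′∈ , nx | y′ , y′∈ , ny | z′ , z′∈ , nz =
      ⊥-elim (<⇒≱ {5} {6} ≤-refl (≤-trans (+-mono-≤ three-neg (≤-trans three-neg opt)) (≤-trans (≤-reflexive (S₁.cross-+ δ X Y)) total)))
      where
        X Y : List (Fin n)
        X = x ∷ y ∷ z ∷ []
        Y = L ∖ X
        x≢y : x ≢ y
        x≢y = loop (pos-strong p) ∘ sym
        x≢z : x ≢ z
        x≢z = loop (pos-strong q) ∘ sym
        X⊆L : X ⊆ L
        X⊆L 1st = x∈
        X⊆L 2nd = y∈
        X⊆L 3rd = z∈
        opt = S₁.optimal δ X (uq₃ x≢y x≢z ne) X⊆L (best (S₁.flipOn X δ))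
        -- A negative edge `yz` would close a negative triangle with the positive edges `xy` and
        -- `xz`. Hence the mates of `x`, `y`, `z` all lie outside `X`.
        flat : neg y z ≡ true → ⊥
        flat h with isStrong-elim I x y (proj₁ (∧-elim p)) | isStrong-elim I x z (proj₁ (∧-elim q)) | isStrong-elim I y z (proj₁ (∧-elim h))
        ... | s₁ , e₁ | s₂ , e₂ | s₃ , e₃ = no-neg x∈ y∈ z∈ (neg3 e₁ e₂ e₃
          (sgn s₁ s₂ s₃ (δ x) (δ y) (δ z)
            (subst (λ w → not (w xor (δ x xor δ y)) ≡ true) (isNeg-at x y e₁) (proj₂ (∧-elim {isStrong I x y} p)))
            (subst (λ w → not (w xor (δ x xor δ z)) ≡ true) (isNeg-at x z e₂) (proj₂ (∧-elim {isStrong I x z} q)))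
            (subst (λ w → (w xor (δ y xor δ z)) ≡ true) (isNeg-at y z e₃) (proj₂ (∧-elim {isStrong I y z} h)))))
          where
            sgn : ∀ s₁ s₂ s₃ a b d → not (isMinus s₁ xor (a xor b)) ✓ → not (isMinus s₂ xor (a xor d)) ✓ →
              (isMinus s₃ xor (b xor d)) ✓ → negTri s₁ s₂ s₃ ✓
            sgn = toWitness {a? = allS? λ _ → allS? λ _ → allS? λ _ → allB? λ _ → allB? λ _ → allB? λ _ → imp? (imp? (imp? chk))} tt
        one : ∀ {u u′} → u′ ∈ L → u′ ∉ X → neg u u′ ≡ true → 1 ≤ ∑ Y (λ v → 𝟙 (neg u v))
        one {u} {u′} u′∈ q h = ≤-trans (≤-reflexive (sym (cong 𝟙 h))) (term≤∑ {x = u′} (λ v → 𝟙 (neg u v)) (∈-∖⁺ u′∈ q))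
        three-neg : 3 ≤ S₁.cross neg X Y
        three-neg = +-mono-≤ (one x′∈ (λ { (here e) → loop (neg-strong nx) e ; (there (here e)) → neg≢pos nx p e ; (there (there (here e))) → neg≢pos nx q e }) nx)
          (+-mono-≤ (one y′∈ (λ { (here e) → neg≢pos ny (pos-sym p) e ; (there (here e)) → loop (neg-strong ny) e
                                ; 3rd → flat ny }) ny)
            (≤-trans (one z′∈ (λ { (here e) → neg≢pos nz (pos-sym q) e ; 2nd → flat (neg-sym nz)
                                 ; (there (there (here e))) → loop (neg-strong nz) e }) nz) (m≤m+n _ 0)))
        ∉Y : ∀ {v} → v ∈ X → v ∉ Y
        ∉Y v∈X m = proj₂ (∈-∖⁻ L m) v∈X
        uY : Unique Y
        uY = Unique-∖ uqL
        st1 : ∀ {u v} → pos u v ≡ true → 1 ≤ 𝟙 (isStrong I u v)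
        st1 {u} {v} h = ≤-reflexive (sym (cong 𝟙 (proj₁ (∧-elim {isStrong I u v} h))))
        yside : ∀ {u} → u ∈ L → pos u x ≡ true → ∑ Y (λ v → 𝟙 (isStrong I u v)) ≤ 2
        yside {u} u∈ h = +-cancelˡ-≤ 1 _ _ (≤-trans (+-monoˡ-≤ _ (st1 h)) (strong-∑ {u} {x ∷ Y} u∈ (∉Y 1st ∷ᵘ uY)
          (λ { 1st → x∈ ; (there m) → ∖-⊆ m })))
        xside : ∑ Y (λ v → 𝟙 (isStrong I x v)) ≤ 1
        xside = +-cancelˡ-≤ 2 _ _ (≤-trans (≤-trans (+-mono-≤ (st1 p) (+-monoˡ-≤ (∑ Y (λ v → 𝟙 (isStrong I x v))) (st1 q))) ≤-refl)
          (strong-∑ {x} {y ∷ z ∷ Y} x∈ ((λ { (here e) → ne e ; (there m) → ∉Y 2nd m }) ∷ᵘ (∉Y 3rd ∷ᵘ uY))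
            (λ { 1st → y∈ ; 2nd → z∈ ; (there (there m)) → ∖-⊆ m })))
        -- Of its three edges `x` spends two inside `X`, and `y` and `z` at least one each. Three
        -- negative edges leave `X`, and optimality would ask for six edges in all.
        total : S₁.cross (isStrong I) X Y ≤ 5
        total = +-mono-≤ xside (+-mono-≤ (yside y∈ (pos-sym p)) (≤-trans (≤-reflexive (+-identityʳ _)) (yside z∈ (pos-sym q))))

    -- These edges form a matching by `one-pos`. The second use of `Switching` splits the matched
    -- vertices into two sides with mates apart, and its frustrated edges are the links joining
    -- opposite sides.
    link : Fin n → Fin n → Bool
    link u v = pos u v ∧ (matched u ∧ matched v)

    link-sym : ∀ u v → link u v ≡ link v u
    link-sym u v = cong₂ _∧_ (S₁.calm-sym δ u v) (∧-comm (matched u) (matched v))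

    module S₂ = Switching L uqL link (λ _ _ → false) link-sym (λ _ _ → refl)

    Opposite : (Fin n → Bool) → Set
    Opposite h = ∀ {u v} → u ∈ L → v ∈ L → neg u v ≡ true → (h u xor h v) ≡ true

    module Sides (h : Fin n → Bool) (opp : Opposite h) (best₂ : ∀ h′ → Opposite h′ → S₂.size h′ < S₂.size h → ⊥) where
      bad : Fin n → Bool
      bad x = anyL (S₂.frus h x) L

      opp-flip : ∀ {x x′} → x ∈ L → x′ ∈ L → neg x x′ ≡ true → Opposite (S₂.flipOn (x ∷ x′ ∷ []) h)
      opp-flip {x} {x′} x∈ x′∈ nx {u} {v} u∈ v∈ nuv = go (u ∈? X) (v ∈? X)
        where
          X : List (Fin n)
          X = x ∷ x′ ∷ []
          paired : ∀ {u v} → u ∈ L → v ∈ L → neg u v ≡ true → u ∈ X → v ∈ X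
          paired u∈ v∈ nuv 1st = there (here (one-neg x∈ v∈ x′∈ nuv nx))
          paired u∈ v∈ nuv 2nd = here (one-neg x′∈ v∈ x∈ nuv (neg-sym nx))
          toggle : ∀ a b → (a xor b) ✓ → (not a xor not b) ✓
          toggle = toWitness {a? = allB? λ _ → allB? λ _ → imp? chk} tt
          go : Dec (u ∈ X) → Dec (v ∈ X) → (S₂.flipOn X h u xor S₂.flipOn X h v) ≡ true
          go (yes p) _ = trans (cong₂ _xor_ (S₂.flip-in X h p) (S₂.flip-in X h (paired u∈ v∈ nuv p))) (toggle (h u) (h v) (opp u∈ v∈ nuv))
          go (no p) (yes q) = ⊥-elim (p (paired v∈ u∈ (neg-sym nuv) q))
          go (no p) (no q) = trans (cong₂ _xor_ (S₂.flip-out X h p) (S₂.flip-out X h q)) (opp u∈ v∈ nuv)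

      frus-link : ∀ {x y} → S₂.frus h x y ≡ true → (pos x y ≡ true) × (matched x ≡ true) × (matched y ≡ true)
      frus-link {x} {y} p = let a , b = ∧-elim {pos x y} (proj₁ (∧-elim {link x y} p)) in a , ∧-elim b

      link-≤1 : ∀ x Y → x ∈ L → Unique Y → Y ⊆ L → ∑ Y (λ y → 𝟙 (link x y)) ≤ 1
      link-≤1 x Y x∈ uY sY = ≤-trans (≤-reflexive (sym (length-filterᵇ (link x) Y))) (at-most-one (Unique-filterᵇ (link x) uY) same)
        where
          same : ∀ {y z} → y ∈ filterᵇ (link x) Y → z ∈ filterᵇ (link x) Y → y ≡ z
          same {y} {z} m m′ =
            let y∈ , p = ∈filterᵇ (link x) Y m ; z∈ , q = ∈filterᵇ (link x) Y m′
                p₁ , p₂ = ∧-elim {pos x y} p ; q₁ , q₂ = ∧-elim {pos x z} q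
                mx , my = ∧-elim {matched x} p₂ ; _ , mz = ∧-elim {matched x} q₂
            in one-pos x∈ (sY y∈) (sY z∈) mx my mz p₁ q₁

      -- Moving `x` and `x′` to the other side together keeps mates apart and would repair the only
      -- links at these two vertices. A better division would result.
      not-both-bad : ∀ {x x′} → x ∈ L → x′ ∈ L → neg x x′ ≡ true → bad x ≡ true → bad x′ ≡ true → ⊥
      not-both-bad {x} {x′} x∈ x′∈ nx b b′ with anyL-elim (S₂.frus h x) L b | anyL-elim (S₂.frus h x′) L b′
      ... | y , y∈ , p | y′ , y′∈ , p′ =
        <⇒≱ {2} {4} (≤ᵇ⇒≤ 3 4 tt) (≤-trans (+-mono-≤ two-bad (≤-trans two-bad opt)) (≤-trans (≤-reflexive (S₂.cross-+ h X Y)) total))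
        where
          X Y : List (Fin n)
          X = x ∷ x′ ∷ []
          Y = L ∖ X
          X⊆L : X ⊆ L
          X⊆L 1st = x∈
          X⊆L 2nd = x′∈
          opt = S₂.optimal h X (uq₂ (loop (neg-strong nx) ∘ sym)) X⊆L (best₂ (S₂.flipOn X h) (opp-flip x∈ x′∈ nx))
          one : ∀ {u w} → w ∈ L → w ∉ X → S₂.frus h u w ≡ true → 1 ≤ ∑ Y (λ v → 𝟙 (S₂.frus h u v))
          one {u} {w} w∈ q z = ≤-trans (≤-reflexive (sym (cong 𝟙 z))) (term≤∑ {x = w} (λ v → 𝟙 (S₂.frus h u v)) (∈-∖⁺ w∈ q))
          two-bad : 2 ≤ S₂.cross (S₂.frus h) X Y
          two-bad = +-mono-≤ (one y∈ (λ { (here e) → loop (pos-strong (proj₁ (frus-link p))) e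
                                        ; (there (here e)) → neg≢pos nx (proj₁ (frus-link p)) (sym e) }) p)
            (≤-trans (one y′∈ (λ { (here e) → neg≢pos (neg-sym nx) (proj₁ (frus-link p′)) (sym e)
                                 ; (there (here e)) → loop (pos-strong (proj₁ (frus-link p′))) e }) p′) (m≤m+n _ 0))
          total : S₂.cross link X Y ≤ 2
          total = +-mono-≤ (link-≤1 x Y x∈ (Unique-∖ uqL) ∖-⊆) (≤-trans (≤-reflexive (+-identityʳ _)) (link-≤1 x′ Y x′∈ (Unique-∖ uqL) ∖-⊆))

      hue : Fin n → Color
      hue v = tint (δ v) (matched v) (h v) (bad v)

      hue-ok : ∀ {u v q} → u ∈ L → v ∈ L → st (c I u v) ≡ just q → okS q (hue u) (hue v) ≡ true
      hue-ok {u} {v} {q} u∈ v∈ e = go (Bool-cases (isMinus q xor (δ u xor δ v)))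
        where
          str : isStrong I u v ≡ true
          str = isStrong-intro I u v e
          go : ((isMinus q xor (δ u xor δ v)) ≡ true) ⊎ ((isMinus q xor (δ u xor δ v)) ≡ false) → okS q (hue u) (hue v) ≡ true
          go (inj₁ f) = subst₂ (λ x y → okS q (tint (δ u) x (h u) (bad u)) (tint (δ v) y (h v) (bad v)) ≡ true) (sym mu) (sym mv)
              (tint-frus q (δ u) (δ v) (h u) (h v) (bad u) (bad v) f (opp u∈ v∈ nuv) nb′)
            where
              nuv : neg u v ≡ true
              nuv = ∧-intro str (trans (cong (_xor (δ u xor δ v)) (isNeg-at u v e)) f)
              mu : matched u ≡ true
              mu = anyL-intro (neg u) v∈ nuv
              mv : matched v ≡ true
              mv = anyL-intro (neg v) u∈ (neg-sym nuv)
              nb′ : not (bad u ∧ bad v) ≡ true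
              nb′ with Bool-cases (bad u ∧ bad v)
              ... | inj₂ z = cong not z
              ... | inj₁ z = ⊥-elim (not-both-bad u∈ v∈ nuv (proj₁ (∧-elim {bad u} z)) (proj₂ (∧-elim {bad u} z)))
          go (inj₂ f) = tint-calm q (δ u) (δ v) (matched u) (matched v) (h u) (h v) (bad u) (bad v) (cong not f) imp
            where
              puv : pos u v ≡ true
              puv = ∧-intro str (cong not (trans (cong (_xor (δ u xor δ v)) (isNeg-at u v e)) f))
              imp : (matched u ∧ matched v ∧ (h u xor h v) ⇒ bad u ∧ bad v) ≡ true
              imp with Bool-cases (matched u ∧ matched v ∧ (h u xor h v))
              ... | inj₂ z = cong (λ w → w ⇒ bad u ∧ bad v) z
              ... | inj₁ z = trans (cong (λ w → w ⇒ bad u ∧ bad v) z) (∧-intro (anyL-intro (S₂.frus h u) v∈ fuv)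
                               (anyL-intro (S₂.frus h v) u∈ (trans (S₂.frus-sym h v u) fuv)))
                where
                  fuv : S₂.frus h u v ≡ true
                  fuv = let a , b = ∧-elim {matched u} z ; b₁ , b₂ = ∧-elim {matched v} b in ∧-intro (∧-intro puv (∧-intro a b₁)) b₂

      paint : Fin n → Color
      paint v with v ∈? L
      ... | yes _ = hue v
      ... | no _  = f₀ v

      paint-in : ∀ {v} → v ∈ L → paint v ≡ hue v
      paint-in {v} m with v ∈? L
      ... | yes _ = refl
      ... | no q  = ⊥-elim (q m)

      paint-out : ∀ v → v ∉ L → paint v ≡ f₀ v
      paint-out v m with v ∈? L
      ... | yes q = ⊥-elim (m q)
      ... | no _  = refl

      done : ⊥
      done = N (paint , paint-out , λ {u} {v} u∈ v∈ → mkOK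
        (λ q e → let v∈L = nbr-in-L u∈ (deg≤6 u∈) (q , e) v∈ in
           subst₂ (λ x y → okS q x y ≡ true) (sym (paint-in u∈)) (sym (paint-in v∈L)) (hue-ok u∈ v∈L e))
        (λ ω z → ⊥-elim (no-weak u∈ v∈ ω z)))

    -- An arbitrary division to start from: of two mates, the one of smaller index is on the side
    -- `true`.
    h₀ : Fin n → Bool
    h₀ u = anyL (λ v → neg u v ∧ (toℕ u <ᵇ toℕ v)) L

    h₀-at : ∀ {u v} → u ∈ L → v ∈ L → neg u v ≡ true → h₀ u ≡ (toℕ u <ᵇ toℕ v)
    h₀-at {u} {v} u∈ v∈ nuv with Bool-cases (toℕ u <ᵇ toℕ v)
    ... | inj₁ z = trans (anyL-intro (λ v → neg u v ∧ (toℕ u <ᵇ toℕ v)) v∈ (∧-intro nuv z)) (sym z)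
    ... | inj₂ z with Bool-cases (h₀ u)
    ...   | inj₂ w = trans w (sym z)
    ...   | inj₁ w with anyL-elim (λ v → neg u v ∧ (toℕ u <ᵇ toℕ v)) L w
    ...     | v′ , v′∈ , k with one-neg u∈ v∈ v′∈ nuv (proj₁ (∧-elim {neg u v′} k))
    ...       | refl = ⊥-elim (true≢false (proj₂ (∧-elim {neg u v} k)) z)

    opp₀ : Opposite h₀
    opp₀ {u} {v} u∈ v∈ nuv = trans (cong₂ _xor_ (h₀-at u∈ v∈ nuv) (h₀-at v∈ u∈ (neg-sym nuv)))
      (asym (toℕ u) (toℕ v) (λ e → loop (neg-strong nuv) (sym (toℕ-injective e))))
      where
        asym : ∀ x y → x ≢ y → ((x <ᵇ y) xor (y <ᵇ x)) ≡ true
        asym zero zero ne = ⊥-elim (ne refl)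
        asym zero (suc y) ne = refl
        asym (suc x) zero ne = refl
        asym (suc x) (suc y) ne = asym x y (ne ∘ cong suc)

    -- Descent in place of choosing an optimum: a better division would already lead to a
    -- contradiction, so the current one may be treated as best. The choice of `δ` in `switchings`
    -- is handled alike.
    sides : ∀ k h → Opposite h → S₂.size h < k → ⊥
    sides (suc k) h opp l = Sides.done h opp λ h′ opp′ l′ → sides k h′ opp′ (≤-trans l′ (+-cancelˡ-≤ 1 _ _ l))

  switchings : ∀ k δ → S₁.size δ < k → ⊥
  switchings (suc k) δ l = Matching.sides δ best _ (Matching.h₀ δ best) (Matching.opp₀ δ best) ≤-refl
    where
      best : ∀ δ′ → S₁.size δ′ < S₁.size δ → ⊥
      best δ′ l′ = switchings k δ′ (≤-trans l′ (+-cancelˡ-≤ 1 _ _ l))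

  absurd : ⊥
  absurd = switchings _ (λ _ → false) ≤-refl

module _ {n : ℕ} where

  extend : ∀ k (I : Inst n) P L f₀ → length L < k → Unique (L ++ P) → Sparse I P L → NoK4 I L → ¬ ¬ Ext I P L f₀
  extend (suc k) I P L f₀ l uq sp nk N = Min.absurd record
    { I = I ; P = P ; L = L ; f₀ = f₀ ; uq = uq ; sparse = sp ; nok4 = nk ; N = N
    ; IH = λ I′ P′ L′ f′ l′ → extend k I′ P′ L′ f′ (≤-trans l′ (+-cancelˡ-≤ 1 _ _ l)) }

-- Critical signed graphs

module _ (G : SignedGraph) where
  private
    Vx = Fin (nV G)
    Ed = Fin (nE G)

  joins : Ed → Vx → Vx → Bool
  joins e u v = isPair (src G e) (tgt G e) u v

  joins-ends : ∀ e → joins e (src G e) (tgt G e) ≡ true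
  joins-ends e = isPair-intro (src G e) (tgt G e)

  joins-unique : ∀ e p q p′ q′ → joins e p q ≡ true → joins e p′ q′ ≡ true →
    ((p ≡ p′) × (q ≡ q′)) ⊎ ((p ≡ q′) × (q ≡ p′))
  joins-unique e p q p′ q′ h h′ with isPair-elim _ _ p q h | isPair-elim _ _ p′ q′ h′
  ... | inj₁ (refl , refl) | inj₁ (refl , refl) = inj₁ (refl , refl)
  ... | inj₁ (refl , refl) | inj₂ (refl , refl) = inj₂ (refl , refl)
  ... | inj₂ (refl , refl) | inj₁ (refl , refl) = inj₂ (refl , refl)
  ... | inj₂ (refl , refl) | inj₂ (refl , refl) = inj₁ (refl , refl)

  joins-okS : ∀ {e p q} (f : Vx → Color) → joins e p q ≡ true → K10-3-Edge (sign G e) (f (src G e)) (f (tgt G e)) →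
    okS (sign G e) (f p) (f q) ≡ true
  joins-okS {e} {p} {q} f h k with isPair-elim _ _ p q h
  ... | inj₁ (refl , refl) = okS-complete (sign G e) _ _ k
  ... | inj₂ (refl , refl) = okS-sym (sign G e) _ _ (okS-complete (sign G e) _ _ k)

  -- An uncolourable subgraph of a critical graph is the whole graph.
  contains⇒iso : Critical G → (H : SignedGraph) (φ : Fin (nV H) → Vx) (ψ : Fin (nE H) → Ed) →
    (∀ {i j} → φ i ≡ φ j → i ≡ j) → (∀ {k l} → ψ k ≡ ψ l → k ≡ l) →
    (∀ k → joins (ψ k) (φ (src H k)) (φ (tgt H k)) ≡ true) →
    (∀ (f : Fin (nV H) → Color) → (∀ k → okS (sign G (ψ k)) (f (src H k)) (f (tgt H k)) ≡ true) → ⊥) →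
    (δ : Fin (nV H) → Bool) → (∀ k → sign H k ≡ flipIf (δ (src H k) xor δ (tgt H k)) (sign G (ψ k))) →
    SwitchIso G H
  contains⇒iso (_ , crit) H φ ψ φ-inj ψ-inj jn unc δ sg =
    mk↔ₛ′ φ⁻ φ (λ i → φ-inj (φφ⁻ (φ i))) φφ⁻ , mk↔ₛ′ ψ⁻ ψ (λ k → ψ-inj (ψψ⁻ (ψ k))) ψψ⁻ , δ ∘ φ⁻ ,
    λ e → subst Edge-ok (ψψ⁻ e) (edge (ψ⁻ e))
    where
      hit? : ∀ v → Dec (∃ λ i → φ i ≡ v)
      hit? v = any? (λ i → φ i ≟ v)
      hitE? : ∀ e → Dec (∃ λ k → ψ k ≡ e)
      hitE? e = any? (λ k → ψ k ≟ e)
      yes! : ∀ {B : Set} (d : Dec B) → B → does d ≡ true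
      yes! (yes _) _ = refl
      yes! (no q)  b = ⊥-elim (q b)
      sub′ : Subgraph G
      sub′ = record { inV = λ v → does (hit? v) ; inE = λ e → does (hitE? e) ; closed = cl }
        where
          cl : ∀ e → does (hitE? e) ≡ true → (does (hit? (src G e)) ≡ true) × (does (hit? (tgt G e)) ≡ true)
          cl e h with hitE? e
          ... | yes (k , refl) with isPair-elim _ _ _ _ (jn k)
          ...   | inj₁ (p , q) = yes! (hit? (src G e)) (_ , p) , yes! (hit? (tgt G e)) (_ , q)
          ...   | inj₂ (p , q) = yes! (hit? (src G e)) (_ , q) , yes! (hit? (tgt G e)) (_ , p)
      improper : ¬ Proper sub′
      improper pr with crit sub′ pr
      ... | f , good = unc (f ∘ φ) λ k → joins-okS f (jn k) (good (ψ k) (yes! (hitE? (ψ k)) (k , refl)))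
      surj : ∀ v → ∃ λ i → φ i ≡ v
      surj v with hit? v in eq
      ... | yes q = q
      ... | no q  = ⊥-elim (improper (inj₁ (v , cong does eq)))
      surjE : ∀ e → ∃ λ k → ψ k ≡ e
      surjE e with hitE? e in eq
      ... | yes q = q
      ... | no q  = ⊥-elim (improper (inj₂ (e , cong does eq)))
      φ⁻ : Vx → Fin (nV H)
      φ⁻ v = proj₁ (surj v)
      φφ⁻ : ∀ v → φ (φ⁻ v) ≡ v
      φφ⁻ v = proj₂ (surj v)
      ψ⁻ : Ed → Fin (nE H)
      ψ⁻ e = proj₁ (surjE e)
      ψψ⁻ : ∀ e → ψ (ψ⁻ e) ≡ e
      ψψ⁻ e = proj₂ (surjE e)
      inv : ∀ {v i} → φ i ≡ v → i ≡ φ⁻ v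
      inv {v} p = φ-inj (trans p (sym (φφ⁻ v)))
      Edge-ok : Ed → Set
      Edge-ok e = (((src H (ψ⁻ e) ≡ φ⁻ (src G e)) × (tgt H (ψ⁻ e) ≡ φ⁻ (tgt G e))) ⊎
                   ((src H (ψ⁻ e) ≡ φ⁻ (tgt G e)) × (tgt H (ψ⁻ e) ≡ φ⁻ (src G e)))) ×
                  (sign H (ψ⁻ e) ≡ flipIf (δ (φ⁻ (src G e)) xor δ (φ⁻ (tgt G e))) (sign G e))
      edge : ∀ k → Edge-ok (ψ k)
      edge k rewrite ψ-inj (ψψ⁻ (ψ k)) with isPair-elim _ _ _ _ (jn k)
      ... | inj₁ (p , q) = inj₁ (inv p , inv q) ,
            trans (sg k) (cong₂ (λ x y → flipIf (δ x xor δ y) (sign G (ψ k))) (inv p) (inv q))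
      ... | inj₂ (p , q) = inj₂ (inv p , inv q) ,
            trans (sg k) (trans (cong₂ (λ x y → flipIf (δ x xor δ y) (sign G (ψ k))) (inv p) (inv q))
              (cong (λ z → flipIf z (sign G (ψ k))) (xor-comm (δ (φ⁻ (tgt G (ψ k)))) (δ (φ⁻ (src G (ψ k)))))))

opaque
  unfolding okS

  okS-exclusive : ∀ i j → okS plus i j ≡ true → okS minus i j ≡ true → ⊥
  okS-exclusive i j p q with near ∣ toℕ i - toℕ j ∣
  okS-exclusive i j p () | true

  -- With all edges switched to negative, four colours pairwise at distance at least 3 would need a
  -- circle of length 12.
  K4-uncolorable : ∀ ab ax bx → negTri ab ax bx ✓ → ∀ ay by → negTri ab ay by ✓ → ∀ xy → negTri ax ay xy ✓ →
    ∀ i j → okS ab i j ✓ → ∀ k → okS ax i k ✓ → okS bx j k ✓ → ∀ l → okS ay i l ✓ → okS by j l ✓ → okS xy k l ✓ → ⊥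
  K4-uncolorable = toWitness {a? = allS? λ _ → allS? λ _ → allS? λ _ → imp? (allS? λ _ → allS? λ _ → imp? (allS? λ _ → imp? (
    allF? λ _ → allF? λ _ → imp? (allF? λ _ → imp? (imp? (allF? λ _ → imp? (imp? (imp? (no λ ())))))))))} tt

injective₄ : {X : Set} (φ : Fin 4 → X) → φ (# 0) ≢ φ (# 1) → φ (# 0) ≢ φ (# 2) → φ (# 0) ≢ φ (# 3) →
  φ (# 1) ≢ φ (# 2) → φ (# 1) ≢ φ (# 3) → φ (# 2) ≢ φ (# 3) → ∀ {i j} → φ i ≡ φ j → i ≡ j
injective₄ φ p₁ p₂ p₃ p₄ p₅ p₆ {i} {j} = go i j
  where
    go : ∀ i j → φ i ≡ φ j → i ≡ j
    go zero zero _ = refl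
    go zero (suc zero) e = ⊥-elim (p₁ e)
    go zero (suc (suc zero)) e = ⊥-elim (p₂ e)
    go zero (suc (suc (suc zero))) e = ⊥-elim (p₃ e)
    go (suc zero) zero e = ⊥-elim (p₁ (sym e))
    go (suc zero) (suc zero) _ = refl
    go (suc zero) (suc (suc zero)) e = ⊥-elim (p₄ e)
    go (suc zero) (suc (suc (suc zero))) e = ⊥-elim (p₅ e)
    go (suc (suc zero)) zero e = ⊥-elim (p₂ (sym e))
    go (suc (suc zero)) (suc zero) e = ⊥-elim (p₄ (sym e))
    go (suc (suc zero)) (suc (suc zero)) _ = refl
    go (suc (suc zero)) (suc (suc (suc zero))) e = ⊥-elim (p₆ e)
    go (suc (suc (suc zero))) zero e = ⊥-elim (p₃ (sym e))
    go (suc (suc (suc zero))) (suc zero) e = ⊥-elim (p₅ (sym e))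
    go (suc (suc (suc zero))) (suc (suc zero)) e = ⊥-elim (p₆ (sym e))
    go (suc (suc (suc zero))) (suc (suc (suc zero))) _ = refl

K4-simple : ∀ (k l : Fin 6) → ((K4src k ≡ K4src l) × (K4tgt k ≡ K4tgt l)) ⊎ ((K4src k ≡ K4tgt l) × (K4tgt k ≡ K4src l)) → k ≡ l
K4-simple = toWitness {a? = allF? λ k → allF? λ l →
  ((K4src k ≟ K4src l) ×-dec (K4tgt k ≟ K4tgt l) ⊎-dec (K4src k ≟ K4tgt l) ×-dec (K4tgt k ≟ K4src l)) →-dec (k ≟ l)} tt

switch-star : ∀ p → minus ≡ flipIf (not (isMinus p)) p
switch-star plus = refl
switch-star minus = refl
switch-cross : ∀ p q r → negTri p q r ≡ true → minus ≡ flipIf (not (isMinus p) xor not (isMinus q)) r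
switch-cross plus plus minus _ = refl
switch-cross plus minus plus _ = refl
switch-cross minus plus plus _ = refl
switch-cross minus minus minus _ = refl

module Graph (G : SignedGraph) (crit : Critical G) (¬digon : ¬ SwitchIso G digon) (¬K4 : ¬ SwitchIso G K4minus) where
  private
    Vx = Fin (nV G)
    Ed = Fin (nE G)

  one-sign : ∀ e e′ p q → joins G e p q ≡ true → joins G e′ p q ≡ true → sign G e ≡ plus → sign G e′ ≡ minus → ⊥
  one-sign e e′ p q h h′ s s′ = ¬digon (contains⇒iso G crit digon φ ψ φ-inj ψ-inj jn
      (λ f good → okS-exclusive (f zero) (f (suc zero))
        (subst (λ z → okS z (f zero) (f (suc zero)) ≡ true) s (good zero))
        (subst (λ z → okS z (f zero) (f (suc zero)) ≡ true) s′ (good (suc zero))))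
      (λ _ → false) (λ { zero → sym s ; (suc zero) → sym s′ }))
    where
      φ : Fin 2 → Vx
      φ zero = p
      φ (suc zero) = q
      ψ : Fin 2 → Ed
      ψ zero = e
      ψ (suc zero) = e′
      p≢q : p ≢ q
      p≢q refl with isPair-elim _ _ p p h
      ... | inj₁ (a , b) = loopless G e (trans (sym a) b)
      ... | inj₂ (a , b) = loopless G e (trans (sym b) a)
      φ-inj : ∀ {i j} → φ i ≡ φ j → i ≡ j
      φ-inj {zero} {zero} _ = refl
      φ-inj {suc zero} {suc zero} _ = refl
      φ-inj {zero} {suc zero} z = ⊥-elim (p≢q z)
      φ-inj {suc zero} {zero} z = ⊥-elim (p≢q (sym z))
      e≢e′ : e ≢ e′
      e≢e′ refl with trans (sym s) s′
      ... | ()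
      ψ-inj : ∀ {i j} → ψ i ≡ ψ j → i ≡ j
      ψ-inj {zero} {zero} _ = refl
      ψ-inj {suc zero} {suc zero} _ = refl
      ψ-inj {zero} {suc zero} z = ⊥-elim (e≢e′ z)
      ψ-inj {suc zero} {zero} z = ⊥-elim (e≢e′ (sym z))
      jn : ∀ k → joins G (ψ k) p q ≡ true
      jn zero = h
      jn (suc zero) = h′

  -- Parallel edges of opposite signs would make `G` the digon. An instance therefore loses nothing
  -- by keeping one edge for each adjacent pair.
  same-sign : ∀ e e′ p q → joins G e p q ≡ true → joins G e′ p q ≡ true → sign G e ≡ sign G e′
  same-sign e e′ p q h h′ with sign G e in s | sign G e′ in s′
  ... | plus  | plus  = refl
  ... | minus | minus = refl
  ... | plus  | minus = ⊥-elim (one-sign e e′ p q h h′ s s′)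
  ... | minus | plus  = ⊥-elim (one-sign e′ e p q h′ h s′ s)

  lookupE : List Ed → Vx → Vx → Maybe Ed
  lookupE []       u v = nothing
  lookupE (e ∷ es) u v = if joins G e u v then just e else lookupE es u v

  lookupE-sym : ∀ es u v → lookupE es u v ≡ lookupE es v u
  lookupE-sym []       u v = refl
  lookupE-sym (e ∷ es) u v = cong₂ (λ x y → if x then just e else y) (isPair-sym _ _ u v) (lookupE-sym es u v)

  lookupE-sound : ∀ es u v {e} → lookupE es u v ≡ just e → joins G e u v ≡ true
  lookupE-sound (e ∷ es) u v h with joins G e u v in j
  lookupE-sound (e ∷ es) u v refl | true = j
  ... | false = lookupE-sound es u v h

  lookupE-complete : ∀ es {u v e} → e ∈ es → joins G e u v ≡ true → ∃ λ e′ → lookupE es u v ≡ just e′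
  lookupE-complete (e ∷ es) {u} {v} m h with joins G e u v in j
  ... | true = e , refl
  lookupE-complete (e ∷ es) 1st h | false = ⊥-elim (true≢false h j)
  lookupE-complete (e ∷ es) (there m) h | false = lookupE-complete es m h

  loop-free : ∀ es u → lookupE es u u ≡ nothing
  loop-free es u with lookupE es u u in eq
  ... | nothing = refl
  ... | just e with isPair-elim _ _ u u (lookupE-sound es u u eq)
  ...   | inj₁ (a , b) = ⊥-elim (loopless G e (trans (sym a) b))
  ...   | inj₂ (a , b) = ⊥-elim (loopless G e (trans (sym b) a))

  edgeOf : Vx → Vx → Maybe Ed
  edgeOf = lookupE (allFin (nE G))

  relOf : Maybe Ed → Rel
  relOf nothing  = none
  relOf (just e) = rel (just (sign G e)) false false

  inst : Inst (nV G)
  inst = record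
    { c = λ u v → relOf (edgeOf u v)
    ; csym = λ u v → cong relOf (lookupE-sym (allFin (nE G)) u v)
    ; cirr = λ u → cong relOf (loop-free (allFin (nE G)) u) }

  edge-st : ∀ {e u v} → joins G e u v ≡ true → st (c inst u v) ≡ just (sign G e)
  edge-st {e} {u} {v} h with lookupE-complete (allFin (nE G)) (∈-allFin e) h
  ... | e′ , q = trans (cong (st ∘ relOf) q) (cong just (same-sign e′ e u v (lookupE-sound (allFin (nE G)) u v q) h))

  st-edge : ∀ {u v q} → st (c inst u v) ≡ just q → ∃ λ e → (joins G e u v ≡ true) × (sign G e ≡ q)
  st-edge {u} {v} h with edgeOf u v in eq
  st-edge {u} {v} refl | just e = e , lookupE-sound (allFin (nE G)) u v eq , refl

  noK4 : NoK4 inst (allFin (nV G))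
  noK4 {a} {b} {x} {y} _ _ _ _ (k4 (neg3 {ab} {ax} {bx} e₁ e₂ e₃ n₁) (neg3 {ab′} {ay} {by} e₁′ e₄ e₅ n₂) (neg3 {ax′} {ay′} {xy} e₂′ e₄′ e₆ n₃) _) =
    ¬K4 (contains⇒iso G crit K4minus φ ψ φ-inj ψ-inj jn unc δ sg)
    where
      φ : Fin 4 → Vx
      φ zero = a
      φ (suc zero) = b
      φ (suc (suc zero)) = x
      φ (suc (suc (suc zero))) = y
      pair : Fin 6 → Sign
      pair zero = ab
      pair (suc zero) = ax
      pair (suc (suc zero)) = ay
      pair (suc (suc (suc zero))) = bx
      pair (suc (suc (suc (suc zero)))) = by
      pair (suc (suc (suc (suc (suc zero))))) = xy
      edges : ∀ k → ∃ λ e → (joins G e (φ (K4src k)) (φ (K4tgt k)) ≡ true) × (sign G e ≡ pair k)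
      edges zero = st-edge e₁
      edges (suc zero) = st-edge e₂
      edges (suc (suc zero)) = st-edge e₄
      edges (suc (suc (suc zero))) = st-edge e₃
      edges (suc (suc (suc (suc zero)))) = st-edge e₅
      edges (suc (suc (suc (suc (suc zero))))) = st-edge e₆
      ψ : Fin 6 → Ed
      ψ k = proj₁ (edges k)
      jn : ∀ k → joins G (ψ k) (φ (K4src k)) (φ (K4tgt k)) ≡ true
      jn k = proj₁ (proj₂ (edges k))
      ne : ∀ {u v q} → st (c inst u v) ≡ just q → u ≢ v
      ne {u} e refl with trans (sym e) (cong st (cirr inst u))
      ... | ()
      φ-inj : ∀ {i j} → φ i ≡ φ j → i ≡ j
      φ-inj = injective₄ φ (ne e₁) (ne e₂) (ne e₄) (ne e₃) (ne e₅) (ne e₆)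
      ψ-inj : ∀ {k l} → ψ k ≡ ψ l → k ≡ l
      ψ-inj {k} {l} p with joins-unique G (ψ k) (φ (K4src k)) (φ (K4tgt k)) (φ (K4src l)) (φ (K4tgt l)) (jn k) (subst (λ z → joins G z (φ (K4src l)) (φ (K4tgt l)) ≡ true) (sym p) (jn l))
      ... | inj₁ (r , w) = K4-simple k l (inj₁ (φ-inj r , φ-inj w))
      ... | inj₂ (r , w) = K4-simple k l (inj₂ (φ-inj r , φ-inj w))
      n₂′ : negTri ab ay by ≡ true
      n₂′ = subst (λ z → negTri z ay by ≡ true) (just-inj e₁′ e₁) n₂
      n₃′ : negTri ax ay xy ≡ true
      n₃′ = subst₂ (λ z w → negTri z w xy ≡ true) (just-inj e₂′ e₂) (just-inj e₄′ e₄) n₃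
      unc : ∀ (f : Fin 4 → Color) → (∀ k → okS (sign G (ψ k)) (f (K4src k)) (f (K4tgt k)) ≡ true) → ⊥
      unc f good = K4-uncolorable ab ax bx n₁ ay by n₂′ xy n₃′ (f (# 0)) (f (# 1)) (ok (# 0)) (f (# 2)) (ok (# 1)) (ok (# 3))
          (f (# 3)) (ok (# 2)) (ok (# 4)) (ok (# 5))
        where
          ok : ∀ k → okS (pair k) (f (K4src k)) (f (K4tgt k)) ≡ true
          ok k = subst (λ z → okS z (f (K4src k)) (f (K4tgt k)) ≡ true) (proj₂ (proj₂ (edges k))) (good k)
      -- This switching makes the three edges at `a` negative, and the triangles through `a` then
      -- force the other three.
      δ : Fin 4 → Bool
      δ zero = false
      δ (suc zero) = not (isMinus ab)
      δ (suc (suc zero)) = not (isMinus ax)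
      δ (suc (suc (suc zero))) = not (isMinus ay)
      base : ∀ k → minus ≡ flipIf (δ (K4src k) xor δ (K4tgt k)) (pair k)
      base zero = switch-star ab
      base (suc zero) = switch-star ax
      base (suc (suc zero)) = switch-star ay
      base (suc (suc (suc zero))) = switch-cross ab ax bx n₁
      base (suc (suc (suc (suc zero)))) = switch-cross ab ay by n₂′
      base (suc (suc (suc (suc (suc zero))))) = switch-cross ax ay xy n₃′
      sg : ∀ k → minus ≡ flipIf (δ (K4src k) xor δ (K4tgt k)) (sign G (ψ k))
      sg k = trans (base k) (cong (flipIf (δ (K4src k) xor δ (K4tgt k))) (sym (proj₂ (proj₂ (edges k)))))

  cost-edge : ∀ {u v} → cost (c inst u v) ≢ 0 → ∃ λ e → (joins G e u v ≡ true) × (cost (c inst u v) ≡ 2)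
  cost-edge {u} {v} h with edgeOf u v in eq
  ... | nothing = ⊥-elim (h refl)
  ... | just e  = e , lookupE-sound (allFin (nE G)) u v eq , refl

  star-edges : ∀ u Y → Unique Y → ∃ λ fs → Unique fs × (∀ {e} → e ∈ fs → ∃ λ v → (v ∈ Y) × (joins G e u v ≡ true)) ×
    (κ inst u Y ≤ 2 * length fs)
  star-edges u [] _ = [] , [] , (λ ()) , z≤n
  star-edges u (v ∷ Y) uY with star-edges u Y (Unique-tail uY) | Data.Nat._≟_ (cost (c inst u v)) 0
  ... | fs , ufs , at , l | yes z = fs , ufs , (λ m → let w , m′ , j = at m in w , there m′ , j) ,
        ≤-trans (≤-reflexive (cong (_+ κ inst u Y) z)) l
  ... | fs , ufs , at , l | no nz with cost-edge nz
  ...   | e , j , two = e ∷ fs , fresh ∷ᵘ ufs ,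
        (λ { 1st → v , 1st , j ; (there m) → let w , m′ , j′ = at m in w , there m′ , j′ }) ,
        ≤-trans (+-mono-≤ (≤-reflexive two) l) (≤-reflexive (sym (*-suc 2 (length fs))))
    where
      fresh : e ∉ fs
      fresh m with at m
      ... | w , w∈ , j′ with joins-unique G e u v u w j j′
      ...   | inj₁ (_ , q) = Unique-head uY (subst (_∈ Y) (sym q) w∈)
      ...   | inj₂ (p , q) = Unique-head uY (subst (_∈ Y) (sym (trans q p)) w∈)

  -- Distinct edges witness the adjacent pairs that `cst` charges, so the total cost is at most
  -- twice the number of edges.
  inner-edges : ∀ S → Unique S → ∃ λ es → Unique es × (∀ {e} → e ∈ es → (src G e ∈ S) × (tgt G e ∈ S)) ×
    (cst inst [] S ≤ 2 * length es)
  inner-edges [] _ = [] , [] , (λ ()) , z≤n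
  inner-edges (u ∷ S) uS with inner-edges S (Unique-tail uS) | star-edges u S (Unique-tail uS)
  ... | es , ues , ends , l | fs , ufs , at , l′ = fs ++ es , Unique-++ ufs ues apart , both ,
        ≤-trans (+-mono-≤ l (≤-trans (≤-reflexive (cong (κ inst u) (++-identityʳ S))) l′))
          (≤-reflexive (trans (arith (length es) (length fs)) (cong (2 *_) (sym (length-++ fs)))))
    where
      arith : ∀ x y → 2 * x + 2 * y ≡ 2 * (y + x)
      arith = solve-∀
      apart : ∀ {e} → e ∈ fs → e ∉ es
      apart {e} m m′ with at m
      ... | v , _ , j with isPair-elim _ _ u v j
      ...   | inj₁ (refl , _) = Unique-head uS (proj₁ (ends m′))
      ...   | inj₂ (refl , _) = Unique-head uS (proj₂ (ends m′))
      both : ∀ {e} → e ∈ fs ++ es → (src G e ∈ u ∷ S) × (tgt G e ∈ u ∷ S)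
      both {e} m with ∈-++⁻ fs m
      ... | inj₂ q = there (proj₁ (ends q)) , there (proj₂ (ends q))
      ... | inj₁ q with at q
      ...   | v , v∈ , j with isPair-elim _ _ u v j
      ...     | inj₁ (refl , refl) = 1st , there v∈
      ...     | inj₂ (refl , refl) = there v∈ , 1st

  cst-≤ : ∀ S → Unique S → cst inst [] S ≤ 2 * nE G
  cst-≤ S uS = let es , ues , _ , l = inner-edges S uS in ≤-trans l (*-monoʳ-≤ 2 (length-≤n ues))

  -- Colouring a critical graph with too few edges

  module Dense (sparse-G : 2 * nE G ≤ 3 * nV G) where
    all : List Vx
    all = allFin (nV G)

    length-all : length all ≡ nV G
    length-all = length-tabulate {n = nV G} id

    colouring : ∀ S f → (∀ e → src G e ∈ S → tgt G e ∈ S → K10-3-Edge (sign G e) (f (src G e)) (f (tgt G e))) →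
      Ext inst S (all ∖ S) f → ⊥
    colouring S f inside (f′ , ag , good) = proj₁ crit (f′ , ok)
      where
        L′ = all ∖ S
        place : ∀ v → v ∈ L′ ++ S
        place v with v ∈? S
        ... | yes q = ∈-++⁺ʳ L′ q
        ... | no q  = ∈-++⁺ˡ (∈-∖⁺ (∈-allFin v) q)
        keep : ∀ {v} → v ∈ S → f′ v ≡ f v
        keep {v} m = ag v (λ k → proj₂ (∈-∖⁻ all k) m)
        ok : ∀ e → K10-3-Edge (sign G e) (f′ (src G e)) (f′ (tgt G e))
        ok e with src G e ∈? S | tgt G e ∈? S
        ... | yes p | yes q = subst₂ (K10-3-Edge (sign G e)) (sym (keep p)) (sym (keep q)) (inside e p q)
        ... | no p | _ = okS-sound (sign G e) _ _ (strongOK (good (∈-∖⁺ (∈-allFin _) p) (place (tgt G e))) (sign G e) (edge-st (joins-ends G e)))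
        ... | yes _ | no q = okS-sound (sign G e) _ _ (okS-sym (sign G e) _ _
              (strongOK (good (∈-∖⁺ (∈-allFin _) q) (place (src G e))) (sign G e)
                (trans (cong st (csym inst (tgt G e) (src G e))) (edge-st (joins-ends G e)))))

    -- Colour a set S of smallest potential by criticality; every set then has nonnegative potential relative to S.
    dense : ∀ k S → Unique S → 3 * length S < cst inst [] S → 2 * nE G + 3 * length S < cst inst [] S + k → ⊥
    -- The number `k` bounds how far the potential of `S` can still fall; at zero it would lie below
    -- `- 2 * nE G`, although `cst` never exceeds `2 * nE G`.
    dense zero S uS d l = <⇒≱ l (≤-trans (≤-reflexive (+-identityʳ _)) (≤-trans (cst-≤ S uS) (m≤m+n _ _)))
    dense (suc k) S uS d l = extend _ inst S (all ∖ S) f ≤-refl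
        (Unique-++ (Unique-∖ (UP.allFin⁺ (nV G))) uS (λ m → proj₂ (∈-∖⁻ all m))) sp (NoK4-st (λ _ _ → refl) ∖-⊆ noK4)
        (colouring S f (λ e p q → proj₂ coloured e (∧-intro (yes! (src G e) p) (yes! (tgt G e) q))))
      where
        yes! : ∀ v → v ∈ S → does (v ∈? S) ≡ true
        yes! v m with v ∈? S
        ... | yes _ = refl
        ... | no q  = ⊥-elim (q m)
        H : Subgraph G
        H = record { inV = λ v → does (v ∈? S) ; inE = λ e → does (src G e ∈? S) ∧ does (tgt G e ∈? S)
                   ; closed = λ e h → ∧-elim {does (src G e ∈? S)} h }
        -- The whole vertex set has nonnegative potential by `sparse-G`, so a set of negative
        -- potential leaves a vertex out, and criticality colours it.
        short : length S < length all
        short = *-cancelˡ-< 3 _ _ (≤-trans d (≤-trans (cst-≤ S uS) (≤-trans sparse-G (≤-reflexive (cong (3 *_) (sym length-all))))))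
        proper : Proper H
        proper with pigeonhole all S (UP.allFin⁺ (nV G)) short
        ... | v , _ , q = inj₁ (v , out)
          where
            out : does (v ∈? S) ≡ false
            out with v ∈? S
            ... | yes m = ⊥-elim (q m)
            ... | no _  = refl
        coloured : SubColorable H
        coloured = proj₂ crit H proper
        f : Vx → Color
        f = proj₁ coloured
        sp : Sparse inst S (all ∖ S)
        sp T uT sT with cst inst S T ≤? 3 * length T
        ... | yes q = q
        -- A set `T` of negative potential relative to `S` makes the union worse than `S` by at
        -- least 1. This descent replaces the choice of a set of least potential.
        ... | no q = ⊥-elim (dense k (T ++ S) (Unique-++ uT uS (λ m → proj₂ (∈-∖⁻ all (sT m)))) d′ l′)
          where
            split : cst inst [] (T ++ S) ≡ cst inst S T + cst inst [] S
            split = trans (cst-++ inst [] T S) (cong (λ z → cst inst z T + cst inst [] S) (++-identityʳ S))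
            arith₁ : ∀ t s x y → suc (3 * (t + s)) + (x + y) + 1 ≡ x + y + (suc (3 * t) + suc (3 * s))
            arith₁ = solve-∀
            d′ : 3 * length (T ++ S) < cst inst [] (T ++ S)
            d′ = subst₂ (λ a b → 3 * a < b) (sym (length-++ T)) (sym split)
              (lin 1 (+-mono-≤ (≰⇒> q) d) (arith₁ (length T) (length S) (cst inst S T) (cst inst [] S)))
            arith₂ : ∀ m t s x y k → suc (m + 3 * (t + s)) + (x + (y + suc k)) + 0 ≡ (x + y + k) + (suc (3 * t) + suc (m + 3 * s))
            arith₂ = solve-∀
            l′ : 2 * nE G + 3 * length (T ++ S) < cst inst [] (T ++ S) + k
            l′ = subst₂ (λ a b → 2 * nE G + 3 * a < b + k) (sym (length-++ T)) (sym split)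
              (lin 0 (+-mono-≤ (≰⇒> q) l) (arith₂ (2 * nE G) (length T) (length S) (cst inst S T) (cst inst [] S) k))

    -- Any set of negative potential is refuted by `dense`, so the extension statement applies to
    -- the whole graph with nothing precoloured.
    contradiction! : ⊥
    contradiction! = extend _ inst [] (all ∖ []) (λ _ → zero) ≤-refl
      (Unique-++ (Unique-∖ (UP.allFin⁺ (nV G))) [] (λ _ ())) sp (NoK4-st (λ _ _ → refl) ∖-⊆ noK4)
      (colouring [] (λ _ → zero) (λ e ()))
      where
        sp : Sparse inst [] (all ∖ [])
        sp T uT sT with cst inst [] T ≤? 3 * length T
        ... | yes q = q
        ... | no q = ⊥-elim (dense _ T uT (≰⇒> q) (≤-trans ≤-refl (m≤n+m _ (cst inst [] T))))

theorem1p3 : (G : SignedGraph) → Critical G →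
    ¬ SwitchIso G digon → ¬ SwitchIso G K4minus →
    3 * nV G + 1 ≤ 2 * nE G
theorem1p3 G crit ¬d ¬k with (3 * nV G + 1) ≤? (2 * nE G)
... | yes q = q
... | no q  = ⊥-elim (Graph.Dense.contradiction! G crit ¬d ¬k
                (+-cancelʳ-≤ 1 _ _ (≤-trans (≤-reflexive (+-comm _ 1)) (≰⇒> q))))
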